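{- Let $D\ge2$ be a fixed integer and let $m$ be a fixed positive integer. The asymptotic probability (as $n\to\infty$) that a uniformly random graph encoded manifold (GEM) $g\in\mathcal{GEM}=\mathcal{GEM}(D)$ of dimension $D$ and size $2n$ has $m$ connected components satisfies $$\mathbb P(g\text{ has }m\text{ connected components})\approx\sum_{k\ge0}\mathfrak d_{2k,m}(\mathcal{GEM})\cdot\binom{2n}{2k}\cdot\left(\frac{(2(n-k)-1)!!}{(2n-1)!!}\right)^{D+1},$$ where $$\begin{aligned}\mathfrak d_{k,m}(\mathcal{GEM})&=\#\{(g',g'')\in\mathcal{GEM}_i\cdot\mathcal{GEM}_{k-i}\mid0\le i\le k,\ \pi_0(g')=m-1,\ \pi_0(g'')\text{ is even}\}\\&\quad-\#\{(g',g'')\in\mathcal{GEM}_i\cdot\mathcal{GEM}_{k-i}\mid0\le i\le k,\ \pi_0(g')=m-1,\ \pi_0(g'')\text{ is odd}\}\end{aligned}$$ and $\pi_0(g)$ is the number of connected components of the GEM $g$.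
   Context: A GEM of dimension $D$ and size $N$ is obtained from $N$ simplices of dimension $D$ labeled by $[N]=\{1,\dots,N\}$ (or any set of size $N$), each with vertices labeled $1,\dots,D+1$, by choosing perfect matchings $\alpha_1,\dots,\alpha_{D+1}$ of the set of simplices and gluing, for each $i$ and $k$, the hyperface opposite to the $k$th vertex of the $i$th simplex to the hyperface opposite to the $k$th vertex of the $\alpha_k(i)$th simplex. Equivalently, it is a $(D+1)$-regular (multi)graph on $N$ labeled vertices with edges colored by $[D+1]$ in which each vertex is incident to exactly one edge of each color, i.e. a $(D+1)$-tuple of perfect matchings of the label set. There are $((2n-1)!!)^{D+1}$ GEMs of size $2n$ and none of odd size (with $(-1)!!=1$; for size $0$ there is one, the empty GEM, with $0$ components). Connected components are those of this graph. $\mathcal{GEM}_i$ denotes GEMs of dimension $D$ and size $i$; $(g',g'')\in\mathcal{GEM}_i\cdot\mathcal{GEM}_{k-i}$ means an ordered pair such that, for some decomposition $[k]=U'\sqcup U''$ with $|U'|=i$, $|U''|=k-i$, $g'$ is a GEM labeled by $U'$ and $g''$ is a GEM labeled by $U''$ (all decompositions are counted). Notation $\approx$: $p_n\approx\sum_{k\ge0}c_kg_k(n)$ (here $g_k(n)=\binom{2n}{2k}\big((2(n-k)-1)!!/(2n-1)!!\big)^{D+1}$) means that $g_{k+1}(n)=o(g_k(n))$ for every $k$ and, for every integer $r\ge0$, $p_n=\sum_{k=0}^rc_kg_k(n)+O(g_{r+1}(n))$ as $n\to\infty$. -}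

module Defs where

open import Data.Nat.Base as ℕ using (ℕ; zero; suc; NonZero; _∸_)
open import Data.Nat.Properties as ℕ using ()
open import Data.Nat.Combinatorics using (_C_)
open import Data.Nat.Divisibility using (_∣?_)
open import Data.Integer.Base as ℤ using (ℤ; +_)
open import Data.Rational.Base as ℚ using (ℚ; 0ℚ; _/_)
import Data.Rational.Properties as ℚ
open import Data.Fin.Base using (Fin; toℕ; opposite)
open import Data.Fin.Properties as Fin using (all?; any?)
open import Data.Fin.Subset using (Subset; _∈_; _∉_; ∣_∣; ∁; ⊤; inside; outside)
open import Data.Fin.Subset.Properties using (_∈?_; ∈⊤)
open import Data.Vec.Base as Vec using (Vec; []; _∷_; lookup)
import Data.Vec.Properties as Vec
open import Data.List.Base as List
  using (List; []; _∷_; [_]; length; filter; deduplicate; concatMap; upTo; allFin;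
         cartesianProduct; cartesianProductWith)
open import Data.List.Membership.Propositional as List using ()
import Data.List.Membership.Propositional.Properties as List
open import Data.List.Relation.Unary.Any using (here; there)
open import Data.Product using (∃; _×_; _,_; proj₁; proj₂)
open import Data.Sum using (_⊎_; inj₁; inj₂)
open import Function.Base using (_∘_)
open import Relation.Binary using (Rel; Decidable)
open import Relation.Binary.Construct.Closure.ReflexiveTransitive using (Star; ε; _◅_; _◅◅_; gmap)
open import Relation.Binary.PropositionalEquality
  using (_≡_; _≢_; refl; sym; trans; cong; subst; module ≡-Reasoning)
open import Relation.Nullary using (Dec; yes; no; ¬?; _×-dec_; _→-dec_; _⊎-dec_; contradiction)
import Relation.Nullary.Decidable as Dec
open import Level using (0ℓ)
import Algebra.Bundles as Bundles
import Algebra.Properties.Semiring.Exp as Exp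

-- A perfect matching of a label set U ⊆ Fin n is an involution of U without
-- fixed points.  It is stored as the table of the involution of Fin n that
-- extends it by the identity outside U, so that each perfect matching of U
-- has exactly one table.
IsPerfectMatching : ∀ {n} → Subset n → Vec (Fin n) n → Set
IsPerfectMatching U α =
  (∀ i → lookup α (lookup α i) ≡ i) ×
  (∀ i → (i ∈ U → lookup α i ≢ i) × (i ∉ U → lookup α i ≡ i))

isPerfectMatching? : ∀ {n} (U : Subset n) α → Dec (IsPerfectMatching U α)
isPerfectMatching? U α =
  all? (λ i → lookup α (lookup α i) Fin.≟ i) ×-dec
  all? (λ i → ((i ∈? U) →-dec ¬? (lookup α i Fin.≟ i)) ×-dec
              (¬? (i ∈? U) →-dec (lookup α i Fin.≟ i)))

Matchings : ℕ → ℕ → Set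
Matchings D n = Vec (Vec (Fin n) n) (suc D)

-- g is a GEM of dimension D labelled by U; a GEM of size n is the case U = ⊤.
IsGEM : ∀ {D n} → Subset n → Matchings D n → Set
IsGEM U g = ∀ c → IsPerfectMatching U (lookup g c)

isGEM? : ∀ {D n} (U : Subset n) (g : Matchings D n) → Dec (IsGEM U g)
isGEM? U g = all? (λ c → isPerfectMatching? U (lookup g c))

-- All vectors of length n with entries from xs; without repetition when xs
-- has none.
vectors : ∀ {A : Set} → List A → ∀ n → List (Vec A n)
vectors xs zero    = [ [] ]
vectors xs (suc n) = cartesianProductWith _∷_ xs (vectors xs n)

subsets : ∀ n → List (Subset n)
subsets = vectors (inside ∷ outside ∷ [])

gems : ∀ D {n} → Subset n → List (Matchings D n)
gems D {n} U = filter (isGEM? U) (vectors (vectors (allFin n) n) (suc D))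

Adjacent : ∀ {D n} → Matchings D n → Rel (Fin n) 0ℓ
Adjacent g u v = ∃ λ c → lookup (lookup g c) u ≡ v

-- For a GEM, Adjacent is symmetric (each colour is an involution), so this
-- is the equivalence relation of being joined by a path.
Connected : ∀ {D n} → Matchings D n → Rel (Fin n) 0ℓ
Connected g = Star (Adjacent g)

-- Reachability for a decidable relation on Fin n, adding one edge at a time.
module _ {n : ℕ} where

  Edge : List (Fin n × Fin n) → Rel (Fin n) 0ℓ
  Edge es u v = (u , v) List.∈ es

  path-∷⁻ : ∀ {a b es u v} → Star (Edge ((a , b) ∷ es)) u v →
            Star (Edge es) u v ⊎ (Star (Edge es) u a × Star (Edge es) b v)
  path-∷⁻ ε = inj₁ ε
  path-∷⁻ (here refl ◅ p) with path-∷⁻ p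
  ... | inj₁ q       = inj₂ (ε , q)
  ... | inj₂ (_ , q) = inj₂ (ε , q)
  path-∷⁻ (there e ◅ p) with path-∷⁻ p
  ... | inj₁ q       = inj₁ (e ◅ q)
  ... | inj₂ (q , r) = inj₂ (e ◅ q , r)

  path-∷⁺ : ∀ {a b es u v} →
            Star (Edge es) u v ⊎ (Star (Edge es) u a × Star (Edge es) b v) →
            Star (Edge ((a , b) ∷ es)) u v
  path-∷⁺ (inj₁ p)       = gmap (λ x → x) there p
  path-∷⁺ (inj₂ (p , q)) = gmap (λ x → x) there p ◅◅ (here refl ◅ gmap (λ x → x) there q)

  path? : ∀ es → Decidable (Star (Edge es))
  path? [] u v with u Fin.≟ v
  ... | yes refl = yes ε
  ... | no u≢v   = no λ { ε → u≢v refl }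
  path? ((a , b) ∷ es) u v =
    Dec.map′ path-∷⁺ path-∷⁻ (path? es u v ⊎-dec (path? es u a ×-dec path? es b v))

  star? : ∀ {R : Rel (Fin n) 0ℓ} → Decidable R → Decidable (Star R)
  star? {R} R? u v = Dec.map′ (gmap (λ x → x) from) (gmap (λ x → x) to) (path? es u v)
    where
    R′? : ∀ e → Dec (R (proj₁ e) (proj₂ e))
    R′? e = R? (proj₁ e) (proj₂ e)

    es : List (Fin n × Fin n)
    es = filter R′? (cartesianProduct (allFin n) (allFin n))

    from : ∀ {x y} → Edge es x y → R x y
    from = proj₂ ∘ List.∈-filter⁻ R′? {xs = cartesianProduct (allFin n) (allFin n)}

    to : ∀ {x y} → R x y → Edge es x y
    to r = List.∈-filter⁺ R′? (List.∈-cartesianProduct⁺ (List.∈-allFin _) (List.∈-allFin _)) r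

connected? : ∀ {D n} (g : Matchings D n) → Decidable (Connected g)
connected? g = star? (λ u v → any? (λ c → lookup (lookup g c) u Fin.≟ v))

-- The number of components of a GEM g labelled by U: deduplication keeps one
-- representative in U of each class of Connected g.
π₀ : ∀ {D n} → Subset n → Matchings D n → ℕ
π₀ {n = n} U g = length (deduplicate (connected? g) (filter (_∈? U) (allFin n)))

-- (U′ , g′ , g″) stands for the pair (g′ , g″) with decomposition
-- [k] = U′ ⊔ ∁ U′.
Pair : ℕ → ℕ → Set
Pair D k = Subset k × Matchings D k × Matchings D k

-- 𝒢ℰℳ_i · 𝒢ℰℳ_{k-i}
pairs : ∀ D k → ℕ → List (Pair D k)
pairs D k i =
  concatMap (λ U′ → List.map (U′ ,_) (cartesianProduct (gems D U′) (gems D (∁ U′))))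
            (filter (λ U′ → ∣ U′ ∣ ℕ.≟ i) (subsets k))

π₀′ π₀″ : ∀ {D k} → Pair D k → ℕ
π₀′ (U′ , g′ , g″) = π₀ U′ g′
π₀″ (U′ , g′ , g″) = π₀ (∁ U′) g″

evenPairs oddPairs : ∀ D k m → List (Pair D k)
evenPairs D k m =
  filter (λ x → (π₀′ x ℕ.≟ m ∸ 1) ×-dec (2 ∣? π₀″ x))
         (concatMap (pairs D k) (upTo (suc k)))
oddPairs D k m =
  filter (λ x → (π₀′ x ℕ.≟ m ∸ 1) ×-dec ¬? (2 ∣? π₀″ x))
         (concatMap (pairs D k) (upTo (suc k)))

𝔡 : ∀ (D k m : ℕ) → ℤ
𝔡 D k m = + length (evenPairs D k m) ℤ.- + length (oddPairs D k m)

∈-vectors : ∀ {A : Set} {xs : List A} → (∀ x → x List.∈ xs) →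
            ∀ {n} (v : Vec A n) → v List.∈ vectors xs n
∈-vectors all []      = here refl
∈-vectors all (x ∷ v) = List.∈-cartesianProductWith⁺ _∷_ (all x) (∈-vectors all v)

opposite-≢ : ∀ n (i : Fin (2 ℕ.* n)) → opposite i ≢ i
opposite-≢ n i eq = ℕ.even≢odd n (toℕ i) (begin
  2 ℕ.* n                                        ≡⟨ ℕ.m∸n+n≡m (Fin.toℕ<n i) ⟨
  (2 ℕ.* n ∸ suc (toℕ i)) ℕ.+ suc (toℕ i)        ≡⟨ cong (ℕ._+ suc (toℕ i)) (Fin.opposite-prop i) ⟨
  toℕ (opposite i) ℕ.+ suc (toℕ i)               ≡⟨ cong (λ j → toℕ j ℕ.+ suc (toℕ i)) eq ⟩
  toℕ i ℕ.+ suc (toℕ i)                          ≡⟨ ℕ.+-suc (toℕ i) (toℕ i) ⟩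
  suc (toℕ i ℕ.+ toℕ i)                          ≡⟨ cong (λ j → suc (toℕ i ℕ.+ j)) (ℕ.+-identityʳ (toℕ i)) ⟨
  suc (2 ℕ.* toℕ i)                              ∎)
  where open ≡-Reasoning

oppositeGEM : ∀ D n → ∃ λ (g : Matchings D (2 ℕ.* n)) → IsGEM ⊤ g
oppositeGEM D n = Vec.replicate (suc D) α , λ c →
  subst (IsPerfectMatching ⊤) (sym (Vec.lookup-replicate c α))
    ( (λ i → trans (look _) (trans (cong opposite (look i)) (Fin.opposite-involutive i)))
    , (λ i → (λ _ → subst (_≢ i) (sym (look i)) (opposite-≢ n i))
           , (λ i∉⊤ → contradiction ∈⊤ i∉⊤)))
  where
  α = Vec.tabulate opposite

  look : ∀ i → lookup α i ≡ opposite i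
  look = Vec.lookup∘tabulate opposite

gems-nonZero : ∀ D n → NonZero (length (gems D {2 ℕ.* n} ⊤))
gems-nonZero D n = nonEmpty (List.∈-filter⁺ (isGEM? ⊤)
    (∈-vectors (∈-vectors List.∈-allFin) (proj₁ (oppositeGEM D n)))
    (proj₂ (oppositeGEM D n)))
  where
  nonEmpty : ∀ {A : Set} {x : A} {xs} → x List.∈ xs → NonZero (length xs)
  nonEmpty (here _)  = _
  nonEmpty (there _) = _

-- The probability that a uniformly random GEM of dimension D and size 2n has
-- m components.
ℙ : ∀ (D m n : ℕ) → ℚ
ℙ D m n =
  _/_ (+ length (filter (λ g → π₀ ⊤ g ℕ.≟ m) (gems D {2 ℕ.* n} ⊤)))
      (length (gems D {2 ℕ.* n} ⊤)) {{gems-nonZero D n}}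

open Exp (Bundles.CommutativeRing.semiring ℚ.+-*-commutativeRing) public
  using () renaming (_^_ to _^ℚ_)

-- ⟦2 n -1⟧!! is (2n - 1)!!, with (-1)!! = 1.
⟦2_-1⟧!! : ℕ → ℕ
⟦2 zero  -1⟧!! = 1
⟦2 suc n -1⟧!! = (2 ℕ.* suc n ∸ 1) ℕ.* ⟦2 n -1⟧!!

doubleFactorial-nonZero : ∀ n → NonZero ⟦2 n -1⟧!!
doubleFactorial-nonZero zero    = _
doubleFactorial-nonZero (suc n) = ℕ.m*n≢0 (2 ℕ.* suc n ∸ 1) ⟦2 n -1⟧!!
  {{subst NonZero (sym (ℕ.+-suc n (n ℕ.+ 0))) _}} {{doubleFactorial-nonZero n}}

-- For k > n the binomial coefficient vanishes, so that the truncation in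
-- n ∸ k plays no role.
gauge : ∀ (D k n : ℕ) → ℚ
gauge D k n =
  (+ ((2 ℕ.* n) C (2 ℕ.* k)) / 1) ℚ.*
  (_/_ (+ ⟦2 n ∸ k -1⟧!!) ⟦2 n -1⟧!! {{doubleFactorial-nonZero n}}) ^ℚ suc D

infix 4 _=O_ _=o_

_=O_ : (ℕ → ℚ) → (ℕ → ℚ) → Set
f =O g = ∃ λ (K : ℚ) → ∃ λ (n₀ : ℕ) → ∀ n → n₀ ℕ.≤ n → ℚ.∣ f n ∣ ℚ.≤ K ℚ.* ℚ.∣ g n ∣

_=o_ : (ℕ → ℚ) → (ℕ → ℚ) → Set
f =o g = ∀ (δ : ℚ) → 0ℚ ℚ.< δ →
         ∃ λ (n₀ : ℕ) → ∀ n → n₀ ℕ.≤ n → ℚ.∣ f n ∣ ℚ.≤ δ ℚ.* ℚ.∣ g n ∣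

-- f 0 + … + f r
sum≤ : ℕ → (ℕ → ℚ) → ℚ
sum≤ zero    f = f zero
sum≤ (suc r) f = sum≤ r f ℚ.+ f (suc r)

infix 4 _≈∑_·_

-- p ≈∑ c · g  is  p_n ≈ ∑_{k ≥ 0} c_k g_k(n).
_≈∑_·_ : (ℕ → ℚ) → (ℕ → ℚ) → (ℕ → ℕ → ℚ) → Set
p ≈∑ c · g =
  (∀ k → g (suc k) =o g k) ×
  (∀ r → (λ n → p n ℚ.- sum≤ r (λ k → c k ℚ.* g k n)) =O g (suc r))

{-# OPTIONS --safe #-}
-- Gluing a GEM g on [2n] from a pair counted by 𝔡 on a vertex set W and an
-- arbitrary GEM on the complement of W turns the partial sum up to k = r, times
-- the number of GEMs, into a sum over g of the alternating weight of the pairs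
-- of disjoint closed sets of g (unions of components) of total size at most 2r.
-- If g has a component missing at most 2r vertices, inclusion-exclusion over
-- the remaining components collapses this weight to the indicator of g having m
-- components.  Otherwise both are at most the number of chains U ⊆ W ⊆ V of
-- closed sets with more than 2r vertices inside and outside V.  Summed over g,
-- these chains number at most a constant times
-- ∑_u (2n choose 2u) ((2u - 1)!! (2(n - u) - 1)!!)^(D+1) over r < u < n - r;
-- the terms are smallest in the middle and, as D ≥ 2, drop by a factor of order
-- n after the first one, so the sum is of the order of its first term.

module Submission where

open import Defs
open import Data.Bool.Base using (true; false; if_then_else_; _xor_)
import Data.Bool.Properties as Bool
open import Data.Unit.Base using (tt)
open import Data.Nat.Base as ℕ
  using (ℕ; zero; suc; NonZero; _≤_; _<_; _+_; _*_; _∸_; _^_; _!; z≤n; s≤s)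
import Data.Nat.Properties as ℕ
open import Data.Nat.Combinatorics
  using (_C_; nCn≡1; nCk≡nC[n∸k]; nCk≡n!/k![n-k]!; k![n∸k]!∣n!; k>n⇒nCk≡0; nCk+nC[k+1]≡[n+1]C[k+1])
import Data.Nat.DivMod as ℕ
open import Data.Nat.Divisibility as ℕ using (_∣?_; divides)
open import Data.Integer.Base as ℤ using (ℤ; +_; 0ℤ; 1ℤ)
import Data.Integer.Properties as ℤ
open import Data.Rational.Base as ℚ using (ℚ; 0ℚ; _/_)
import Data.Rational.Properties as ℚ
open import Data.Rational.Unnormalised.Base as ℚᵘ using (mkℚᵘ; *≡*; *≤*)
import Data.Rational.Unnormalised.Properties as ℚᵘ
open import Data.Fin.Base as Fin using (Fin; zero; suc)
import Data.Fin.Properties as Fin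
open import Data.Fin.Subset as Subset
  using (Subset; _∈_; _∉_; _⊆_; ∣_∣; ∁; ⊤; ⊥; _∪_; _─_; ⁅_⁆; inside; outside)
open import Data.Fin.Subset.Properties
open import Data.Vec.Base as Vec using (Vec; []; _∷_; lookup; tabulate)
import Data.Vec.Properties as Vec
open import Data.List.Base as List
  using (List; []; _∷_; _++_; length; filter; deduplicate; concatMap; upTo; allFin;
         cartesianProduct; cartesianProductWith)
import Data.List.Properties as List
import Data.List.Membership.Propositional as List using (_∈_; _∉_)
import Data.List.Membership.Propositional.Properties as List
open import Data.List.Relation.Unary.Any using (here; there)
open import Data.List.Relation.Unary.All as All using (All; []; _∷_)
open import Data.List.Relation.Unary.AllPairs using ([]; _∷_)
open import Data.List.Relation.Unary.Unique.Propositional using (Unique)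
import Data.List.Relation.Unary.Unique.Propositional.Properties as Unique
open import Data.Product using (∃; _×_; _,_; proj₁; proj₂)
open import Data.Sum using (_⊎_; inj₁; inj₂)
open import Function.Base using (_∘_; id; case_of_)
open import Relation.Binary using (Rel; DecidableEquality)
import Relation.Binary as Rel
open import Relation.Unary using (Decidable)
open import Relation.Binary.Construct.Closure.ReflexiveTransitive using (ε; _◅_; _◅◅_; gmap; reverse)
open import Relation.Binary.PropositionalEquality
  using (_≡_; _≢_; refl; sym; trans; cong; cong₂; subst; subst₂; module ≡-Reasoning)
open import Relation.Nullary using (Dec; yes; no; does; ¬_; ¬?; _×-dec_; _→-dec_; contradiction)
import Relation.Nullary.Decidable as Dec
open import Level using (0ℓ)
import Data.Product.Properties as Product
import Data.Integer.Tactic.RingSolver as ℤSolver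
import Data.Nat.Tactic.RingSolver as ℕSolver

-- Finite sums of integers

-- The obstacle is that inclusion-exclusion cancels only next to a giant component. Elsewhere
-- absolute values must be summed, and the plain count of small closed pairs U ⊆ W, summed over all
-- GEMs, would be dominated by the GEMs that do have a giant component. The extra set V repairs
-- this: it can only exist in quantity when no component is giant, and it can be counted exactly by
-- cutting the GEM along V, then W, then U. Above every small closed W such a V exists once n > 3r:
-- either the complement of one large component serves, or components are added to W until its size
-- passes 2r. Given V, the choices of W and U cost only a constant: the ways to split a set into two
-- parts with a GEM on each are at most 4 times as many as the GEMs on the whole set. What remains
-- is a sum of at most n + 1 terms. The two extreme ones are equal, and each inner one is at most
-- the next term, whose loss of a factor n pays for the number of terms. All of this is done with
-- integer counts; division by (2n - 1)!!^(D+1) comes last.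

infix 6 ∑
∑ : ∀ {A : Set} → List A → (A → ℤ) → ℤ
∑ []       f = 0ℤ
∑ (x ∷ xs) f = f x ℤ.+ ∑ xs f

syntax ∑ xs (λ x → e) = ∑[ x ∈ xs ] e

𝟙 : ∀ {P : Set} → Dec P → ℤ
𝟙 P? = if does P? then 1ℤ else 0ℤ

private
  variable
    A B X : Set
    P Q : Set

𝟙-yes : (P? : Dec P) → P → 𝟙 P? ≡ 1ℤ
𝟙-yes (yes _) _ = refl
𝟙-yes (no ¬p) p = contradiction p ¬p

𝟙-no : (P? : Dec P) → ¬ P → 𝟙 P? ≡ 0ℤ
𝟙-no (yes p) ¬p = contradiction p ¬p
𝟙-no (no _)  _  = refl

𝟙-cong : (P? : Dec P) (Q? : Dec Q) → (P → Q) → (Q → P) → 𝟙 P? ≡ 𝟙 Q?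
𝟙-cong (yes p) Q? f g = sym (𝟙-yes Q? (f p))
𝟙-cong (no ¬p) Q? f g = sym (𝟙-no Q? (¬p ∘ g))

𝟙-× : (P? : Dec P) (Q? : Dec Q) → 𝟙 (P? ×-dec Q?) ≡ 𝟙 P? ℤ.* 𝟙 Q?
𝟙-× (yes _) (yes _) = refl
𝟙-× (yes _) (no _)  = refl
𝟙-× (no _)  Q?      = refl

𝟙-*-cong : ∀ (P? : Dec P) {x y} → (P → x ≡ y) → 𝟙 P? ℤ.* x ≡ 𝟙 P? ℤ.* y
𝟙-*-cong (yes p) e = cong (1ℤ ℤ.*_) (e p)
𝟙-*-cong (no _)  e = refl

𝟙≥0 : (P? : Dec P) → 0ℤ ℤ.≤ 𝟙 P?
𝟙≥0 (yes _) = ℤ.+≤+ z≤n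
𝟙≥0 (no _)  = ℤ.≤-refl

𝟙-*≥0 : ∀ (P? : Dec P) {x} → 0ℤ ℤ.≤ x → 0ℤ ℤ.≤ 𝟙 P? ℤ.* x
𝟙-*≥0 (yes _) {x} x≥0 = subst (0ℤ ℤ.≤_) (sym (ℤ.*-identityˡ x)) x≥0
𝟙-*≥0 (no _)      _   = ℤ.≤-refl

𝟙-*-mono : ∀ (P? : Dec P) {x y} → (P → x ℤ.≤ y) → 𝟙 P? ℤ.* x ℤ.≤ 𝟙 P? ℤ.* y
𝟙-*-mono (yes p) e = ℤ.*-monoˡ-≤-nonNeg 1ℤ (e p)
𝟙-*-mono (no _)  e = ℤ.≤-refl

∑-cong : ∀ (xs : List A) {f g : A → ℤ} → (∀ x → x List.∈ xs → f x ≡ g x) → ∑ xs f ≡ ∑ xs g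
∑-cong []       e = refl
∑-cong (x ∷ xs) e = cong₂ ℤ._+_ (e x (here refl)) (∑-cong xs (λ y → e y ∘ there))

∑-ext : ∀ (xs : List A) {f g : A → ℤ} → (∀ x → f x ≡ g x) → ∑ xs f ≡ ∑ xs g
∑-ext xs e = ∑-cong xs (λ x _ → e x)

∑-zero : ∀ (xs : List A) → ∑[ x ∈ xs ] 0ℤ ≡ 0ℤ
∑-zero []       = refl
∑-zero (x ∷ xs) = trans (ℤ.+-identityˡ _) (∑-zero xs)

∑-+ : ∀ (xs : List A) (f g : A → ℤ) → ∑ xs (λ x → f x ℤ.+ g x) ≡ ∑ xs f ℤ.+ ∑ xs g
∑-+ []       f g = refl
∑-+ (x ∷ xs) f g rewrite ∑-+ xs f g = ring (f x) (g x) (∑ xs f) (∑ xs g)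
  where
  ring : ∀ a b c d → a ℤ.+ b ℤ.+ (c ℤ.+ d) ≡ a ℤ.+ c ℤ.+ (b ℤ.+ d)
  ring = ℤSolver.solve-∀

∑-*ˡ : ∀ (c : ℤ) (xs : List A) (f : A → ℤ) → ∑ xs (λ x → c ℤ.* f x) ≡ c ℤ.* ∑ xs f
∑-*ˡ c []       f = sym (ℤ.*-zeroʳ c)
∑-*ˡ c (x ∷ xs) f = trans (cong (ℤ._+_ (c ℤ.* f x)) (∑-*ˡ c xs f)) (sym (ℤ.*-distribˡ-+ c (f x) (∑ xs f)))

∑-*ʳ : ∀ (c : ℤ) (xs : List A) (f : A → ℤ) → ∑ xs (λ x → f x ℤ.* c) ≡ ∑ xs f ℤ.* c
∑-*ʳ c xs f = trans (∑-ext xs (λ x → ℤ.*-comm (f x) c)) (trans (∑-*ˡ c xs f) (ℤ.*-comm c _))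

∑-neg : ∀ (xs : List A) (f : A → ℤ) → ∑ xs (λ x → ℤ.- f x) ≡ ℤ.- ∑ xs f
∑-neg []       f = refl
∑-neg (x ∷ xs) f = trans (cong (ℤ._+_ (ℤ.- f x)) (∑-neg xs f)) (sym (ℤ.neg-distrib-+ (f x) (∑ xs f)))

∑-- : ∀ (xs : List A) (f g : A → ℤ) → ∑ xs (λ x → f x ℤ.- g x) ≡ ∑ xs f ℤ.- ∑ xs g
∑-- xs f g = trans (∑-+ xs f (λ x → ℤ.- g x)) (cong (ℤ._+_ (∑ xs f)) (∑-neg xs g))

∑-swap : ∀ (xs : List A) (ys : List B) (f : A → B → ℤ) →
         ∑[ x ∈ xs ] ∑[ y ∈ ys ] f x y ≡ ∑[ y ∈ ys ] ∑[ x ∈ xs ] f x y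
∑-swap []       ys f = sym (∑-zero ys)
∑-swap (x ∷ xs) ys f =
  trans (cong (ℤ._+_ (∑ ys (f x))) (∑-swap xs ys f)) (sym (∑-+ ys (f x) (λ y → ∑ xs (λ x → f x y))))

∑-++ : ∀ (xs ys : List A) (f : A → ℤ) → ∑ (xs ++ ys) f ≡ ∑ xs f ℤ.+ ∑ ys f
∑-++ []       ys f = sym (ℤ.+-identityˡ _)
∑-++ (x ∷ xs) ys f = trans (cong (ℤ._+_ (f x)) (∑-++ xs ys f)) (sym (ℤ.+-assoc (f x) _ _))

∑-map : ∀ (h : A → B) (xs : List A) (f : B → ℤ) → ∑ (List.map h xs) f ≡ ∑ xs (f ∘ h)
∑-map h []       f = refl
∑-map h (x ∷ xs) f = cong (ℤ._+_ (f (h x))) (∑-map h xs f)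

∑-concatMap : ∀ (h : A → List B) (xs : List A) (f : B → ℤ) →
              ∑ (concatMap h xs) f ≡ ∑[ x ∈ xs ] ∑ (h x) f
∑-concatMap h []       f = refl
∑-concatMap h (x ∷ xs) f =
  trans (∑-++ (h x) (concatMap h xs) f) (cong (ℤ._+_ (∑ (h x) f)) (∑-concatMap h xs f))

∑-cartesianProductWith : ∀ (h : A → B → X) (xs : List A) (ys : List B) (f : X → ℤ) →
  ∑ (cartesianProductWith h xs ys) f ≡ ∑[ x ∈ xs ] ∑[ y ∈ ys ] f (h x y)
∑-cartesianProductWith h []       ys f = refl
∑-cartesianProductWith h (x ∷ xs) ys f =
  trans (∑-++ (List.map (h x) ys) (cartesianProductWith h xs ys) f)
        (cong₂ ℤ._+_ (∑-map (h x) ys f) (∑-cartesianProductWith h xs ys f))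

∑-filter : ∀ {P : A → Set} (P? : Decidable P) (xs : List A) (f : A → ℤ) →
           ∑ (filter P? xs) f ≡ ∑[ x ∈ xs ] 𝟙 (P? x) ℤ.* f x
∑-filter P? []       f = refl
∑-filter P? (x ∷ xs) f with P? x
... | yes _ = cong₂ ℤ._+_ (sym (ℤ.*-identityˡ (f x))) (∑-filter P? xs f)
... | no  _ = trans (∑-filter P? xs f) (sym (ℤ.+-identityˡ _))

∑-length : ∀ (xs : List A) → + length xs ≡ ∑[ x ∈ xs ] 1ℤ
∑-length []       = refl
∑-length (x ∷ xs) = cong (ℤ._+_ 1ℤ) (∑-length xs)

length-filter : ∀ {P : A → Set} (P? : Decidable P) (xs : List A) →
                + length (filter P? xs) ≡ ∑[ x ∈ xs ] 𝟙 (P? x)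
length-filter P? xs = trans (∑-length (filter P? xs))
  (trans (∑-filter P? xs (λ _ → 1ℤ)) (∑-ext xs (λ x → ℤ.*-identityʳ _)))

∑-mono : ∀ (xs : List A) {f g : A → ℤ} → (∀ x → x List.∈ xs → f x ℤ.≤ g x) → ∑ xs f ℤ.≤ ∑ xs g
∑-mono []       e = ℤ.≤-refl
∑-mono (x ∷ xs) e = ℤ.+-mono-≤ (e x (here refl)) (∑-mono xs (λ y → e y ∘ there))

∑≥0 : ∀ (xs : List A) {f : A → ℤ} → (∀ x → 0ℤ ℤ.≤ f x) → 0ℤ ℤ.≤ ∑ xs f
∑≥0 xs {f} e = subst (ℤ._≤ ∑ xs f) (∑-zero xs) (∑-mono xs (λ x _ → e x))

term≤∑ : ∀ {xs : List A} {f : A → ℤ} → (∀ x → 0ℤ ℤ.≤ f x) → ∀ {x} → x List.∈ xs → f x ℤ.≤ ∑ xs f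
term≤∑ {xs = y ∷ xs} {f} f≥0 (here refl) = ℤ.i≤i+j (f y) (∑ xs f) {{ℤ.nonNegative (∑≥0 xs f≥0)}}
term≤∑ {xs = y ∷ xs} {f} f≥0 (there x∈) =
  ℤ.≤-trans (term≤∑ f≥0 x∈) (ℤ.i≤j+i (∑ xs f) (f y) {{ℤ.nonNegative (f≥0 y)}})

∑-abs : ∀ (xs : List A) {f g : A → ℤ} → (∀ x → x List.∈ xs → + ℤ.∣ f x ∣ ℤ.≤ g x) →
        + ℤ.∣ ∑ xs f ∣ ℤ.≤ ∑ xs g
∑-abs []       e = ℤ.≤-refl
∑-abs (x ∷ xs) {f} e = ℤ.≤-trans (ℤ.+≤+ (ℤ.∣i+j∣≤∣i∣+∣j∣ (f x) (∑ xs f)))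
  (ℤ.+-mono-≤ (e x (here refl)) (∑-abs xs (λ y → e y ∘ there)))

∑-𝟙-∉ : ∀ (_≟_ : DecidableEquality A) {xs : List A} {y : A} (f : A → ℤ) → y List.∉ xs →
        ∑[ x ∈ xs ] 𝟙 (x ≟ y) ℤ.* f x ≡ 0ℤ
∑-𝟙-∉ _≟_ {xs} {y} f y∉ =
  trans (∑-cong xs (λ x x∈ → cong (ℤ._* f x) (𝟙-no (x ≟ y) λ { refl → y∉ x∈ }))) (∑-zero xs)

∑-𝟙-∈ : ∀ (_≟_ : DecidableEquality A) {xs : List A} {y : A} (f : A → ℤ) → Unique xs → y List.∈ xs →
        ∑[ x ∈ xs ] 𝟙 (x ≟ y) ℤ.* f x ≡ f y
∑-𝟙-∈ _≟_ {x ∷ xs} {y} f (x∉xs ∷ u) y∈ with x ≟ y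
... | yes refl = trans (cong (ℤ._+_ (1ℤ ℤ.* f x)) (∑-𝟙-∉ _≟_ f (λ x∈ → All.lookup x∉xs x∈ refl)))
                       (trans (ℤ.+-identityʳ _) (ℤ.*-identityˡ (f x)))
... | no x≢y with y∈
...   | here refl = contradiction refl x≢y
...   | there y∈′ = trans (ℤ.+-identityˡ _) (∑-𝟙-∈ _≟_ f u y∈′)

-- Both sides are the sum of f x over the pairs (x , y) with y ≡ φ x.
∑-bijection : ∀ (_≟ᴬ_ : DecidableEquality A) (_≟ᴮ_ : DecidableEquality B)
  {xs : List A} {ys : List B} → Unique xs → Unique ys →
  (φ : A → B) (ψ : B → A) →
  (∀ x → x List.∈ xs → φ x List.∈ ys × ψ (φ x) ≡ x) →
  (∀ y → y List.∈ ys → ψ y List.∈ xs × φ (ψ y) ≡ y) →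
  ∀ {f : A → ℤ} {g : B → ℤ} → (∀ x → x List.∈ xs → f x ≡ g (φ x)) →
  ∑ xs f ≡ ∑ ys g
∑-bijection _≟ᴬ_ _≟ᴮ_ {xs} {ys} uxs uys φ ψ to from {f} {g} f≡g = begin
  ∑ xs f
    ≡⟨ ∑-cong xs (λ x x∈ → trans (f≡g x x∈) (sym (∑-𝟙-∈ _≟ᴮ_ g uys (proj₁ (to x x∈))))) ⟩
  ∑[ x ∈ xs ] ∑[ y ∈ ys ] 𝟙 (y ≟ᴮ φ x) ℤ.* g y
    ≡⟨ ∑-swap xs ys _ ⟩
  ∑[ y ∈ ys ] ∑[ x ∈ xs ] 𝟙 (y ≟ᴮ φ x) ℤ.* g y
    ≡⟨ ∑-cong ys (λ y y∈ → ∑-cong xs (λ x x∈ → cong (ℤ._* g y)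
         (𝟙-cong (y ≟ᴮ φ x) (x ≟ᴬ ψ y)
           (λ { refl → sym (proj₂ (to x x∈)) })
           (λ { refl → sym (proj₂ (from y y∈)) })))) ⟩
  ∑[ y ∈ ys ] ∑[ x ∈ xs ] 𝟙 (x ≟ᴬ ψ y) ℤ.* g y
    ≡⟨ ∑-cong ys (λ y y∈ → ∑-𝟙-∈ _≟ᴬ_ (λ _ → g y) uxs (proj₁ (from y y∈))) ⟩
  ∑ ys g ∎
  where open ≡-Reasoning

x≡-x⇒x≡0 : ∀ x → x ≡ ℤ.- x → x ≡ 0ℤ
x≡-x⇒x≡0 (+ zero) _ = refl

-- Reindexing by `φ` turns the sum into its own negative. Fixed points of `φ` are covered as well:
-- there `f` is its own negative.
∑-involution : ∀ (_≟_ : DecidableEquality A) {xs : List A} → Unique xs →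
  (φ : A → A) → (∀ x → φ x List.∈ xs) → (∀ x → φ (φ x) ≡ x) →
  ∀ {f : A → ℤ} → (∀ x → f (φ x) ≡ ℤ.- f x) → ∑ xs f ≡ 0ℤ
∑-involution _≟_ {xs} u φ φ∈ φφ {f} neg = x≡-x⇒x≡0 (∑ xs f) (trans
  (sym (∑-bijection _≟_ _≟_ u u φ φ (λ x _ → φ∈ x , φφ x) (λ x _ → φ∈ x , φφ x) (λ _ _ → refl)))
  (trans (∑-ext xs neg) (∑-neg xs f)))

vectors-unique : ∀ {xs : List A} → Unique xs → ∀ n → Unique (vectors xs n)
vectors-unique u zero    = [] ∷ []
vectors-unique u (suc n) = Unique.cartesianProductWith⁺ _∷_ (λ { refl → refl , refl }) u (vectors-unique u n)

-- Gluing and restricting GEMs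

act : ∀ {D n} → Matchings D n → Fin (suc D) → Fin n → Fin n
act g c i = lookup (lookup g c) i

build : ∀ {D n} → (Fin (suc D) → Fin n → Fin n) → Matchings D n
build f = tabulate (λ c → tabulate (f c))

act-build : ∀ {D n} (f : Fin (suc D) → Fin n → Fin n) c i → act (build f) c i ≡ f c i
act-build f c i = trans (cong (λ α → lookup α i) (Vec.lookup∘tabulate (λ c → tabulate (f c)) c)) (Vec.lookup∘tabulate (f c) i)

lookup-ext : ∀ {A : Set} {n} {v w : Vec A n} → (∀ i → lookup v i ≡ lookup w i) → v ≡ w
lookup-ext {v = v} {w} e =
  trans (sym (Vec.tabulate∘lookup v)) (trans (Vec.tabulate-cong e) (Vec.tabulate∘lookup w))

-- Matchings are stored as tables, so agreement of all values already gives propositional equality,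
-- without function extensionality.
act-ext : ∀ {D n} {g h : Matchings D n} → (∀ c i → act g c i ≡ act h c i) → g ≡ h
act-ext e = lookup-ext (λ c → lookup-ext (e c))

_≟ᴹ_ : ∀ {D n} → DecidableEquality (Matchings D n)
_≟ᴹ_ = Vec.≡-dec (Vec.≡-dec Fin._≟_)

x∈p─q⁻ : ∀ {n} {x : Fin n} (p q : Subset n) → x ∈ p ─ q → x ∈ p × x ∉ q
x∈p─q⁻ p q x∈ = p─q⊆p p q x∈ , x∉q p q x∈
  where
  x∉q : ∀ {n} {x : Fin n} (p q : Subset n) → x ∈ p ─ q → x ∉ q
  x∉q (_ ∷ p) (_ ∷ q) (Vec.there x∈) (Vec.there x∈q) = x∉q p q x∈ x∈q

-- IsGEM U g and the closure condition unfold to function types from which Agda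
-- cannot recover g; the wrappers keep g and U inferable.
record GEM {D n} (U : Subset n) (g : Matchings D n) : Set where
  constructor mkGEM′
  field isGEM : IsGEM U g

record Closed {D n} (g : Matchings D n) (U : Subset n) : Set where
  constructor mkClosed
  field step : ∀ c i → i ∈ U → act g c i ∈ U

open GEM
open Closed

module _ {D n : ℕ} where

  gems-∈⁺ : ∀ {U : Subset n} {g : Matchings D n} → GEM U g → g List.∈ gems D U
  gems-∈⁺ {U} gem = List.∈-filter⁺ (isGEM? U) (∈-vectors (∈-vectors List.∈-allFin) _) (isGEM gem)

  gems-∈⁻ : ∀ {U : Subset n} {g : Matchings D n} → g List.∈ gems D U → GEM U g
  gems-∈⁻ {U} g∈ =
    mkGEM′ (proj₂ (List.∈-filter⁻ (isGEM? U) {xs = vectors (vectors (allFin n) n) (suc D)} g∈))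

  gems-unique : ∀ (U : Subset n) → Unique (gems D U)
  gems-unique U = Unique.filter⁺ (isGEM? U)
    (vectors-unique (vectors-unique (Unique.allFin⁺ n) n) (suc D))

  closed? : ∀ (g : Matchings D n) U → Dec (Closed g U)
  closed? g U =
    Dec.map′ mkClosed step (Fin.all? (λ c → Fin.all? (λ i → (i ∈? U) →-dec (act g c i ∈? U))))

  module _ {U : Subset n} {g : Matchings D n} (gem : GEM U g) where

    gem-involutive : ∀ c i → act g c (act g c i) ≡ i
    gem-involutive c = proj₁ (isGEM gem c)

    gem-≢ : ∀ c {i} → i ∈ U → act g c i ≢ i
    gem-≢ c = proj₁ (proj₂ (isGEM gem c) _)

    gem-≡ : ∀ c {i} → i ∉ U → act g c i ≡ i
    gem-≡ c = proj₂ (proj₂ (isGEM gem c) _)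

    -- A point of `U` sent outside `U` would have a fixed image; applying the involution once more
    -- would make the point itself fixed.
    gem-step : ∀ c {i} → i ∈ U → act g c i ∈ U
    gem-step c {i} i∈U with act g c i ∈? U
    ... | yes gi∈U = gi∈U
    ... | no  gi∉U = contradiction (trans (sym (gem-≡ c gi∉U)) (gem-involutive c i)) (gem-≢ c i∈U)

    gem-closed : Closed g U
    gem-closed = mkClosed (λ c i → gem-step c)

    closed-─ : ∀ {S V} → Closed g S → Closed g V → Closed g (S ─ V)
    closed-─ {S} {V} clS clV = mkClosed λ c i i∈ →
      let i∈S , i∉V = x∈p─q⁻ S V i∈ in
      x∈p∧x∉q⇒x∈p─q (step clS c i i∈S) (λ gi∈V → i∉V (subst (_∈ V) (gem-involutive c i) (step clV c _ gi∈V)))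

  mkGEM : ∀ {U : Subset n} {g : Matchings D n} → (∀ c i → act g c (act g c i) ≡ i) →
          (∀ c i → i ∈ U → act g c i ≢ i) → (∀ c i → i ∉ U → act g c i ≡ i) → GEM U g
  mkGEM inv moves fixes = mkGEM′ λ c → inv c , λ i → moves c i , fixes c i

  glue : Subset n → Matchings D n → Matchings D n → Matchings D n
  glue U g h = build (λ c i → if does (i ∈? U) then act g c i else act h c i)

  module _ (U : Subset n) (g h : Matchings D n) where

    glue-∈ : ∀ c {i} → i ∈ U → act (glue U g h) c i ≡ act g c i
    glue-∈ c {i} i∈U rewrite act-build (λ c i → if does (i ∈? U) then act g c i else act h c i) c i
      with i ∈? U
    ... | yes _   = refl
    ... | no  i∉U = contradiction i∈U i∉U

    glue-∉ : ∀ c {i} → i ∉ U → act (glue U g h) c i ≡ act h c i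
    glue-∉ c {i} i∉U rewrite act-build (λ c i → if does (i ∈? U) then act g c i else act h c i) c i
      with i ∈? U
    ... | yes i∈U = contradiction i∈U i∉U
    ... | no  _   = refl

  -- Tables are the identity off their label set, so restricting a GEM means gluing it with the
  -- identity. This is also the unique GEM labelled by the empty set.
  fixAll : Matchings D n
  fixAll = build (λ _ i → i)

  restrict : Subset n → Matchings D n → Matchings D n
  restrict U g = glue U g fixAll

  restrict-∈ : ∀ U g c {i} → i ∈ U → act (restrict U g) c i ≡ act g c i
  restrict-∈ U g = glue-∈ U g fixAll

  restrict-∉ : ∀ U g c {i} → i ∉ U → act (restrict U g) c i ≡ i
  restrict-∉ U g c i∉U = trans (glue-∉ U g fixAll c i∉U) (act-build (λ _ i → i) c _)

  restrict-gem : ∀ {S U g} → GEM S g → U ⊆ S → Closed g U → GEM U (restrict U g)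
  restrict-gem {S} {U} {g} gem U⊆S cl = mkGEM inv
    (λ c i i∈U → subst (_≢ i) (sym (restrict-∈ U g c i∈U)) (gem-≢ gem c (U⊆S i∈U)))
    (λ c i → restrict-∉ U g c)
    where
    inv : ∀ c i → act (restrict U g) c (act (restrict U g) c i) ≡ i
    inv c i with i ∈? U
    ... | no i∉U  = trans (cong (act (restrict U g) c) (restrict-∉ U g c i∉U)) (restrict-∉ U g c i∉U)
    ... | yes i∈U = trans (cong (act (restrict U g) c) (restrict-∈ U g c i∈U))
                      (trans (restrict-∈ U g c (step cl c i i∈U)) (gem-involutive gem c i))

  module _ {S U : Subset n} (U⊆S : U ⊆ S) where

    glue-gem : ∀ {g h} → GEM U g → GEM (S ─ U) h → GEM S (glue U g h)
    glue-gem {g} {h} gemg gemh = mkGEM inv moves fixes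
      where
      ∉U : ∀ c {i} → i ∉ U → act h c i ∉ U
      ∉U c {i} i∉U with i ∈? (S ─ U)
      ... | yes i∈ = proj₂ (x∈p─q⁻ S U (gem-step gemh c i∈))
      ... | no  i∉ = subst (_∉ U) (sym (gem-≡ gemh c i∉)) i∉U

      inv : ∀ c i → act (glue U g h) c (act (glue U g h) c i) ≡ i
      inv c i with i ∈? U
      ... | yes i∈U = trans (cong (act (glue U g h) c) (glue-∈ U g h c i∈U))
                        (trans (glue-∈ U g h c (gem-step gemg c i∈U)) (gem-involutive gemg c i))
      ... | no  i∉U = trans (cong (act (glue U g h) c) (glue-∉ U g h c i∉U))
                        (trans (glue-∉ U g h c (∉U c i∉U)) (gem-involutive gemh c i))

      moves : ∀ c i → i ∈ S → act (glue U g h) c i ≢ i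
      moves c i i∈S with i ∈? U
      ... | yes i∈U = gem-≢ gemg c i∈U ∘ trans (sym (glue-∈ U g h c i∈U))
      ... | no  i∉U = gem-≢ gemh c (x∈p∧x∉q⇒x∈p─q i∈S i∉U) ∘ trans (sym (glue-∉ U g h c i∉U))

      fixes : ∀ c i → i ∉ S → act (glue U g h) c i ≡ i
      fixes c i i∉S = trans (glue-∉ U g h c (i∉S ∘ U⊆S)) (gem-≡ gemh c (i∉S ∘ p─q⊆p S U))

    glue-closed : ∀ {g h} → GEM U g → Closed (glue U g h) U
    glue-closed {g} {h} gemg = mkClosed λ c i i∈U → subst (_∈ U) (sym (glue-∈ U g h c i∈U)) (gem-step gemg c i∈U)

    restrict-glue : ∀ {g h} → GEM U g → restrict U (glue U g h) ≡ g
    restrict-glue {g} {h} gemg = act-ext {g = restrict U (glue U g h)} {g} λ c i → case i ∈? U of λ where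
      (yes i∈U) → trans (restrict-∈ U (glue U g h) c i∈U) (glue-∈ U g h c i∈U)
      (no  i∉U) → trans (restrict-∉ U (glue U g h) c i∉U) (sym (gem-≡ gemg c i∉U))

    restrict-─-glue : ∀ {g h} → GEM (S ─ U) h → restrict (S ─ U) (glue U g h) ≡ h
    restrict-─-glue {g} {h} gemh = act-ext {g = restrict (S ─ U) (glue U g h)} {h} λ c i → case i ∈? (S ─ U) of λ where
      (yes i∈) → trans (restrict-∈ (S ─ U) (glue U g h) c i∈) (glue-∉ U g h c (proj₂ (x∈p─q⁻ S U i∈)))
      (no  i∉) → trans (restrict-∉ (S ─ U) (glue U g h) c i∉) (sym (gem-≡ gemh c i∉))

    glue-restrict : ∀ {g} → GEM S g → glue U (restrict U g) (restrict (S ─ U) g) ≡ g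
    glue-restrict {g} gem = act-ext {g = glue U (restrict U g) (restrict (S ─ U) g)} {g} λ c i → case i ∈? U of λ where
      (yes i∈U) → trans (glue-∈ U (restrict U g) (restrict (S ─ U) g) c i∈U) (restrict-∈ U g c i∈U)
      (no  i∉U) → trans (glue-∉ U (restrict U g) (restrict (S ─ U) g) c i∉U) (case i ∈? S of λ where
        (yes i∈S) → restrict-∈ (S ─ U) g c (x∈p∧x∉q⇒x∈p─q i∈S i∉U)
        (no  i∉S) → trans (restrict-∉ (S ─ U) g c (i∉S ∘ p─q⊆p S U)) (sym (gem-≡ gem c i∉S)))

    -- Cutting along a closed set is inverse to gluing. Both the count of perfect matchings and all
    -- sums over closed sets rest on this bijection.
    ∑-gems-split : ∀ (F : Matchings D n → ℤ) →
      ∑[ g ∈ gems D S ] 𝟙 (closed? g U) ℤ.* F g ≡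
      ∑[ g ∈ gems D U ] ∑[ h ∈ gems D (S ─ U) ] F (glue U g h)
    ∑-gems-split F = begin
      ∑[ g ∈ gems D S ] 𝟙 (closed? g U) ℤ.* F g
        ≡⟨ ∑-filter (λ g → closed? g U) (gems D S) F ⟨
      ∑ (filter (λ g → closed? g U) (gems D S)) F
        ≡⟨ ∑-bijection _≟ᴹ_ (Product.≡-dec _≟ᴹ_ _≟ᴹ_)
             (Unique.filter⁺ (λ g → closed? g U) (gems-unique S))
             (Unique.cartesianProduct⁺ (gems-unique U) (gems-unique (S ─ U)))
             (λ g → restrict U g , restrict (S ─ U) g) (λ (g , h) → glue U g h)
             to from (λ g g∈ → cong F (sym (glue-restrict (gemˢ g∈)))) ⟩
      ∑ (cartesianProduct (gems D U) (gems D (S ─ U))) (λ (g , h) → F (glue U g h))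
        ≡⟨ ∑-cartesianProductWith _,_ (gems D U) (gems D (S ─ U)) _ ⟩
      ∑[ g ∈ gems D U ] ∑[ h ∈ gems D (S ─ U) ] F (glue U g h) ∎
      where
      open ≡-Reasoning

      split⁻ : ∀ {g} → g List.∈ filter (λ g → closed? g U) (gems D S) → g List.∈ gems D S × Closed g U
      split⁻ = List.∈-filter⁻ (λ g → closed? g U) {xs = gems D S}

      gemˢ : ∀ {g} → g List.∈ filter (λ g → closed? g U) (gems D S) → GEM S g
      gemˢ = gems-∈⁻ ∘ proj₁ ∘ split⁻

      to : ∀ g → g List.∈ filter (λ g → closed? g U) (gems D S) →
           (restrict U g , restrict (S ─ U) g) List.∈ cartesianProduct (gems D U) (gems D (S ─ U)) ×
           glue U (restrict U g) (restrict (S ─ U) g) ≡ g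
      to g g∈ = List.∈-cartesianProduct⁺
          (gems-∈⁺ (restrict-gem (gemˢ g∈) U⊆S cl))
          (gems-∈⁺ (restrict-gem (gemˢ g∈) (p─q⊆p S U)
            (closed-─ (gemˢ g∈) (gem-closed (gemˢ g∈)) cl)))
        , glue-restrict (gemˢ g∈)
        where cl = proj₂ (split⁻ g∈)

      from : ∀ p → p List.∈ cartesianProduct (gems D U) (gems D (S ─ U)) →
             glue U (proj₁ p) (proj₂ p) List.∈ filter (λ g → closed? g U) (gems D S) ×
             (restrict U (glue U (proj₁ p) (proj₂ p)) , restrict (S ─ U) (glue U (proj₁ p) (proj₂ p))) ≡ p
      from (g , h) p∈ with List.∈-cartesianProduct⁻ (gems D U) (gems D (S ─ U)) p∈
      ... | g∈ , h∈ = List.∈-filter⁺ (λ g → closed? g U)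
                        (gems-∈⁺ (glue-gem (gems-∈⁻ g∈) (gems-∈⁻ h∈))) (glue-closed {h = h} (gems-∈⁻ g∈))
                    , cong₂ _,_ (restrict-glue {h = h} (gems-∈⁻ g∈)) (restrict-─-glue {g = g} (gems-∈⁻ h∈))

-- The number of GEMs

-- The indicator of an entrywise condition is a product, so the sum over vectors factors into a
-- power.
length-filter-vectors : ∀ {A : Set} {P : A → Set} (P? : Decidable P) (xs : List A) k →
  length (filter (λ v → Fin.all? (λ c → P? (lookup v c))) (vectors xs k)) ≡ length (filter P? xs) ^ k
length-filter-vectors {A} {P} P? xs k = ℤ.+-injective (trans (length-filter _ (vectors xs k)) (go k))
  where
  open ≡-Reasoning

  All? : ∀ {k} (v : Vec A k) → Dec (∀ c → P (lookup v c))
  All? v = Fin.all? (λ c → P? (lookup v c))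

  go : ∀ k → ∑[ v ∈ vectors xs k ] 𝟙 (All? v) ≡ + (length (filter P? xs) ^ k)
  go zero    = refl
  go (suc k) = begin
    ∑[ v ∈ vectors xs (suc k) ] 𝟙 (All? v)
      ≡⟨ ∑-cartesianProductWith _∷_ xs (vectors xs k) _ ⟩
    ∑[ x ∈ xs ] ∑[ v ∈ vectors xs k ] 𝟙 (All? (x ∷ v))
      ≡⟨ ∑-ext xs (λ x → ∑-ext (vectors xs k) (λ v → trans
           (𝟙-cong (All? (x ∷ v)) (P? x ×-dec All? v)
             (λ p → p zero , p ∘ suc) (λ { (p , q) zero → p ; (p , q) (suc c) → q c }))
           (𝟙-× (P? x) (All? v)))) ⟩
    ∑[ x ∈ xs ] ∑[ v ∈ vectors xs k ] 𝟙 (P? x) ℤ.* 𝟙 (All? v)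
      ≡⟨ ∑-ext xs (λ x → ∑-*ˡ (𝟙 (P? x)) (vectors xs k) _) ⟩
    ∑[ x ∈ xs ] 𝟙 (P? x) ℤ.* (∑[ v ∈ vectors xs k ] 𝟙 (All? v))
      ≡⟨ ∑-*ʳ _ xs _ ⟩
    (∑[ x ∈ xs ] 𝟙 (P? x)) ℤ.* (∑[ v ∈ vectors xs k ] 𝟙 (All? v))
      ≡⟨ cong₂ ℤ._*_ (sym (length-filter P? xs)) (go k) ⟩
    + length (filter P? xs) ℤ.* + (length (filter P? xs) ^ k)
      ≡⟨ ℤ.pos-* (length (filter P? xs)) _ ⟨
    + (length (filter P? xs) ^ suc k) ∎

-- The `suc D` colours are chosen independently, and a GEM of dimension 0 is a single perfect
-- matching; hence only `D = 0` has to be counted by hand.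
length-gems-^ : ∀ D {n} (U : Subset n) → length (gems D U) ≡ length (gems 0 U) ^ suc D
length-gems-^ D {n} U = trans (^-form D)
  (cong (_^ suc D) (sym (trans (^-form 0)
    (ℕ.*-identityʳ (length (filter (isPerfectMatching? U) (vectors (allFin n) n)))))))
  where
  ^-form : ∀ D → length (gems D U) ≡
           length (filter (isPerfectMatching? U) (vectors (allFin n) n)) ^ suc D
  ^-form D = length-filter-vectors (isPerfectMatching? U) (vectors (allFin n) n) (suc D)

∑-singleton : ∀ {A : Set} (_≟_ : DecidableEquality A) {xs : List A} → Unique xs →
  ∀ {y} → y List.∈ xs → (∀ {x} → x List.∈ xs → x ≡ y) → ∑[ x ∈ xs ] 1ℤ ≡ 1ℤ
∑-singleton _≟_ {xs} u {y} y∈ only = trans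
  (∑-cong xs (λ x x∈ → sym (trans (ℤ.*-identityʳ _) (𝟙-yes (x ≟ y) (only x∈)))))
  (∑-𝟙-∈ _≟_ (λ _ → 1ℤ) u y∈)

act-fixAll : ∀ {D n} c i → act (fixAll {D} {n}) c i ≡ i
act-fixAll = act-build (λ _ i → i)

fixAll-gem : ∀ {D n} → GEM {D} {n} ⊥ fixAll
fixAll-gem = mkGEM (λ c i → trans (act-fixAll c _) (act-fixAll c i))
  (λ c i i∈⊥ → contradiction i∈⊥ ∉⊥) (λ c i _ → act-fixAll c i)

length-gems-⊥ : ∀ n → length (gems 0 (⊥ {n})) ≡ 1
length-gems-⊥ n = ℤ.+-injective (trans (∑-length (gems 0 (⊥ {n})))
  (∑-singleton _≟ᴹ_ (gems-unique (⊥ {n})) (gems-∈⁺ fixAll-gem) λ {g} g∈ →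
    act-ext {g = g} {fixAll} λ c i → trans (gem-≡ (gems-∈⁻ {U = ⊥} g∈) c ∉⊥) (sym (act-fixAll c i))))

module _ {n : ℕ} {i j : Fin n} (i≢j : i ≢ j) where

  pair : Subset n
  pair = ⁅ i ⁆ ∪ ⁅ j ⁆

  i∈pair : i ∈ pair
  i∈pair = x∈p∪q⁺ (inj₁ (x∈⁅x⁆ i))

  j∈pair : j ∈ pair
  j∈pair = x∈p∪q⁺ (inj₂ (x∈⁅x⁆ j))

  pair⁻ : ∀ {k} → k ∈ pair → k ≡ i ⊎ k ≡ j
  pair⁻ k∈ with x∈p∪q⁻ ⁅ i ⁆ ⁅ j ⁆ k∈
  ... | inj₁ k∈i = inj₁ (x∈⁅y⁆⇒x≡y i k∈i)
  ... | inj₂ k∈j = inj₂ (x∈⁅y⁆⇒x≡y j k∈j)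

  swap : Fin n → Fin n
  swap k = if does (k Fin.≟ i) then j else if does (k Fin.≟ j) then i else k

  swap-i : ∀ {k} → k ≡ i → swap k ≡ j
  swap-i {k} k≡i with k Fin.≟ i
  ... | yes _  = refl
  ... | no k≢i = contradiction k≡i k≢i

  swap-j : ∀ {k} → k ≡ j → swap k ≡ i
  swap-j {k} k≡j with k Fin.≟ i | k Fin.≟ j
  ... | yes k≡i | _      = contradiction (trans (sym k≡i) k≡j) i≢j
  ... | no _    | yes _  = refl
  ... | no _    | no k≢j = contradiction k≡j k≢j

  swap-∉ : ∀ {k} → k ∉ pair → swap k ≡ k
  swap-∉ {k} k∉ with k Fin.≟ i | k Fin.≟ j
  ... | yes refl | _        = contradiction i∈pair k∉
  ... | no _     | yes refl = contradiction j∈pair k∉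
  ... | no _     | no _     = refl

  swap-gem : GEM {0} pair (build (λ _ → swap))
  swap-gem = mkGEM
    (λ c k → trans (cong (act (build (λ _ → swap)) c) (act-build (λ _ → swap) c k))
               (trans (act-build (λ _ → swap) c (swap k)) (inv k)))
    (λ c k k∈ → subst (_≢ k) (sym (act-build (λ _ → swap) c k)) (moves k∈))
    (λ c k k∉ → trans (act-build (λ _ → swap) c k) (swap-∉ k∉))
    where
    inv : ∀ k → swap (swap k) ≡ k
    inv k with k ∈? pair
    ... | no k∉ = trans (cong swap (swap-∉ k∉)) (swap-∉ k∉)
    ... | yes k∈ with pair⁻ k∈
    ...   | inj₁ k≡i = trans (swap-j (swap-i k≡i)) (sym k≡i)
    ...   | inj₂ k≡j = trans (swap-i (swap-j k≡j)) (sym k≡j)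

    moves : ∀ {k} → k ∈ pair → swap k ≢ k
    moves k∈ eq with pair⁻ k∈
    ... | inj₁ refl = i≢j (trans (sym eq) (swap-i refl))
    ... | inj₂ refl = i≢j (trans (sym (swap-j refl)) eq)

  gem-pair : ∀ {U} {g : Matchings 0 n} → GEM U g → i ∈ U → Closed g pair → act g zero i ≡ j
  gem-pair gem i∈U cl with pair⁻ (Closed.step cl zero i i∈pair)
  ... | inj₁ gi≡i = contradiction gi≡i (gem-≢ gem zero i∈U)
  ... | inj₂ gi≡j = gi≡j

  closed-pair : ∀ {U} {g : Matchings 0 n} → GEM U g → act g zero i ≡ j → Closed g pair
  closed-pair {g = g} gem gi≡j = mkClosed λ where
    zero k k∈ → case pair⁻ k∈ of λ where
      (inj₁ refl) → subst (_∈ pair) (sym gi≡j) j∈pair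
      (inj₂ refl) → subst (_∈ pair)
        (sym (trans (cong (act g zero) (sym gi≡j)) (gem-involutive gem zero i))) i∈pair

  ∑-gems-pair : ∑[ g ∈ gems 0 pair ] 1ℤ ≡ 1ℤ
  ∑-gems-pair = ∑-singleton _≟ᴹ_ (gems-unique pair) (gems-∈⁺ swap-gem) λ {g} g∈ → only (gems-∈⁻ g∈)
    where
    only : ∀ {g} → GEM pair g → g ≡ build (λ _ → swap)
    only {g} gem = act-ext {g = g} {build (λ _ → swap)} agree
      where
      gi≡j : act g zero i ≡ j
      gi≡j = gem-pair gem i∈pair (gem-closed gem)

      image : ∀ k → act g zero k ≡ swap k
      image k with k ∈? pair
      ... | no k∉ = trans (gem-≡ gem zero k∉) (sym (swap-∉ k∉))
      ... | yes k∈ with pair⁻ k∈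
      ...   | inj₁ refl = trans gi≡j (sym (swap-i refl))
      ...   | inj₂ refl = trans (trans (cong (act g zero) (sym gi≡j)) (gem-involutive gem zero i))
                                (sym (swap-j refl))

      agree : ∀ c k → act g c k ≡ act (build (λ _ → swap)) c k
      agree zero k = trans (image k) (sym (act-build {0} (λ _ → swap) zero k))

suc-∣p-x∣ : ∀ {n} {x : Fin n} (p : Subset n) → x ∈ p → suc ∣ p Subset.- x ∣ ≡ ∣ p ∣
suc-∣p-x∣ (_ ∷ p)       Vec.here       = cong (suc ∘ ∣_∣) (p─⊥≡p p)
suc-∣p-x∣ (inside  ∷ p) (Vec.there x∈) = cong suc (suc-∣p-x∣ p x∈)
suc-∣p-x∣ (outside ∷ p) (Vec.there x∈) = suc-∣p-x∣ p x∈

allFin-suc : ∀ n → allFin (suc n) ≡ zero ∷ List.map suc (allFin n)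
allFin-suc n = cong (zero ∷_) (sym (List.map-tabulate id suc))

∑-∈? : ∀ {n} (p : Subset n) → ∑[ j ∈ allFin n ] 𝟙 (j ∈? p) ≡ + ∣ p ∣
∑-∈? []      = refl
∑-∈? {suc n} (s ∷ p) = begin
  ∑[ j ∈ allFin (suc n) ] 𝟙 (j ∈? (s ∷ p))
    ≡⟨ cong (λ xs → ∑[ j ∈ xs ] 𝟙 (j ∈? (s ∷ p))) (allFin-suc n) ⟩
  𝟙 (zero ∈? (s ∷ p)) ℤ.+ (∑[ j ∈ List.map suc (allFin n) ] 𝟙 (j ∈? (s ∷ p)))
    ≡⟨ cong (ℤ._+_ (𝟙 (zero ∈? (s ∷ p)))) (trans (∑-map suc (allFin n) _)
         (∑-ext (allFin n) (λ j → 𝟙-cong (suc j ∈? (s ∷ p)) (j ∈? p) drop-there Vec.there))) ⟩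
  𝟙 (zero ∈? (s ∷ p)) ℤ.+ (∑[ j ∈ allFin n ] 𝟙 (j ∈? p))
    ≡⟨ cong (ℤ._+_ (𝟙 (zero ∈? (s ∷ p)))) (∑-∈? p) ⟩
  𝟙 (zero ∈? (s ∷ p)) ℤ.+ + ∣ p ∣
    ≡⟨ head s ⟩
  + ∣ s ∷ p ∣ ∎
  where
  open ≡-Reasoning

  head : ∀ s → 𝟙 (zero ∈? (s ∷ p)) ℤ.+ + ∣ p ∣ ≡ + ∣ s ∷ p ∣
  head inside  = refl
  head outside = refl

-- The value 0 at odd sizes lets sums over splits run through all part sizes. The factor `suc k`
-- counts the partners of one chosen element.
matchingCount : ℕ → ℕ
matchingCount zero          = 1
matchingCount (suc zero)    = 0
matchingCount (suc (suc k)) = suc k * matchingCount k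

-- Matchings are sorted by the partner `j` of a chosen `i`: once `j` is fixed, the pair is closed
-- and splits off, leaving `k ∸ 1` elements. Two elements disappear at a time, so the recursion
-- descends on the bound `b`.
length-matchings : ∀ b {n} k → k ≤ b → (U : Subset n) → ∣ U ∣ ≡ k → length (gems 0 U) ≡ matchingCount k
length-matchings b {n} zero k≤b U ∣U∣≡0 with nonempty? U
... | no empty = trans (cong (λ U → length (gems 0 U)) (Empty-unique empty)) (length-gems-⊥ n)
... | yes (i , i∈U) = contradiction (trans (suc-∣p-x∣ U i∈U) ∣U∣≡0) λ ()
length-matchings (suc b) {n} (suc k) (s≤s k≤b) U ∣U∣≡1+k with nonempty? U
... | no empty = contradiction
        (trans (sym ∣U∣≡1+k) (trans (cong ∣_∣ (Empty-unique empty)) (∣⊥∣≡0 n))) λ ()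
... | yes (i , i∈U) = ℤ.+-injective (begin
  + length (gems 0 U)
    ≡⟨ ∑-length (gems 0 U) ⟩
  ∑[ g ∈ gems 0 U ] 1ℤ
    ≡⟨ ∑-ext (gems 0 U) (λ g → sym (trans
         (∑-ext (allFin n) (λ j → sym (ℤ.*-identityʳ (𝟙 (j Fin.≟ act g zero i)))))
         (∑-𝟙-∈ Fin._≟_ (λ _ → 1ℤ) (Unique.allFin⁺ n) (List.∈-allFin _)))) ⟩
  ∑[ g ∈ gems 0 U ] ∑[ j ∈ allFin n ] 𝟙 (j Fin.≟ act g zero i)
    ≡⟨ ∑-swap (gems 0 U) (allFin n) _ ⟩
  ∑[ j ∈ allFin n ] ∑[ g ∈ gems 0 U ] 𝟙 (j Fin.≟ act g zero i)
    ≡⟨ ∑-ext (allFin n) partner ⟩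
  ∑[ j ∈ allFin n ] 𝟙 (j ∈? V) ℤ.* + matchingCount (k ∸ 1)
    ≡⟨ trans (∑-*ʳ _ (allFin n) _) (cong (ℤ._* + matchingCount (k ∸ 1)) (∑-∈? V)) ⟩
  + ∣ V ∣ ℤ.* + matchingCount (k ∸ 1)
    ≡⟨ trans (sym (ℤ.pos-* ∣ V ∣ _)) (cong (λ k′ → + (k′ * matchingCount (k ∸ 1))) ∣V∣≡k) ⟩
  + (k * matchingCount (k ∸ 1))
    ≡⟨ cong +_ (unfold k) ⟩
  + matchingCount (suc k) ∎)
  where
  open ≡-Reasoning

  V : Subset n
  V = U Subset.- i

  ∣V∣≡k : ∣ V ∣ ≡ k
  ∣V∣≡k = ℕ.suc-injective (trans (suc-∣p-x∣ U i∈U) ∣U∣≡1+k)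

  -- For `k = 0` there is no partner, and the truncated `k ∸ 1` is met by the factor zero.
  unfold : ∀ k → k * matchingCount (k ∸ 1) ≡ matchingCount (suc k)
  unfold zero    = refl
  unfold (suc k) = refl

  partner : ∀ j → ∑[ g ∈ gems 0 U ] 𝟙 (j Fin.≟ act g zero i) ≡
                  𝟙 (j ∈? V) ℤ.* + matchingCount (k ∸ 1)
  partner j with j ∈? V
  ... | no j∉V = trans (∑-cong (gems 0 U) λ g g∈ → 𝟙-no (j Fin.≟ act g zero i) λ j≡gi → j∉V
          (x∈p∧x≢y⇒x∈p-y (subst (_∈ U) (sym j≡gi) (gem-step (gems-∈⁻ g∈) zero i∈U))
            (λ j≡i → gem-≢ (gems-∈⁻ g∈) zero i∈U (trans (sym j≡gi) j≡i))))
          (∑-zero (gems 0 U))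
  ... | yes j∈V = begin
    ∑[ g ∈ gems 0 U ] 𝟙 (j Fin.≟ act g zero i)
      ≡⟨ ∑-cong (gems 0 U) (λ g g∈ → trans
           (𝟙-cong (j Fin.≟ act g zero i) (closed? g E)
             (λ j≡gi → closed-pair i≢j (gems-∈⁻ g∈) (sym j≡gi))
             (λ cl → sym (gem-pair i≢j (gems-∈⁻ g∈) i∈U cl)))
           (sym (ℤ.*-identityʳ _))) ⟩
    ∑[ g ∈ gems 0 U ] 𝟙 (closed? g E) ℤ.* 1ℤ
      ≡⟨ ∑-gems-split E⊆U (λ _ → 1ℤ) ⟩
    ∑[ g ∈ gems 0 E ] ∑[ h ∈ gems 0 (U ─ E) ] 1ℤ
      ≡⟨ ∑-ext (gems 0 E) (λ _ → trans (sym (ℤ.*-identityˡ _)) (cong (1ℤ ℤ.*_) rest)) ⟩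
    ∑[ g ∈ gems 0 E ] 1ℤ ℤ.* + matchingCount (k ∸ 1)
      ≡⟨ trans (∑-*ʳ (+ matchingCount (k ∸ 1)) (gems 0 E) (λ _ → 1ℤ))
               (cong (ℤ._* + matchingCount (k ∸ 1)) (∑-gems-pair i≢j)) ⟩
    1ℤ ℤ.* + matchingCount (k ∸ 1) ∎
    where
    j∈U : j ∈ U
    j∈U = p─q⊆p U ⁅ i ⁆ j∈V

    i≢j : i ≢ j
    i≢j refl = proj₂ (x∈p─q⁻ U ⁅ i ⁆ j∈V) (x∈⁅x⁆ i)

    E : Subset n
    E = pair i≢j

    E⊆U : E ⊆ U
    E⊆U k∈E with pair⁻ i≢j k∈E
    ... | inj₁ refl = i∈U
    ... | inj₂ refl = j∈U

    rest : ∑[ h ∈ gems 0 (U ─ E) ] 1ℤ ≡ + matchingCount (k ∸ 1)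
    rest = trans (sym (∑-length (gems 0 (U ─ E)))) (cong +_ (length-matchings b (k ∸ 1) (ℕ.≤-trans (ℕ.m∸n≤m k 1) k≤b) (U ─ E)
      (trans (cong ∣_∣ (sym (p─q─r≡p─q∪r U ⁅ i ⁆ ⁅ j ⁆)))
        (cong (_∸ 1) (trans (suc-∣p-x∣ V j∈V) ∣V∣≡k)))))

gemCount : ℕ → ℕ → ℕ
gemCount D k = matchingCount k ^ suc D

length-gems : ∀ D {n} (U : Subset n) → length (gems D U) ≡ gemCount D ∣ U ∣
length-gems D U = trans (length-gems-^ D U) (cong (_^ suc D) (length-matchings ∣ U ∣ ∣ U ∣ ℕ.≤-refl U refl))

-- Sums over subsets and their sizes

-- The sum of f i j over the 2^k ways of splitting a k-set into parts of sizes i and j.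
∑splits : ℕ → (ℕ → ℕ → ℤ) → ℤ
∑splits zero    f = f 0 0
∑splits (suc k) f = ∑splits k (λ i j → f (suc i) j) ℤ.+ ∑splits k (λ i j → f i (suc j))

∑-subsets-suc : ∀ {n} (F : Subset (suc n) → ℤ) → ∑ (subsets (suc n)) F ≡
  (∑[ W ∈ subsets n ] F (inside ∷ W)) ℤ.+ (∑[ W ∈ subsets n ] F (outside ∷ W))
∑-subsets-suc {n} F = trans
  (∑-cartesianProductWith _∷_ (inside ∷ outside ∷ []) (subsets n) F)
  (cong (ℤ._+_ (∑[ W ∈ subsets n ] F (inside ∷ W))) (ℤ.+-identityʳ _))

-- The recursion of `∑splits` follows that of `subsets`: an element of `S` goes to `W` or to
-- `S ─ W`, while an element outside `S` has no choice.
∑-⊆ : ∀ {n} (S : Subset n) (f : ℕ → ℕ → ℤ) →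
  ∑[ W ∈ subsets n ] 𝟙 (W ⊆? S) ℤ.* f ∣ W ∣ (∣ S ─ W ∣) ≡ ∑splits (∣ S ∣) f
∑-⊆ [] f = trans (ℤ.+-identityʳ _) (trans
  (cong (ℤ._* f 0 0) (𝟙-yes ([] ⊆? []) (λ x∈ → x∈))) (ℤ.*-identityˡ _))
∑-⊆ {suc n} (inside ∷ S) f = trans (∑-subsets-suc {n} _) (cong₂ ℤ._+_
  (trans (∑-ext (subsets n) (λ W → cong (ℤ._* f (suc (∣ W ∣)) (∣ S ─ W ∣))
           (𝟙-cong ((inside ∷ W) ⊆? (inside ∷ S)) (W ⊆? S) (λ p → drop-∷-⊆ p) (λ p → in⊆in p))))
         (∑-⊆ S (λ i j → f (suc i) j)))
  (trans (∑-ext (subsets n) (λ W → cong (ℤ._* f (∣ W ∣) (suc (∣ S ─ W ∣)))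
           (𝟙-cong ((outside ∷ W) ⊆? (inside ∷ S)) (W ⊆? S) (λ p → drop-∷-⊆ p) (λ p → out⊆ p))))
         (∑-⊆ S (λ i j → f i (suc j)))))
∑-⊆ {suc n} (outside ∷ S) f = trans (∑-subsets-suc {n} _) (trans (cong₂ ℤ._+_
  (trans (∑-ext (subsets n) (λ W → cong (ℤ._* f (suc (∣ W ∣)) (∣ S ─ W ∣))
           (𝟙-no ((inside ∷ W) ⊆? (outside ∷ S)) (λ p → case p Vec.here of λ ()))))
         (∑-zero (subsets n)))
  (trans (∑-ext (subsets n) (λ W → cong (ℤ._* f (∣ W ∣) (∣ S ─ W ∣))
           (𝟙-cong ((outside ∷ W) ⊆? (outside ∷ S)) (W ⊆? S) (λ p → drop-∷-⊆ p) (λ p → out⊆ p))))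
         (∑-⊆ S f)))
  (ℤ.+-identityˡ _))

∑splits-cong : ∀ k {f g : ℕ → ℕ → ℤ} → (∀ i j → i + j ≡ k → f i j ≡ g i j) →
               ∑splits k f ≡ ∑splits k g
∑splits-cong zero    e = e 0 0 refl
∑splits-cong (suc k) e = cong₂ ℤ._+_
  (∑splits-cong k (λ i j p → e (suc i) j (cong suc p)))
  (∑splits-cong k (λ i j p → e i (suc j) (trans (ℕ.+-suc i j) (cong suc p))))

sumTo : ℕ → (ℕ → ℤ) → ℤ
sumTo zero    h = h 0
sumTo (suc k) h = sumTo k h ℤ.+ h (suc k)

sumTo-cong : ∀ k {g h : ℕ → ℤ} → (∀ t → t ≤ k → g t ≡ h t) → sumTo k g ≡ sumTo k h
sumTo-cong zero    e = e 0 z≤n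
sumTo-cong (suc k) e =
  cong₂ ℤ._+_ (sumTo-cong k (λ t t≤k → e t (ℕ.m≤n⇒m≤1+n t≤k))) (e (suc k) ℕ.≤-refl)

sumTo-mono : ∀ k {g h : ℕ → ℤ} → (∀ t → t ≤ k → g t ℤ.≤ h t) → sumTo k g ℤ.≤ sumTo k h
sumTo-mono zero    e = e 0 z≤n
sumTo-mono (suc k) e =
  ℤ.+-mono-≤ (sumTo-mono k (λ t t≤k → e t (ℕ.m≤n⇒m≤1+n t≤k))) (e (suc k) ℕ.≤-refl)

sumTo-+ : ∀ k (g h : ℕ → ℤ) → sumTo k (λ t → g t ℤ.+ h t) ≡ sumTo k g ℤ.+ sumTo k h
sumTo-+ zero    g h = refl
sumTo-+ (suc k) g h = trans (cong (ℤ._+ (g (suc k) ℤ.+ h (suc k))) (sumTo-+ k g h))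
  (ring (sumTo k g) (sumTo k h) (g (suc k)) (h (suc k)))
  where
  ring : ∀ a b c d → a ℤ.+ b ℤ.+ (c ℤ.+ d) ≡ a ℤ.+ c ℤ.+ (b ℤ.+ d)
  ring = ℤSolver.solve-∀

sumTo-*ˡ : ∀ c k (h : ℕ → ℤ) → sumTo k (λ t → c ℤ.* h t) ≡ c ℤ.* sumTo k h
sumTo-*ˡ c zero    h = refl
sumTo-*ˡ c (suc k) h =
  trans (cong (ℤ._+ c ℤ.* h (suc k)) (sumTo-*ˡ c k h)) (sym (ℤ.*-distribˡ-+ c _ _))

sumTo-const : ∀ k c → sumTo k (λ _ → c) ≡ + suc k ℤ.* c
sumTo-const zero    c = sym (ℤ.*-identityˡ c)
sumTo-const (suc k) c = trans (cong (ℤ._+ c) (sumTo-const k c)) (ring (+ suc k) c)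
  where
  ring : ∀ n c → n ℤ.* c ℤ.+ c ≡ (1ℤ ℤ.+ n) ℤ.* c
  ring = ℤSolver.solve-∀

sumTo-head : ∀ k (h : ℕ → ℤ) → sumTo (suc k) h ≡ h 0 ℤ.+ sumTo k (h ∘ suc)
sumTo-head zero    h = refl
sumTo-head (suc k) h = trans (cong (ℤ._+ h (suc (suc k))) (sumTo-head k h)) (ℤ.+-assoc (h 0) _ _)

sumTo-truncate : ∀ {r k} → r ≤ k → (h : ℕ → ℤ) → (∀ t → r < t → h t ≡ 0ℤ) → sumTo k h ≡ sumTo r h
sumTo-truncate {r} {k} r≤k h z with ℕ.m≤n⇒∃[o]m+o≡n r≤k
... | o , refl = go o
  where
  go : ∀ o → sumTo (r + o) h ≡ sumTo r h
  go zero    = cong (λ k → sumTo k h) (ℕ.+-identityʳ r)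
  go (suc o) = trans (cong (λ k → sumTo k h) (ℕ.+-suc r o))
    (trans (cong₂ ℤ._+_ (go o) (z (suc (r + o)) (s≤s (ℕ.m≤m+n r o)))) (ℤ.+-identityʳ _))

sumTo-even : ∀ k (h : ℕ → ℤ) → (∀ u → h (suc (2 * u)) ≡ 0ℤ) → sumTo (2 * k) h ≡ sumTo k (λ u → h (2 * u))
sumTo-even zero    h odd = refl
sumTo-even (suc k) h odd = trans (cong (λ j → sumTo j h) 2*suc)
  (cong₂ ℤ._+_
    (trans (cong (ℤ._+_ (sumTo (2 * k) h)) (odd k)) (trans (ℤ.+-identityʳ _) (sumTo-even k h odd)))
    (cong h (sym 2*suc)))
  where
  2*suc : 2 * suc k ≡ suc (suc (2 * k))
  2*suc = ℕ.*-suc 2 k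

-- Induction by Pascal's rule. The sum of `β` may be extended to `suc k`, where the binomial
-- coefficient vanishes; splitting off its head then aligns it with `α`.
∑splits≡sumTo : ∀ k f → ∑splits k f ≡ sumTo k (λ t → + (k C t) ℤ.* f t (k ∸ t))
∑splits≡sumTo zero    f = sym (ℤ.*-identityˡ _)
∑splits≡sumTo (suc k) f = begin
  ∑splits k (λ i j → f (suc i) j) ℤ.+ ∑splits k (λ i j → f i (suc j))
    ≡⟨ cong₂ ℤ._+_ (∑splits≡sumTo k (λ i j → f (suc i) j)) (trans (∑splits≡sumTo k (λ i j → f i (suc j)))
         (trans (sumTo-cong k (λ t t≤k → cong (λ j → + (k C t) ℤ.* f t j) (sym (ℕ.+-∸-assoc 1 t≤k))))
         (trans (sym (ℤ.+-identityʳ _)) (trans (cong (ℤ._+_ (sumTo k β)) (sym last)) (sumTo-head k β))))) ⟩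
  sumTo k α ℤ.+ (β 0 ℤ.+ sumTo k (β ∘ suc))
    ≡⟨ ring (sumTo k α) (β 0) (sumTo k (β ∘ suc)) ⟩
  β 0 ℤ.+ (sumTo k α ℤ.+ sumTo k (β ∘ suc))
    ≡⟨ cong (ℤ._+_ (β 0)) (trans (sym (sumTo-+ k α (β ∘ suc))) (sumTo-cong k λ t _ → pascal t)) ⟩
  γ 0 ℤ.+ sumTo k (γ ∘ suc)
    ≡⟨ sumTo-head k γ ⟨
  sumTo (suc k) γ ∎
  where
  open ≡-Reasoning

  α β γ : ℕ → ℤ
  α t = + (k C t) ℤ.* f (suc t) (k ∸ t)
  β t = + (k C t) ℤ.* f t (suc k ∸ t)
  γ t = + (suc k C t) ℤ.* f t (suc k ∸ t)

  last : β (suc k) ≡ 0ℤ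
  last = cong (λ c → + c ℤ.* f (suc k) (suc k ∸ suc k)) (k>n⇒nCk≡0 (ℕ.n<1+n k))

  pascal : ∀ t → α t ℤ.+ β (suc t) ≡ γ (suc t)
  pascal t = trans (sym (ℤ.*-distribʳ-+ (f (suc t) (k ∸ t)) (+ (k C t)) (+ (k C suc t))))
    (cong (ℤ._* f (suc t) (k ∸ t)) (cong +_ (nCk+nC[k+1]≡[n+1]C[k+1] k t)))

  ring : ∀ a b c → a ℤ.+ (b ℤ.+ c) ≡ b ℤ.+ (a ℤ.+ c)
  ring = ℤSolver.solve-∀

-- Components

module _ {A : Set} {P Q : A → Set} (P? : Decidable P) (Q? : Decidable Q) where

  filter-cong : ∀ xs → (∀ {x} → x List.∈ xs → P x → Q x) → (∀ {x} → x List.∈ xs → Q x → P x) →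
                filter P? xs ≡ filter Q? xs
  filter-cong []       to from = refl
  filter-cong (x ∷ xs) to from with P? x
  ... | yes p = trans (cong (x ∷_) (filter-cong xs (to ∘ there) (from ∘ there)))
                      (sym (List.filter-accept Q? (to (here refl) p)))
  ... | no ¬p = trans (filter-cong xs (to ∘ there) (from ∘ there))
                      (sym (List.filter-reject Q? (¬p ∘ from (here refl))))

  filter-absorb : (∀ {x} → P x → Q x) → ∀ xs → filter P? (filter Q? xs) ≡ filter P? xs
  filter-absorb P⇒Q []       = refl
  filter-absorb P⇒Q (x ∷ xs) with Q? x
  ... | no ¬q = trans (filter-absorb P⇒Q xs) (sym (List.filter-reject P? (¬q ∘ P⇒Q)))
  ... | yes _ with P? x
  ...   | yes _ = cong (x ∷_) (filter-absorb P⇒Q xs)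
  ...   | no _  = filter-absorb P⇒Q xs

filter-comm : ∀ {A : Set} {P Q : A → Set} (P? : Decidable P) (Q? : Decidable Q) xs →
              filter P? (filter Q? xs) ≡ filter Q? (filter P? xs)
filter-comm P? Q? []       = refl
filter-comm P? Q? (x ∷ xs) with P? x in p | Q? x in q
... | yes px | yes qx = trans (List.filter-accept P? px)
        (trans (cong (x ∷_) (filter-comm P? Q? xs)) (sym (List.filter-accept Q? qx)))
... | yes px | no ¬qx = trans (filter-comm P? Q? xs) (sym (List.filter-reject Q? ¬qx))
... | no ¬px | yes qx = trans (List.filter-reject P? ¬px) (filter-comm P? Q? xs)
... | no ¬px | no ¬qx = filter-comm P? Q? xs

module _ {A : Set} {R : Rel A 0ℓ} (R? : Rel.Decidable R) where

  -- A predicate invariant under `R` keeps or drops whole classes: elements discarded on account of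
  -- a rejected `x` would have been rejected themselves.
  filter-deduplicate : ∀ {P : A → Set} (P? : Decidable P) → (∀ {x y} → R x y → P y → P x) → ∀ xs →
    filter P? (deduplicate R? xs) ≡ deduplicate R? (filter P? xs)
  filter-deduplicate P? resp []       = refl
  filter-deduplicate P? resp (x ∷ xs) with P? x
  ... | yes _ = cong (x ∷_) (trans
          (filter-comm P? (λ y → ¬? (R? x y)) (deduplicate R? xs))
          (cong (filter (λ y → ¬? (R? x y))) (filter-deduplicate P? resp xs)))
  ... | no ¬p = trans
          (filter-absorb P? (λ y → ¬? (R? x y)) (λ py r → ¬p (resp r py)) (deduplicate R? xs))
          (filter-deduplicate P? resp xs)

  length-deduplicate-related : ∀ {xs} → (∀ {x y} → x List.∈ xs → y List.∈ xs → R x y) →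
    ∀ {z} → z List.∈ xs → length (deduplicate R? xs) ≡ 1
  length-deduplicate-related {x ∷ xs} related _ = cong (suc ∘ length)
    (List.filter-none (λ y → ¬? (R? x y)) (All.tabulate (λ y∈ ¬r →
      ¬r (related (here refl) (there (List.∈-deduplicate⁻ R? xs y∈))))))

-- Used with `f = id` to exchange one relation for another on the same list, and with `f = embed U`
-- to relabel.
deduplicate-map : ∀ {A B : Set} {R : Rel A 0ℓ} (R? : Rel.Decidable R)
  {R′ : Rel B 0ℓ} (R′? : Rel.Decidable R′) (f : A → B) xs →
  (∀ {x y} → x List.∈ xs → y List.∈ xs → R x y → R′ (f x) (f y)) →
  (∀ {x y} → x List.∈ xs → y List.∈ xs → R′ (f x) (f y) → R x y) →
  deduplicate R′? (List.map f xs) ≡ List.map f (deduplicate R? xs)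
deduplicate-map R? R′? f []       to from = refl
deduplicate-map {R = R} R? {R′} R′? f (x ∷ xs) to from = cong (f x ∷_) (begin
  filter (λ y → ¬? (R′? (f x) y)) (deduplicate R′? (List.map f xs))
    ≡⟨ cong (filter _) (deduplicate-map R? R′? f xs
         (λ x∈ y∈ → to (there x∈) (there y∈)) (λ x∈ y∈ → from (there x∈) (there y∈))) ⟩
  filter (λ y → ¬? (R′? (f x) y)) (List.map f (deduplicate R? xs))
    ≡⟨ filter-map (λ y → ¬? (R′? (f x) y)) (deduplicate R? xs) ⟩
  List.map f (filter (λ y → ¬? (R′? (f x) (f y))) (deduplicate R? xs))
    ≡⟨ cong (List.map f) (filter-cong (λ y → ¬? (R′? (f x) (f y))) (λ y → ¬? (R? x y)) (deduplicate R? xs)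
         (λ y∈ ¬r r → ¬r (to (here refl) (there (List.∈-deduplicate⁻ R? xs y∈)) r))
         (λ y∈ ¬r r → ¬r (from (here refl) (there (List.∈-deduplicate⁻ R? xs y∈)) r))) ⟩
  List.map f (filter (λ y → ¬? (R? x y)) (deduplicate R? xs)) ∎)
  where
  open ≡-Reasoning

  filter-map : ∀ {P : _ → Set} (P? : Decidable P) ys →
               filter P? (List.map f ys) ≡ List.map f (filter (P? ∘ f) ys)
  filter-map P? []       = refl
  filter-map P? (y ∷ ys) with P? (f y)
  ... | yes _ = cong (f y ∷_) (filter-map P? ys)
  ... | no _  = filter-map P? ys

module _ {D n : ℕ} where

  connected-closed : ∀ {g : Matchings D n} {U} → Closed g U → ∀ {i j} → Connected g i j → i ∈ U → j ∈ U
  connected-closed cl ε i∈U = i∈U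
  connected-closed cl ((c , refl) ◅ p) i∈U = connected-closed cl p (Closed.step cl c _ i∈U)

  connected-sym : ∀ {U} {g : Matchings D n} → GEM U g → ∀ {i j} → Connected g i j → Connected g j i
  connected-sym {g = g} gem = reverse λ { {i} (c , refl) → c , gem-involutive gem c i }

  connected-agree : ∀ {g h : Matchings D n} {U} → Closed g U → (∀ c i → i ∈ U → act g c i ≡ act h c i) →
    ∀ {i j} → i ∈ U → Connected g i j → Connected h i j
  connected-agree cl agree i∈U ε = ε
  connected-agree {g} {h} cl agree i∈U ((c , refl) ◅ p) =
    (c , sym (agree c _ i∈U)) ◅ connected-agree {g} {h} cl agree (Closed.step cl c _ i∈U) p

  members : Subset n → List (Fin n)
  members U = filter (_∈? U) (allFin n)

  members⁻ : ∀ {U i} → i List.∈ members U → i ∈ U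
  members⁻ {U} i∈ = proj₂ (List.∈-filter⁻ (_∈? U) {xs = allFin n} i∈)

  members⁺ : ∀ {U i} → i ∈ U → i List.∈ members U
  members⁺ {U} i∈ = List.∈-filter⁺ (_∈? U) (List.∈-allFin _) i∈

  -- A path that starts in a closed set never leaves it, so only the values of the matchings on `U`
  -- matter.
  π₀-agree : ∀ {g h : Matchings D n} {U} → Closed g U → Closed h U →
    (∀ c i → i ∈ U → act g c i ≡ act h c i) → π₀ U g ≡ π₀ U h
  π₀-agree {g} {h} {U} clg clh agree = sym (trans
    (cong (length ∘ deduplicate (connected? h)) (sym (List.map-id (members U))))
    (trans (cong length (deduplicate-map (connected? g) (connected? h) id (members U)
        (λ x∈ _ → connected-agree {g} {h} clg agree (members⁻ x∈))
        (λ x∈ _ → connected-agree {h} {g} clh (λ c i i∈ → sym (agree c i i∈)) (members⁻ x∈))))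
      (List.length-map id (deduplicate (connected? g) (members U)))))

  representatives : Matchings D n → List (Fin n)
  representatives g = deduplicate (connected? g) (allFin n)

  -- A closed set contains all of a component or none of it, so one list of representatives, chosen
  -- for the whole vertex set, serves every closed set. Additivity of `π₀` thereby becomes
  -- additivity of indicators.
  π₀-closed : ∀ {S U} {g : Matchings D n} → GEM S g → Closed g U →
              + π₀ U g ≡ ∑[ i ∈ representatives g ] 𝟙 (i ∈? U)
  π₀-closed {U = U} {g} gem cl = trans
    (cong (λ xs → + length xs) (sym (filter-deduplicate (connected? g) (_∈? U)
      (λ r → connected-closed cl (connected-sym gem r)) (allFin n))))
    (length-filter (_∈? U) (representatives g))

  π₀-─ : ∀ {S V K} {g : Matchings D n} → GEM S g → Closed g V → Closed g K → K ⊆ V →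
         π₀ V g ≡ π₀ (V ─ K) g + π₀ K g
  π₀-─ {S} {V} {K} {g} gem clV clK K⊆V = ℤ.+-injective (begin
    + π₀ V g
      ≡⟨ π₀-closed gem clV ⟩
    ∑[ i ∈ representatives g ] 𝟙 (i ∈? V)
      ≡⟨ ∑-ext (representatives g) parts ⟩
    ∑[ i ∈ representatives g ] (𝟙 (i ∈? (V ─ K)) ℤ.+ 𝟙 (i ∈? K))
      ≡⟨ ∑-+ (representatives g) _ _ ⟩
    ∑ (representatives g) (λ i → 𝟙 (i ∈? (V ─ K))) ℤ.+ ∑ (representatives g) (λ i → 𝟙 (i ∈? K))
      ≡⟨ cong₂ ℤ._+_ (π₀-closed gem (closed-─ gem clV clK)) (π₀-closed gem clK) ⟨
    + (π₀ (V ─ K) g + π₀ K g) ∎)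
    where
    open ≡-Reasoning

    parts : ∀ i → 𝟙 (i ∈? V) ≡ 𝟙 (i ∈? (V ─ K)) ℤ.+ 𝟙 (i ∈? K)
    parts i with i ∈? K
    ... | yes i∈K = trans (𝟙-yes (i ∈? V) (K⊆V i∈K))
            (cong (ℤ._+ 1ℤ) (sym (𝟙-no (i ∈? (V ─ K)) (λ i∈ → proj₂ (x∈p─q⁻ V K i∈) i∈K))))
    ... | no i∉K  = trans
            (𝟙-cong (i ∈? V) (i ∈? (V ─ K)) (λ i∈V → x∈p∧x∉q⇒x∈p─q i∈V i∉K) (p─q⊆p V K))
            (sym (ℤ.+-identityʳ _))

  component : Matchings D n → Fin n → Subset n
  component g y = tabulate (λ i → does (connected? g y i))

  module _ (g : Matchings D n) (y : Fin n) where

    component⁺ : ∀ {i} → Connected g y i → i ∈ component g y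
    component⁺ {i} r = Vec.lookup⇒[]= i _
      (trans (Vec.lookup∘tabulate _ i) (Dec.dec-true (connected? g y i) r))

    component⁻ : ∀ {i} → i ∈ component g y → Connected g y i
    component⁻ {i} i∈ with connected? g y i in eq
    ... | yes r = r
    ... | no ¬r = contradiction (trans (sym (Vec.[]=⇒lookup i∈))
            (trans (Vec.lookup∘tabulate (λ i → does (connected? g y i)) i) (cong does eq))) λ ()

    ∈component : y ∈ component g y
    ∈component = component⁺ ε

    component-closed : Closed g (component g y)
    component-closed = mkClosed λ c i i∈ → component⁺ (component⁻ i∈ ◅◅ ((c , refl) ◅ ε))

    component-⊆ : ∀ {U} → Closed g U → y ∈ U → component g y ⊆ U
    component-⊆ cl y∈U i∈ = connected-closed cl (component⁻ i∈) y∈U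

    component-disjoint : ∀ {S U} → GEM S g → Closed g U → y ∉ U → ∀ {i} → i ∈ component g y → i ∉ U
    component-disjoint gem cl y∉U i∈ i∈U = y∉U (connected-closed cl (connected-sym gem (component⁻ i∈)) i∈U)

    π₀-component : ∀ {S} → GEM S g → π₀ (component g y) g ≡ 1
    π₀-component gem = length-deduplicate-related (connected? g) {xs = members (component g y)}
      (λ x∈ z∈ → connected-sym gem (component⁻ (members⁻ x∈)) ◅◅ component⁻ (members⁻ z∈))
      (members⁺ ∈component)

-- Relabelling

-- Enumerates `U` in increasing order, so that the list of its members is literally a mapped
-- `allFin` and no permutation of representatives arises.
embed : ∀ {n} (U : Subset n) → Fin (∣ U ∣) → Fin n
embed (inside  ∷ U) zero    = zero
embed (inside  ∷ U) (suc i) = suc (embed U i)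
embed (outside ∷ U) i       = suc (embed U i)

index : ∀ {n} (U : Subset n) {x} → x ∈ U → Fin (∣ U ∣)
index (inside  ∷ U) Vec.here      = zero
index (inside  ∷ U) (Vec.there p) = suc (index U p)
index (outside ∷ U) (Vec.there p) = index U p

embed-∈ : ∀ {n} (U : Subset n) i → embed U i ∈ U
embed-∈ (inside  ∷ U) zero    = Vec.here
embed-∈ (inside  ∷ U) (suc i) = Vec.there (embed-∈ U i)
embed-∈ (outside ∷ U) i       = Vec.there (embed-∈ U i)

embed-index : ∀ {n} (U : Subset n) {x} (p : x ∈ U) → embed U (index U p) ≡ x
embed-index (inside  ∷ U) Vec.here      = refl
embed-index (inside  ∷ U) (Vec.there p) = cong suc (embed-index U p)
embed-index (outside ∷ U) (Vec.there p) = cong suc (embed-index U p)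

embed-injective : ∀ {n} (U : Subset n) {i j} → embed U i ≡ embed U j → i ≡ j
embed-injective (inside  ∷ U) {zero}  {zero}  eq = refl
embed-injective (inside  ∷ U) {suc i} {suc j} eq = cong suc (embed-injective U (Fin.suc-injective eq))
embed-injective (outside ∷ U)                 eq = embed-injective U (Fin.suc-injective eq)

members≡map-embed : ∀ {n} (U : Subset n) → filter (_∈? U) (allFin n) ≡ List.map (embed U) (allFin (∣ U ∣))
members≡map-embed [] = refl
members≡map-embed {suc n} (s ∷ U) = trans (cong (filter (_∈? (s ∷ U))) (allFin-suc n)) (head s)
  where
  open ≡-Reasoning

  tail : ∀ s → filter (_∈? (s ∷ U)) (List.map suc (allFin n)) ≡ List.map (suc ∘ embed U) (allFin (∣ U ∣))
  tail s = begin
    filter (_∈? (s ∷ U)) (List.map suc (allFin n))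
      ≡⟨ filter-map-suc (allFin n) ⟩
    List.map suc (filter (_∈? U) (allFin n))
      ≡⟨ cong (List.map suc) (members≡map-embed U) ⟩
    List.map suc (List.map (embed U) (allFin (∣ U ∣)))
      ≡⟨ List.map-∘ (allFin (∣ U ∣)) ⟨
    List.map (suc ∘ embed U) (allFin (∣ U ∣)) ∎
    where
    filter-map-suc : ∀ xs → filter (_∈? (s ∷ U)) (List.map suc xs) ≡ List.map suc (filter (_∈? U) xs)
    filter-map-suc []       = refl
    filter-map-suc (x ∷ xs) with x ∈? U
    ... | yes _ = cong (suc x ∷_) (filter-map-suc xs)
    ... | no  _ = filter-map-suc xs

  head : ∀ s → filter (_∈? (s ∷ U)) (zero ∷ List.map suc (allFin n)) ≡
               List.map (embed (s ∷ U)) (allFin (∣ s ∷ U ∣))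
  head outside = tail outside
  head inside  = cong (zero ∷_) (trans (tail inside)
    (trans (List.map-tabulate id (suc ∘ embed U)) (sym (List.map-tabulate suc (embed (inside ∷ U))))))

module _ {D n : ℕ} (U : Subset n) where

  private
    extendAct : Matchings D (∣ U ∣) → Fin (suc D) → Fin n → Fin n
    extendAct g c x with x ∈? U
    ... | yes x∈U = embed U (act g c (index U x∈U))
    ... | no  _   = x

    contractAct : Matchings D n → Fin (suc D) → Fin (∣ U ∣) → Fin (∣ U ∣)
    contractAct g c i with act g c (embed U i) ∈? U
    ... | yes gi∈U = index U gi∈U
    -- A default value, never reached when `U` is closed for `g`.
    ... | no  _    = i

  extend : Matchings D (∣ U ∣) → Matchings D n
  extend g = build (extendAct g)

  contract : Matchings D n → Matchings D (∣ U ∣)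
  contract g = build (contractAct g)

  act-extend : ∀ g c i → act (extend g) c (embed U i) ≡ embed U (act g c i)
  act-extend g c i = trans (act-build (extendAct g) c (embed U i)) eq
    where
    eq : extendAct g c (embed U i) ≡ embed U (act g c i)
    eq with embed U i ∈? U
    ... | yes p = cong (embed U ∘ act g c) (embed-injective U (embed-index U p))
    ... | no ¬p = contradiction (embed-∈ U i) ¬p

  act-extend-∉ : ∀ g c {x} → x ∉ U → act (extend g) c x ≡ x
  act-extend-∉ g c {x} x∉U = trans (act-build (extendAct g) c x) eq
    where
    eq : extendAct g c x ≡ x
    eq with x ∈? U
    ... | yes x∈U = contradiction x∈U x∉U
    ... | no  _   = refl

  act-contract : ∀ {g} → Closed g U → ∀ c i → embed U (act (contract g) c i) ≡ act g c (embed U i)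
  act-contract {g} cl c i = trans (cong (embed U) (act-build (contractAct g) c i)) eq
    where
    eq : embed U (contractAct g c i) ≡ act g c (embed U i)
    eq with act g c (embed U i) ∈? U
    ... | yes p = embed-index U p
    ... | no ¬p = contradiction (Closed.step cl c _ (embed-∈ U i)) ¬p

  ∈-elim : ∀ (P : Fin n → Set) → (∀ i → P (embed U i)) → ∀ {x} → x ∈ U → P x
  ∈-elim P p x∈U = subst P (embed-index U x∈U) (p (index U x∈U))

  extend-gem : ∀ {g} → GEM ⊤ g → GEM U (extend g)
  extend-gem {g} gem = mkGEM inv
    (λ c x → ∈-elim (λ x → act (extend g) c x ≢ x) (λ i eq →
      gem-≢ gem c ∈⊤ (embed-injective U (trans (sym (act-extend g c i)) eq))))
    (λ c x → act-extend-∉ g c)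
    where
    inv : ∀ c x → act (extend g) c (act (extend g) c x) ≡ x
    inv c x with x ∈? U
    ... | no x∉U = trans (cong (act (extend g) c) (act-extend-∉ g c x∉U)) (act-extend-∉ g c x∉U)
    ... | yes x∈U = ∈-elim (λ x → act (extend g) c (act (extend g) c x) ≡ x)
            (λ i → trans (cong (act (extend g) c) (act-extend g c i))
              (trans (act-extend g c (act g c i)) (cong (embed U) (gem-involutive gem c i)))) x∈U

  contract-gem : ∀ {g} → GEM U g → GEM ⊤ (contract g)
  contract-gem {g} gem = mkGEM
    (λ c i → embed-injective U (trans (act-contract cl c _)
      (trans (cong (act g c) (act-contract cl c i)) (gem-involutive gem c (embed U i)))))
    (λ c i _ eq → gem-≢ gem c (embed-∈ U i) (trans (sym (act-contract cl c i)) (cong (embed U) eq)))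
    (λ c i i∉⊤ → contradiction ∈⊤ i∉⊤)
    where
    cl : Closed g U
    cl = gem-closed gem

  contract-extend : ∀ {g} → GEM ⊤ g → contract (extend g) ≡ g
  contract-extend {g} gem = act-ext {g = contract (extend g)} {g} λ c i →
    embed-injective U (trans (act-contract (gem-closed (extend-gem gem)) c i) (act-extend g c i))

  extend-contract : ∀ {g} → GEM U g → extend (contract g) ≡ g
  extend-contract {g} gem = act-ext {g = extend (contract g)} {g} agree
    where
    agree : ∀ c x → act (extend (contract g)) c x ≡ act g c x
    agree c x with x ∈? U
    ... | no x∉U = trans (act-extend-∉ (contract g) c x∉U) (sym (gem-≡ gem c x∉U))
    ... | yes x∈U = ∈-elim (λ x → act (extend (contract g)) c x ≡ act g c x)
            (λ i → trans (act-extend (contract g) c i) (act-contract (gem-closed gem) c i)) x∈U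

  connected-extend⁺ : ∀ g {i j} → Connected g i j → Connected (extend g) (embed U i) (embed U j)
  connected-extend⁺ g = gmap (embed U) λ { {i} (c , refl) → c , act-extend g c i }

  -- The endpoints are variables tied to `embed U` by equations, because induction on the path needs
  -- its indices free. Each step stays in the image of `embed U`.
  connected-extend⁻ : ∀ g {x y} → Connected (extend g) x y →
    ∀ {i j} → x ≡ embed U i → y ≡ embed U j → Connected g i j
  connected-extend⁻ g ε {i} x≡ y≡ = subst (Connected g i) (embed-injective U (trans (sym x≡) y≡)) ε
  connected-extend⁻ g ((c , refl) ◅ p) {i} refl y≡ =
    (c , refl) ◅ connected-extend⁻ g p (act-extend g c i) y≡

  π₀-extend : ∀ g → π₀ U (extend g) ≡ π₀ ⊤ g
  π₀-extend g = begin
    length (deduplicate (connected? (extend g)) (filter (_∈? U) (allFin n)))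
      ≡⟨ cong (length ∘ deduplicate (connected? (extend g))) (members≡map-embed U) ⟩
    length (deduplicate (connected? (extend g)) (List.map (embed U) (allFin (∣ U ∣))))
      ≡⟨ cong length (deduplicate-map (connected? g) (connected? (extend g)) (embed U) (allFin (∣ U ∣))
           (λ _ _ → connected-extend⁺ g) (λ _ _ p → connected-extend⁻ g p refl refl)) ⟩
    length (List.map (embed U) (deduplicate (connected? g) (allFin (∣ U ∣))))
      ≡⟨ List.length-map (embed U) (deduplicate (connected? g) (allFin (∣ U ∣))) ⟩
    length (deduplicate (connected? g) (allFin (∣ U ∣)))
      ≡⟨ cong (length ∘ deduplicate (connected? g))
           (List.filter-all (_∈? ⊤) (All.universal (λ _ → ∈⊤) (allFin (∣ U ∣)))) ⟨
    π₀ ⊤ g ∎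
    where open ≡-Reasoning

∑π₀ : ∀ D {n} → Subset n → (ℕ → ℤ) → ℤ
∑π₀ D U h = ∑[ g ∈ gems D U ] h (π₀ U g)

-- The sum thus depends on the size of `U` alone, which is what allows sums over subsets to be
-- rewritten by `∑splits`.
∑π₀-relabel : ∀ D {n} (U : Subset n) h → ∑π₀ D U h ≡ ∑π₀ D (⊤ {∣ U ∣}) h
∑π₀-relabel D U h = sym (∑-bijection _≟ᴹ_ _≟ᴹ_ (gems-unique ⊤) (gems-unique U) (extend U) (contract U)
  (λ g g∈ → gems-∈⁺ (extend-gem U (gems-∈⁻ g∈)) , contract-extend U (gems-∈⁻ g∈))
  (λ g g∈ → gems-∈⁺ (contract-gem U (gems-∈⁻ g∈)) , extend-contract U (gems-∈⁻ g∈))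
  (λ g _ → cong h (sym (π₀-extend U g))))

-- GEMs with a giant component

sgn : ℕ → ℤ
sgn zero    = 1ℤ
sgn (suc k) = ℤ.- sgn k

∣sgn∣≡1 : ∀ k → ℤ.∣ sgn k ∣ ≡ 1
∣sgn∣≡1 zero    = refl
∣sgn∣≡1 (suc k) = trans (ℤ.∣-i∣≡∣i∣ (sgn k)) (∣sgn∣≡1 k)

_≟ˢ_ : ∀ {n} → DecidableEquality (Subset n)
_≟ˢ_ = Vec.≡-dec Bool._≟_

subsets-∈ : ∀ {n} (W : Subset n) → W List.∈ subsets n
subsets-∈ = ∈-vectors λ { inside → here refl ; outside → there (here refl) }

subsets-unique : ∀ n → Unique (subsets n)
subsets-unique = vectors-unique (((λ ()) ∷ []) ∷ [] ∷ [])

∣W∣+∣S─W∣ : ∀ {n} (W S : Subset n) → W ⊆ S → ∣ W ∣ + (∣ S ─ W ∣) ≡ ∣ S ∣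
∣W∣+∣S─W∣ []            []            _   = refl
∣W∣+∣S─W∣ (inside  ∷ W) (inside  ∷ S) W⊆S = cong suc (∣W∣+∣S─W∣ W S (drop-∷-⊆ W⊆S))
∣W∣+∣S─W∣ (inside  ∷ W) (outside ∷ S) W⊆S = case W⊆S Vec.here of λ ()
∣W∣+∣S─W∣ (outside ∷ W) (inside  ∷ S) W⊆S =
  trans (ℕ.+-suc (∣ W ∣) _) (cong suc (∣W∣+∣S─W∣ W S (drop-∷-⊆ W⊆S)))
∣W∣+∣S─W∣ (outside ∷ W) (outside ∷ S) W⊆S = ∣W∣+∣S─W∣ W S (drop-∷-⊆ W⊆S)

∣W∣+∣⊤─W∣ : ∀ {n} (W : Subset n) → ∣ W ∣ + (∣ ⊤ ─ W ∣) ≡ n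
∣W∣+∣⊤─W∣ {n} W = trans (∣W∣+∣S─W∣ W ⊤ ⊆⊤) (∣⊤∣≡n n)

∣p∪q∣≤ : ∀ {n} (p q : Subset n) → ∣ p ∪ q ∣ ≤ (∣ p ∣) + (∣ q ∣)
∣p∪q∣≤ []            []            = z≤n
∣p∪q∣≤ (inside  ∷ p) (inside  ∷ q) =
  s≤s (ℕ.≤-trans (∣p∪q∣≤ p q) (ℕ.+-monoʳ-≤ (∣ p ∣) (ℕ.n≤1+n _)))
∣p∪q∣≤ (inside  ∷ p) (outside ∷ q) = s≤s (∣p∪q∣≤ p q)
∣p∪q∣≤ (outside ∷ p) (inside  ∷ q) =
  ℕ.≤-trans (s≤s (∣p∪q∣≤ p q)) (ℕ.≤-reflexive (sym (ℕ.+-suc (∣ p ∣) _)))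
∣p∪q∣≤ (outside ∷ p) (outside ∷ q) = ∣p∪q∣≤ p q

infixl 5 _△_
_△_ : ∀ {n} → Subset n → Subset n → Subset n
_△_ = Vec.zipWith _xor_

△-involutive : ∀ {n} (p q : Subset n) → (p △ q) △ q ≡ p
△-involutive []      []            = refl
△-involutive (s ∷ p) (t ∷ q) = cong₂ _∷_ (xor-cancel s t) (△-involutive p q)
  where
  xor-cancel : ∀ s t → (s xor t) xor t ≡ s
  xor-cancel true  true  = refl
  xor-cancel true  false = refl
  xor-cancel false true  = refl
  xor-cancel false false = refl

∈△-∈ : ∀ {n} {i : Fin n} (p q : Subset n) → i ∈ q → i ∉ p → i ∈ p △ q
∈△-∈ (inside  ∷ p) (_ ∷ q) Vec.here       i∉p = contradiction Vec.here i∉p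
∈△-∈ (outside ∷ p) (_ ∷ q) Vec.here       i∉p = Vec.here
∈△-∈ (_ ∷ p)       (_ ∷ q) (Vec.there i∈) i∉p = Vec.there (∈△-∈ p q i∈ (i∉p ∘ Vec.there))

∈△-∉ : ∀ {n} {i : Fin n} (p q : Subset n) → i ∉ q → i ∈ p → i ∈ p △ q
∈△-∉ (_ ∷ p) (inside  ∷ q) i∉q Vec.here       = contradiction Vec.here i∉q
∈△-∉ (_ ∷ p) (outside ∷ q) i∉q Vec.here       = Vec.here
∈△-∉ (_ ∷ p) (_ ∷ q)       i∉q (Vec.there i∈) = Vec.there (∈△-∉ p q (i∉q ∘ Vec.there) i∈)

∉△-∈ : ∀ {n} {i : Fin n} (p q : Subset n) → i ∈ q → i ∈ p △ q → i ∉ p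
∉△-∈ p q i∈q i∈△ i∈p = ∉ p q i∈q i∈△ i∈p
  where
  ∉ : ∀ {n} {i : Fin n} (p q : Subset n) → i ∈ q → i ∈ p △ q → i ∉ p
  ∉ (_ ∷ p) (_ ∷ q) Vec.here ()         Vec.here
  ∉ (_ ∷ p) (_ ∷ q) (Vec.there a) (Vec.there b) (Vec.there c) = ∉ p q a b c

∈△-∉⁻ : ∀ {n} {i : Fin n} (p q : Subset n) → i ∉ q → i ∈ p △ q → i ∈ p
∈△-∉⁻ p q i∉q i∈△ = subst (_ ∈_) (△-involutive p q) (∈△-∉ (p △ q) q i∉q i∈△)

small? : ∀ {D n} (g : Matchings D n) s U W → Dec (U ⊆ W × Closed g W × ∣ W ∣ ≤ s)
small? g s U W = (U ⊆? W) ×-dec (closed? g W) ×-dec (∣ W ∣ ℕ.≤? s)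

-- In a graph with a component of x that leaves at most s vertices uncovered, a
-- closed set with at most s vertices is the same as a closed set avoiding x.
-- The alternating sum over such sets W ⊇ U cancels by toggling a component
-- outside U and the component of x, if there is one.
module _ {D n : ℕ} {g : Matchings D n} (gem : GEM ⊤ g) where

  module _ {U : Subset n} (clU : Closed g U) (x : Fin n) where

    Extends : Subset n → Set
    Extends W = U ⊆ W × Closed g W × x ∉ W

    extends? : ∀ W → Dec (Extends W)
    extends? W = (U ⊆? W) ×-dec (closed? g W) ×-dec ¬? (x ∈? W)

    module _ {y : Fin n} (y∉U : y ∉ U) (y∉Kx : y ∉ component g x) where

      private
        K : Subset n
        K = component g y

        clK : Closed g K
        clK = component-closed g y

        toggle-extends : ∀ {W} → Extends W → Extends (W △ K)
        toggle-extends {W} (U⊆W , clW , x∉W) =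
            (λ i∈U → ∈△-∉ W K (λ i∈K → component-disjoint g y gem clU y∉U i∈K i∈U) (U⊆W i∈U))
          , mkClosed stepW
          , λ x∈ → x∉W (∈△-∉⁻ W K x∉K x∈)
          where
          x∉K : x ∉ K
          x∉K x∈K = y∉Kx (component⁺ g x (connected-sym gem (component⁻ g y x∈K)))

          back : ∀ {V} → Closed g V → ∀ c {i} → act g c i ∈ V → i ∈ V
          back clV c {i} gi∈V = subst (_∈ _) (gem-involutive gem c i) (Closed.step clV c _ gi∈V)

          stepW : ∀ c i → i ∈ W △ K → act g c i ∈ W △ K
          stepW c i i∈ with i ∈? K
          ... | yes i∈K = ∈△-∈ W K (Closed.step clK c i i∈K) (∉△-∈ W K i∈K i∈ ∘ back clW c)
          ... | no  i∉K = ∈△-∉ W K (i∉K ∘ back clK c) (Closed.step clW c i (∈△-∉⁻ W K i∉K i∈))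

        -- When `y ∈ W`, toggling removes the whole of `K`, which is exactly one component of
        -- `W ─ U`.
        sgn-toggle : ∀ {W} → Extends W → y ∈ W → sgn (π₀ (W ─ U) g) ≡ ℤ.- sgn (π₀ (W △ K ─ U) g)
        sgn-toggle {W} (U⊆W , clW , _) y∈W = begin
          sgn (π₀ (W ─ U) g)
            ≡⟨ cong sgn (π₀-─ gem (closed-─ gem clW clU) clK K⊆W─U) ⟩
          sgn (π₀ (W ─ U ─ K) g + π₀ K g)
            ≡⟨ cong₂ (λ V k → sgn (π₀ V g + k))
                 (trans (p─q─r≡p─r─q W U K) (cong (_─ U) (sym toggle≡─)))
                 (π₀-component g y gem) ⟩
          sgn (π₀ (W △ K ─ U) g + 1)
            ≡⟨ cong sgn (ℕ.+-comm (π₀ (W △ K ─ U) g) 1) ⟩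
          ℤ.- sgn (π₀ (W △ K ─ U) g) ∎
          where
          open ≡-Reasoning

          K⊆W : K ⊆ W
          K⊆W = component-⊆ g y clW y∈W

          K⊆W─U : K ⊆ W ─ U
          K⊆W─U i∈K = x∈p∧x∉q⇒x∈p─q (K⊆W i∈K) (component-disjoint g y gem clU y∉U i∈K)

          toggle≡─ : W △ K ≡ W ─ K
          toggle≡─ = ⊆-antisym
            (λ {i} i∈ → case i ∈? K of λ where
              (yes i∈K) → contradiction (K⊆W i∈K) (∉△-∈ W K i∈K i∈)
              (no  i∉K) → x∈p∧x∉q⇒x∈p─q (∈△-∉⁻ W K i∉K i∈) i∉K)
            (λ i∈ → let i∈W , i∉K = x∈p─q⁻ W K i∈ in ∈△-∉ W K i∉K i∈W)

      ∑-extends-zero : ∑[ W ∈ subsets n ] 𝟙 (extends? W) ℤ.* sgn (π₀ (W ─ U) g) ≡ 0ℤ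
      ∑-extends-zero = ∑-involution _≟ˢ_ (subsets-unique n) (_△ K) (λ W → subsets-∈ (W △ K))
        (λ W → △-involutive W K) odd
        where
        odd : ∀ W → 𝟙 (extends? (W △ K)) ℤ.* sgn (π₀ (W △ K ─ U) g) ≡
                    ℤ.- (𝟙 (extends? W) ℤ.* sgn (π₀ (W ─ U) g))
        odd W = trans
          (cong (ℤ._* sgn (π₀ (W △ K ─ U) g)) (𝟙-cong (extends? (W △ K)) (extends? W)
            (λ e → subst Extends (△-involutive W K) (toggle-extends e)) toggle-extends))
          (trans (𝟙-*-cong (extends? W) flip) (sym (ℤ.neg-distribʳ-* (𝟙 (extends? W)) _)))
          where
          flip : Extends W → sgn (π₀ (W △ K ─ U) g) ≡ ℤ.- sgn (π₀ (W ─ U) g)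
          flip e with y ∈? W
          ... | yes y∈W = trans (sym (ℤ.neg-involutive _)) (cong ℤ.-_ (sym (sgn-toggle e y∈W)))
          -- `sgn-toggle` expects `y` inside, so it is applied to `W △ K`; toggling back restores
          -- `W`.
          ... | no  y∉W = trans (sgn-toggle (toggle-extends e) (∈△-∈ W K (∈component g y) y∉W))
                  (cong (λ V → ℤ.- sgn (π₀ (V ─ U) g)) (△-involutive W K))

    -- With nothing outside `U` except vertices of the component of `x`, a closed set above `U` that
    -- avoids `x` has no room to grow, and only `W = U` is left.
    ∑-extends-one : x ∉ U → (∀ y → y ∉ U → y ∈ component g x) →
                    ∑[ W ∈ subsets n ] 𝟙 (extends? W) ℤ.* sgn (π₀ (W ─ U) g) ≡ 1ℤ
    ∑-extends-one x∉U rest = begin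
      ∑[ W ∈ subsets n ] 𝟙 (extends? W) ℤ.* sgn (π₀ (W ─ U) g)
        ≡⟨ ∑-ext (subsets n) (λ W → cong (ℤ._* sgn (π₀ (W ─ U) g)) (𝟙-cong (extends? W) (W ≟ˢ U)
             only (λ { refl → (λ i∈ → i∈) , clU , x∉U }))) ⟩
      ∑[ W ∈ subsets n ] 𝟙 (W ≟ˢ U) ℤ.* sgn (π₀ (W ─ U) g)
        ≡⟨ ∑-𝟙-∈ _≟ˢ_ _ (subsets-unique n) (subsets-∈ U) ⟩
      sgn (π₀ (U ─ U) g)
        ≡⟨ cong (sgn ∘ length ∘ deduplicate (connected? g)) (List.filter-none (_∈? (U ─ U))
             (All.universal (λ i i∈ → let i∈U , i∉U = x∈p─q⁻ U U i∈ in i∉U i∈U) (allFin n))) ⟩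
      1ℤ ∎
      where
      open ≡-Reasoning

      only : ∀ {W} → Extends W → W ≡ U
      only {W} (U⊆W , clW , x∉W) = ⊆-antisym
        (λ {i} i∈W → case i ∈? U of λ where
          (yes i∈U) → i∈U
          (no  i∉U) → contradiction i∈W (component-disjoint g x gem clW x∉W (rest i i∉U)))
        (λ i∈U → U⊆W i∈U)

  module _ {s : ℕ} (s+s<n : s + s < n) (x : Fin n) (giant : ∣ ⊤ ─ component g x ∣ ≤ s) where

    private
      K : Subset n
      K = component g x

      s<∣K∣ : s < ∣ K ∣
      s<∣K∣ = ℕ.+-cancelʳ-< s s (∣ K ∣) (ℕ.<-≤-trans s+s<n
        (subst (_≤ ∣ K ∣ + s) (∣W∣+∣⊤─W∣ K) (ℕ.+-monoʳ-≤ (∣ K ∣) giant)))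

    small⇒∉ : ∀ {W} → Closed g W → ∣ W ∣ ≤ s → x ∉ W
    small⇒∉ clW ∣W∣≤s x∈W =
      ℕ.<⇒≱ s<∣K∣ (ℕ.≤-trans (p⊆q⇒∣p∣≤∣q∣ (component-⊆ g x clW x∈W)) ∣W∣≤s)

    ∉⇒small : ∀ {W} → Closed g W → x ∉ W → ∣ W ∣ ≤ s
    ∉⇒small {W} clW x∉W = ℕ.≤-trans (p⊆q⇒∣p∣≤∣q∣ {p = W} {⊤ ─ K} λ i∈W →
      x∈p∧x∉q⇒x∈p─q ∈⊤ (λ i∈K → component-disjoint g x gem clW x∉W i∈K i∈W)) giant

    module _ {U : Subset n} (clU : Closed g U) where

      -- If `x ∈ U`, no `W` qualifies; if some vertex lies outside both `U` and `K`, its component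
      -- is toggled and all cancels. In the only remaining case `U` is the complement of the giant
      -- component.
      ∑-small : ∑[ W ∈ subsets n ] 𝟙 (small? g s U W) ℤ.* sgn (π₀ (W ─ U) g) ≡ 𝟙 (U ≟ˢ (⊤ ─ K))
      ∑-small = trans
        (∑-ext (subsets n) (λ W → cong (ℤ._* sgn (π₀ (W ─ U) g)) (𝟙-cong (small? g s U W) (extends? clU x W)
          (λ { (U⊆W , clW , le) → U⊆W , clW , small⇒∉ clW le })
          (λ { (U⊆W , clW , x∉) → U⊆W , clW , ∉⇒small clW x∉ }))))
        cases
        where
        cases : ∑[ W ∈ subsets n ] 𝟙 (extends? clU x W) ℤ.* sgn (π₀ (W ─ U) g) ≡ 𝟙 (U ≟ˢ (⊤ ─ K))
        cases with x ∈? U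
        ... | yes x∈U = trans (trans
                (∑-ext (subsets n) (λ W → cong (ℤ._* sgn (π₀ (W ─ U) g))
                  (𝟙-no (extends? clU x W) (λ { (U⊆W , _ , x∉W) → x∉W (U⊆W x∈U) }))))
                (∑-zero (subsets n)))
                (sym (𝟙-no (U ≟ˢ (⊤ ─ K)) λ { refl → proj₂ (x∈p─q⁻ ⊤ K x∈U) (∈component g x) }))
        ... | no x∉U with Fin.any? (λ y → ¬? (y ∈? U) ×-dec ¬? (y ∈? K))
        ...   | yes (y , y∉U , y∉K) = trans (∑-extends-zero clU x y∉U y∉K)
                (sym (𝟙-no (U ≟ˢ (⊤ ─ K)) λ { refl → y∉U (x∈p∧x∉q⇒x∈p─q ∈⊤ y∉K) }))
        ...   | no none = trans (∑-extends-one clU x x∉U rest) (sym (𝟙-yes (U ≟ˢ (⊤ ─ K)) U≡))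
          where
          rest : ∀ y → y ∉ U → y ∈ K
          rest y y∉U with y ∈? K
          ... | yes y∈K = y∈K
          ... | no  y∉K = contradiction (y , y∉U , y∉K) none

          U≡ : U ≡ ⊤ ─ K
          U≡ = ⊆-antisym
            (λ i∈U → x∈p∧x∉q⇒x∈p─q ∈⊤ (λ i∈K → component-disjoint g x gem clU x∉U i∈K i∈U))
            (λ {i} i∈ → case i ∈? U of λ where
              (yes i∈U) → i∈U
              (no  i∉U) → contradiction (rest i i∉U) (proj₂ (x∈p─q⁻ ⊤ K i∈)))

-- GEMs without a giant component

∣i-j∣≤0 : ∀ i j → i ≡ j → ∀ b → 0ℤ ℤ.≤ b → + ℤ.∣ i ℤ.- j ∣ ℤ.≤ b ℤ.+ b
∣i-j∣≤0 i j i≡j b b≥0 =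
  subst (λ z → + ℤ.∣ z ∣ ℤ.≤ b ℤ.+ b) (sym (ℤ.i≡j⇒i-j≡0 i≡j)) (ℤ.+-mono-≤ b≥0 b≥0)

∣i-j∣≤ : ∀ i j b → + ℤ.∣ i ∣ ℤ.≤ b → + ℤ.∣ j ∣ ℤ.≤ b → + ℤ.∣ i ℤ.- j ∣ ℤ.≤ b ℤ.+ b
∣i-j∣≤ i j b i≤b j≤b = ℤ.≤-trans (ℤ.+≤+ (ℤ.∣i-j∣≤∣i∣+∣j∣ i j)) (ℤ.+-mono-≤ i≤b j≤b)

∣𝟙∣≤1 : ∀ {P : Set} (P? : Dec P) → ℤ.∣ 𝟙 P? ∣ ≤ 1
∣𝟙∣≤1 (yes _) = ℕ.≤-refl
∣𝟙∣≤1 (no _)  = z≤n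

𝟙-*-abs : ∀ {P : Set} (P? : Dec P) {x y} → + ℤ.∣ x ∣ ℤ.≤ y → + ℤ.∣ 𝟙 P? ℤ.* x ∣ ℤ.≤ 𝟙 P? ℤ.* y
𝟙-*-abs (yes _) {x} {y} le = subst₂ (λ a b → + ℤ.∣ a ∣ ℤ.≤ b)
  (sym (ℤ.*-identityˡ x)) (sym (ℤ.*-identityˡ y)) le
𝟙-*-abs (no _) le = ℤ.≤-refl

closed-∪ : ∀ {D n} {g : Matchings D n} {V K} → Closed g V → Closed g K → Closed g (V ∪ K)
closed-∪ {V = V} {K} clV clK = mkClosed λ c i i∈ → x∈p∪q⁺ (case x∈p∪q⁻ V K i∈ of λ where
  (inj₁ i∈V) → inj₁ (Closed.step clV c i i∈V)
  (inj₂ i∈K) → inj₂ (Closed.step clK c i i∈K))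

module _ {D n : ℕ} (s : ℕ) where

  -- h selects the required number of components of the first GEM of the pair
  -- (U , W ─ U).
  weight : (ℕ → ℤ) → Matchings D n → ℤ
  weight h g = ∑[ W ∈ subsets n ] 𝟙 (∣ W ∣ ℕ.≤? s) ℤ.* (𝟙 (closed? g W) ℤ.*
    (∑[ U ∈ subsets n ] 𝟙 (U ⊆? W) ℤ.* (𝟙 (closed? g U) ℤ.* (h (π₀ U g) ℤ.* sgn (π₀ (W ─ U) g)))))

  -- For closed `W`, both count the closed subsets `U` of `W`; the second also checks `W` itself.
  -- The trailing `1ℤ` gives the shape required by `∑-closed-local`, with constant `Φ`.
  closedParts closedPairs : Matchings D n → Subset n → ℤ
  closedParts g W = ∑[ U ∈ subsets n ] 𝟙 (U ⊆? W) ℤ.* (𝟙 (closed? g U) ℤ.* 1ℤ)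
  closedPairs g W = 𝟙 (closed? g W) ℤ.* closedParts g W

  balanced? : ∀ (V : Subset n) → Dec (s < ∣ V ∣ × s < ∣ ⊤ ─ V ∣)
  balanced? V = (s ℕ.<? ∣ V ∣) ×-dec (s ℕ.<? ∣ ⊤ ─ V ∣)

  -- Counts the chains U ⊆ W ⊆ V of closed sets with `V` balanced. Here `W` ranges over all closed
  -- subsets of `V`, small or not: an overcount whose sum over all GEMs is expressed by
  -- `gemTriples`.
  flags : Matchings D n → ℤ
  flags g = ∑[ V ∈ subsets n ] 𝟙 (balanced? V) ℤ.* (𝟙 (closed? g V) ℤ.*
    (∑[ W ∈ subsets n ] 𝟙 (W ⊆? V) ℤ.* closedPairs g W))

  module _ {g : Matchings D n} (gem : GEM ⊤ g) where

    -- The origin of the `m - 1` in the coefficients: the first GEM of a pair collects all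
    -- components but the giant one.
    π₀-⊤ : ∀ x → π₀ ⊤ g ≡ suc (π₀ (⊤ ─ component g x) g)
    π₀-⊤ x = trans (π₀-─ gem (gem-closed gem) (component-closed g x) ⊆⊤)
      (trans (cong (_+_ _) (π₀-component g x gem)) (ℕ.+-comm _ 1))

    weight-giant : s + s < n → ∀ x → ∣ ⊤ ─ component g x ∣ ≤ s →
                   ∀ h → weight h g ≡ h (π₀ (⊤ ─ component g x) g)
    weight-giant s+s<n x giant h = begin
      weight h g
        ≡⟨ ∑-ext (subsets n) (λ W → trans
             (cong (𝟙 (∣ W ∣ ℕ.≤? s) ℤ.*_) (sym (∑-*ˡ (𝟙 (closed? g W)) (subsets n) _)))
             (sym (∑-*ˡ (𝟙 (∣ W ∣ ℕ.≤? s)) (subsets n) _))) ⟩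
      ∑[ W ∈ subsets n ] ∑[ U ∈ subsets n ] 𝟙 (∣ W ∣ ℕ.≤? s) ℤ.* (𝟙 (closed? g W) ℤ.*
        (𝟙 (U ⊆? W) ℤ.* (𝟙 (closed? g U) ℤ.* (h (π₀ U g) ℤ.* sgn (π₀ (W ─ U) g)))))
        ≡⟨ ∑-swap (subsets n) (subsets n) _ ⟩
      ∑[ U ∈ subsets n ] ∑[ W ∈ subsets n ] 𝟙 (∣ W ∣ ℕ.≤? s) ℤ.* (𝟙 (closed? g W) ℤ.*
        (𝟙 (U ⊆? W) ℤ.* (𝟙 (closed? g U) ℤ.* (h (π₀ U g) ℤ.* sgn (π₀ (W ─ U) g)))))
        ≡⟨ ∑-ext (subsets n) (λ U → trans (∑-ext (subsets n) (λ W → trans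
             (ring (𝟙 (∣ W ∣ ℕ.≤? s)) (𝟙 (closed? g W)) (𝟙 (U ⊆? W)) (𝟙 (closed? g U))
                   (h (π₀ U g)) (sgn (π₀ (W ─ U) g)))
             (cong (λ e → 𝟙 (closed? g U) ℤ.* h (π₀ U g) ℤ.* (e ℤ.* sgn (π₀ (W ─ U) g)))
               (sym (trans (𝟙-× (U ⊆? W) (closed? g W ×-dec (∣ W ∣ ℕ.≤? s)))
                 (cong (𝟙 (U ⊆? W) ℤ.*_) (𝟙-× (closed? g W) (∣ W ∣ ℕ.≤? s))))))))
             (∑-*ˡ (𝟙 (closed? g U) ℤ.* h (π₀ U g)) (subsets n) _)) ⟩
      ∑[ U ∈ subsets n ] 𝟙 (closed? g U) ℤ.* h (π₀ U g) ℤ.*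
        (∑[ W ∈ subsets n ] 𝟙 (small? g s U W) ℤ.* sgn (π₀ (W ─ U) g))
        ≡⟨ ∑-ext (subsets n) (λ U → trans (ℤ.*-assoc (𝟙 (closed? g U)) _ _) (trans
             (𝟙-*-cong (closed? g U) (λ clU → cong (h (π₀ U g) ℤ.*_) (∑-small gem s+s<n x giant clU)))
             (ring′ (𝟙 (closed? g U)) (h (π₀ U g)) (𝟙 (U ≟ˢ (⊤ ─ K)))))) ⟩
      ∑[ U ∈ subsets n ] 𝟙 (U ≟ˢ (⊤ ─ K)) ℤ.* (𝟙 (closed? g U) ℤ.* h (π₀ U g))
        ≡⟨ ∑-𝟙-∈ _≟ˢ_ _ (subsets-unique n) (subsets-∈ (⊤ ─ K)) ⟩
      𝟙 (closed? g (⊤ ─ K)) ℤ.* h (π₀ (⊤ ─ K) g)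
        ≡⟨ cong (ℤ._* h (π₀ (⊤ ─ K) g)) (𝟙-yes (closed? g (⊤ ─ K))
             (closed-─ gem (gem-closed gem) (component-closed g x))) ⟩
      1ℤ ℤ.* h (π₀ (⊤ ─ K) g)
        ≡⟨ ℤ.*-identityˡ _ ⟩
      h (π₀ (⊤ ─ K) g) ∎
      where
      open ≡-Reasoning

      K : Subset n
      K = component g x

      ring : ∀ a b c d p q →
        a ℤ.* (b ℤ.* (c ℤ.* (d ℤ.* (p ℤ.* q)))) ≡ d ℤ.* p ℤ.* (c ℤ.* (b ℤ.* a) ℤ.* q)
      ring = ℤSolver.solve-∀

      ring′ : ∀ a b c → a ℤ.* (b ℤ.* c) ≡ c ℤ.* (a ℤ.* b)
      ring′ = ℤSolver.solve-∀

    closedPairs≥0 : ∀ W → 0ℤ ℤ.≤ closedPairs g W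
    closedPairs≥0 W = 𝟙-*≥0 (closed? g W) (∑≥0 (subsets n) (λ U →
      𝟙-*≥0 (U ⊆? W) (𝟙-*≥0 (closed? g U) (ℤ.+≤+ z≤n))))

    flags≥0 : 0ℤ ℤ.≤ flags g
    flags≥0 = ∑≥0 (subsets n) (λ V → 𝟙-*≥0 (balanced? V) (𝟙-*≥0 (closed? g V)
      (∑≥0 (subsets n) (λ W → 𝟙-*≥0 (W ⊆? V) (closedPairs≥0 W)))))

    ∑small : ℤ
    ∑small = ∑[ W ∈ subsets n ] 𝟙 (∣ W ∣ ℕ.≤? s) ℤ.* closedPairs g W

    ∣weight∣≤ : ∀ h → (∀ k → ℤ.∣ h k ∣ ≤ 1) → + ℤ.∣ weight h g ∣ ℤ.≤ ∑small
    ∣weight∣≤ h ∣h∣≤1 = ∑-abs (subsets n) (λ W _ → 𝟙-*-abs (∣ W ∣ ℕ.≤? s) (𝟙-*-abs (closed? g W)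
      (∑-abs (subsets n) (λ U _ → 𝟙-*-abs (U ⊆? W) (𝟙-*-abs (closed? g U)
        (ℤ.+≤+ (subst (_≤ 1) (sym (trans (ℤ.∣i*j∣≡∣i∣*∣j∣ (h (π₀ U g)) _)
          (trans (cong (ℤ.∣ h (π₀ U g) ∣ *_) (∣sgn∣≡1 (π₀ (W ─ U) g))) (ℕ.*-identityʳ _))))
          (∣h∣≤1 (π₀ U g)))))))))

    -- The pair `U = W = ⊥` is always counted. This lets `∑small` bound the indicator of the
    -- component count as well as the weight.
    1≤∑small : 1ℤ ℤ.≤ ∑small
    1≤∑small = ℤ.≤-trans (ℤ.≤-trans 1≤ (ℤ.≤-reflexive (sym eq)))
      (term≤∑ (λ W → 𝟙-*≥0 (∣ W ∣ ℕ.≤? s) (closedPairs≥0 W)) (subsets-∈ ⊥))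
      where
      cl⊥ : Closed g ⊥
      cl⊥ = mkClosed λ c i i∈⊥ → contradiction i∈⊥ ∉⊥

      eq : 𝟙 (∣ ⊥ {n} ∣ ℕ.≤? s) ℤ.* closedPairs g ⊥ ≡ closedParts g ⊥
      eq = trans (cong₂ (λ a b → a ℤ.* (b ℤ.* closedParts g ⊥))
        (𝟙-yes (∣ ⊥ {n} ∣ ℕ.≤? s) (subst (_≤ s) (sym (∣⊥∣≡0 n)) z≤n)) (𝟙-yes (closed? g ⊥) cl⊥))
        (trans (ℤ.*-identityˡ (1ℤ ℤ.* closedParts g ⊥)) (ℤ.*-identityˡ (closedParts g ⊥)))

      1≤ : 1ℤ ℤ.≤ closedParts g ⊥
      1≤ = ℤ.≤-trans (ℤ.≤-reflexive (sym (cong₂ (λ a b → a ℤ.* (b ℤ.* 1ℤ))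
             (𝟙-yes (⊥ {n} ⊆? ⊥) (λ i∈ → i∈)) (𝟙-yes (closed? g ⊥) cl⊥))))
           (term≤∑ (λ U → 𝟙-*≥0 (U ⊆? ⊥) (𝟙-*≥0 (closed? g U) (ℤ.+≤+ z≤n))) (subsets-∈ ⊥))

    Balanced : Subset n → Subset n → Set
    Balanced W V = W ⊆ V × Closed g V × s < ∣ V ∣ × s < ∣ ⊤ ─ V ∣

    module _ (3s<n : s + s + s < n) (noGiant : ∀ x → s < ∣ ⊤ ─ component g x ∣) where

      module _ {W : Subset n} (clW : Closed g W) (∣W∣≤s : ∣ W ∣ ≤ s) where

        -- Since `3 * s < n`, a component missing at most `2 * s` vertices has more than `s`. It
        -- cannot meet the small `W`, so its complement serves as `V`; the complement exceeds `s`
        -- because no component is giant.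
        balanced-large : ∀ x → ∣ ⊤ ─ component g x ∣ ≤ s + s → ∃ (Balanced W)
        balanced-large x large = ⊤ ─ K
          , (λ i∈W → x∈p∧x∉q⇒x∈p─q ∈⊤ (λ i∈K → component-disjoint g x gem clW x∉W i∈K i∈W))
          , closed-─ gem (gem-closed gem) (component-closed g x)
          , noGiant x
          , ℕ.<-≤-trans s<∣K∣ (p⊆q⇒∣p∣≤∣q∣ {p = K} {⊤ ─ (⊤ ─ K)} λ i∈K →
              x∈p∧x∉q⇒x∈p─q ∈⊤ (λ i∈ → proj₂ (x∈p─q⁻ ⊤ K i∈) i∈K))
          where
          K : Subset n
          K = component g x

          s<∣K∣ : s < ∣ K ∣
          s<∣K∣ = ℕ.+-cancelʳ-< (s + s) s (∣ K ∣) (ℕ.<-≤-trans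
            (subst (_< n) (ℕ.+-assoc s s s) 3s<n)
            (subst (_≤ ∣ K ∣ + (s + s)) (∣W∣+∣⊤─W∣ K) (ℕ.+-monoʳ-≤ (∣ K ∣) large)))

          x∉W : x ∉ W
          x∉W x∈W = ℕ.<⇒≱ s<∣K∣ (ℕ.≤-trans (p⊆q⇒∣p∣≤∣q∣ (component-⊆ g x clW x∈W)) ∣W∣≤s)

        Covers : List (Fin n) → Subset n → Set
        Covers xs V = W ⊆ V × Closed g V × ∣ V ∣ ≤ s × All (_∈ V) xs

        module _ (noLarge : ∀ x → s + s < ∣ ⊤ ─ component g x ∣) where

          -- Components are added to `W` until the size first exceeds `s`. Before the last addition
          -- the set has at most `s` vertices, and the added component misses more than `2 * s`, so
          -- more than `s` vertices are still left outside.
          grow : ∀ xs → ∃ (Balanced W) ⊎ ∃ (Covers xs)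
          grow []       = inj₂ (W , (λ i∈ → i∈) , clW , ∣W∣≤s , [])
          grow (x ∷ xs) with grow xs
          ... | inj₁ b = inj₁ b
          ... | inj₂ (V , W⊆V , clV , ∣V∣≤s , xs∈V) with ∣ V ∪ component g x ∣ ℕ.≤? s
          ...   | yes small = inj₂ (V ∪ component g x , (λ i∈ → V⊆ (W⊆V i∈)) , closed-∪ clV (component-closed g x) , small
                  , x∈p∪q⁺ (inj₂ (∈component g x)) ∷ All.map V⊆ xs∈V)
            where
            V⊆ : V ⊆ V ∪ component g x
            V⊆ = p⊆p∪q (component g x)
          ...   | no ¬small = inj₁ (V ∪ component g x
                  , (λ i∈ → p⊆p∪q (component g x) (W⊆V i∈)) , closed-∪ clV (component-closed g x) , ℕ.≰⇒> ¬small
                  , ℕ.+-cancelˡ-< (∣ V ∪ K ∣) s (∣ ⊤ ─ (V ∪ K) ∣) (ℕ.≤-<-trans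
                      (ℕ.+-monoˡ-≤ s (ℕ.≤-trans (∣p∪q∣≤ V K) (ℕ.+-monoˡ-≤ (∣ K ∣) ∣V∣≤s)))
                      (subst (s + (∣ K ∣) + s <_) (sym (∣W∣+∣⊤─W∣ (V ∪ K)))
                        (subst₂ _<_ (rearrange (∣ K ∣) s) (∣W∣+∣⊤─W∣ K)
                          (ℕ.+-monoʳ-< (∣ K ∣) (noLarge x))))))
            where
            K : Subset n
            K = component g x

            rearrange : ∀ k s → k + (s + s) ≡ s + k + s
            rearrange = ℕSolver.solve-∀

          balanced-small : ∃ (Balanced W)
          balanced-small with grow (allFin n)
          -- The process must stop early: a set covering all vertices would have `n > s` elements.
          ... | inj₁ b = b
          ... | inj₂ (V , _ , _ , ∣V∣≤s , all) = contradiction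
                (ℕ.≤-trans (subst (_≤ ∣ V ∣) (∣⊤∣≡n n)
                  (p⊆q⇒∣p∣≤∣q∣ {p = ⊤} {V} (λ {i} _ → All.lookup all (List.∈-allFin i)))) ∣V∣≤s)
                (ℕ.<⇒≱ (ℕ.≤-<-trans (ℕ.m≤n+m s (s + s)) 3s<n))

        balanced : ∃ (Balanced W)
        balanced with Fin.any? (λ x → ∣ ⊤ ─ component g x ∣ ℕ.≤? s + s)
        ... | yes (x , large) = balanced-large x large
        ... | no none = balanced-small (λ x → ℕ.≰⇒> (λ large → none (x , large)))

      -- For each small closed `W` a single `V` from `balanced` already accounts for all pairs with
      -- this `W`; the other terms are nonnegative.
      ∑small≤flags : ∑small ℤ.≤ flags g
      ∑small≤flags = ℤ.≤-trans (∑-mono (subsets n) (λ W _ → small≤ W)) (ℤ.≤-reflexive (sym expand))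
        where
        term : Subset n → Subset n → ℤ
        term W V = 𝟙 (balanced? V) ℤ.* (𝟙 (closed? g V) ℤ.* (𝟙 (W ⊆? V) ℤ.* closedPairs g W))

        expand : flags g ≡ ∑[ W ∈ subsets n ] ∑[ V ∈ subsets n ] term W V
        expand = trans (∑-ext (subsets n) (λ V → trans
            (cong (𝟙 (balanced? V) ℤ.*_) (sym (∑-*ˡ (𝟙 (closed? g V)) (subsets n) _)))
            (sym (∑-*ˡ (𝟙 (balanced? V)) (subsets n) _))))
          (∑-swap (subsets n) (subsets n) (λ V W → term W V))

        term≥0 : ∀ W V → 0ℤ ℤ.≤ term W V
        term≥0 W V = 𝟙-*≥0 (balanced? V) (𝟙-*≥0 (closed? g V) (𝟙-*≥0 (W ⊆? V) (closedPairs≥0 W)))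

        zero≤ : ∀ W {z} → z ≡ 0ℤ → z ℤ.≤ ∑ (subsets n) (term W)
        zero≤ W refl = ∑≥0 (subsets n) (term≥0 W)

        ones : ∀ z → 1ℤ ℤ.* z ≡ 1ℤ ℤ.* (1ℤ ℤ.* (1ℤ ℤ.* z))
        ones = ℤSolver.solve-∀

        small≤ : ∀ W → 𝟙 (∣ W ∣ ℕ.≤? s) ℤ.* closedPairs g W ℤ.≤ ∑ (subsets n) (term W)
        small≤ W = case ∣ W ∣ ℕ.≤? s of λ where
          (no ≰s) → zero≤ W (cong (ℤ._* closedPairs g W) (𝟙-no (∣ W ∣ ℕ.≤? s) ≰s))
          (yes ≤s) → case closed? g W of λ where
            (no ¬cl) → zero≤ W (trans (cong (𝟙 (∣ W ∣ ℕ.≤? s) ℤ.*_)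
              (cong (ℤ._* closedParts g W) (𝟙-no (closed? g W) ¬cl))) (ℤ.*-zeroʳ (𝟙 (∣ W ∣ ℕ.≤? s))))
            (yes cl) → let V , W⊆V , clV , s<V , s<V′ = balanced cl ≤s in
              ℤ.≤-trans (ℤ.≤-reflexive (trans
                (trans (cong (ℤ._* closedPairs g W) (𝟙-yes (∣ W ∣ ℕ.≤? s) ≤s)) (ones (closedPairs g W)))
                (sym (cong₂ ℤ._*_ (𝟙-yes (balanced? V) (s<V , s<V′))
                  (cong₂ ℤ._*_ (𝟙-yes (closed? g V) clV)
                    (cong (ℤ._* closedPairs g W) (𝟙-yes (W ⊆? V) W⊆V)))))))
                (term≤∑ (term≥0 W) (subsets-∈ V))

  ∣error∣≤flags : s + s + s < n → ∀ m {g} → GEM ⊤ g →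
    + ℤ.∣ 𝟙 (π₀ ⊤ g ℕ.≟ suc m) ℤ.- weight (λ k → 𝟙 (k ℕ.≟ m)) g ∣ ℤ.≤ flags g ℤ.+ flags g
  ∣error∣≤flags 3s<n m {g} gem with Fin.any? (λ x → ∣ ⊤ ─ component g x ∣ ℕ.≤? s)
  ... | yes (x , giant) = ∣i-j∣≤0 (𝟙 (π₀ ⊤ g ℕ.≟ suc m)) (weight h g) equal (flags g) (flags≥0 gem)
    where
    h : ℕ → ℤ
    h k = 𝟙 (k ℕ.≟ m)

    equal : 𝟙 (π₀ ⊤ g ℕ.≟ suc m) ≡ weight h g
    equal = trans
      (𝟙-cong (π₀ ⊤ g ℕ.≟ suc m) (π₀ (⊤ ─ component g x) g ℕ.≟ m)
        (λ eq → ℕ.suc-injective (trans (sym (π₀-⊤ gem x)) eq))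
        (λ eq → trans (π₀-⊤ gem x) (cong suc eq)))
      (sym (weight-giant gem (ℕ.≤-<-trans (ℕ.m≤m+n (s + s) s) 3s<n) x giant h))
  ... | no none = ∣i-j∣≤ (𝟙 (π₀ ⊤ g ℕ.≟ suc m)) (weight h g) (flags g)
      (ℤ.≤-trans (ℤ.≤-trans (ℤ.+≤+ (∣𝟙∣≤1 (π₀ ⊤ g ℕ.≟ suc m))) (1≤∑small gem)) bound)
      (ℤ.≤-trans (∣weight∣≤ gem h (λ k → ∣𝟙∣≤1 (k ℕ.≟ m))) bound)
    where
    h : ℕ → ℤ
    h k = 𝟙 (k ℕ.≟ m)

    bound : ∑small gem ℤ.≤ flags g
    bound = ∑small≤flags gem 3s<n (λ x → ℕ.≰⇒> (λ giant → none (x , giant)))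

-- Summation over all GEMs

module _ {D n : ℕ} where

  closed-agree : ∀ {g h : Matchings D n} {U} → (∀ c i → i ∈ U → act g c i ≡ act h c i) →
                 Closed g U → Closed h U
  closed-agree {U = U} agree cl = mkClosed λ c i i∈ → subst (_∈ U) (agree c i i∈) (Closed.step cl c i i∈)

  module _ {U W : Subset n} (U⊆W : U ⊆ W) (g h : Matchings D n) where

    𝟙-closed-glue : 𝟙 (closed? (glue W g h) U) ≡ 𝟙 (closed? g U)
    𝟙-closed-glue = 𝟙-cong (closed? (glue W g h) U) (closed? g U)
      (closed-agree {glue W g h} {g} (λ c i i∈ → glue-∈ W g h c (U⊆W i∈)))
      (closed-agree {g} {glue W g h} (λ c i i∈ → sym (glue-∈ W g h c (U⊆W i∈))))

    π₀-glue : Closed g U → π₀ U (glue W g h) ≡ π₀ U g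
    π₀-glue cl = π₀-agree {g = glue W g h} {g}
      (closed-agree {g} {glue W g h} (λ c i i∈ → sym (glue-∈ W g h c (U⊆W i∈))) cl) cl
      (λ c i i∈ → glue-∈ W g h c (U⊆W i∈))

  π₀-glue-─ : ∀ {W U : Subset n} (g h : Matchings D n) → Closed h (W ─ U) →
              π₀ (W ─ U) (glue U g h) ≡ π₀ (W ─ U) h
  π₀-glue-─ {W} {U} g h cl = π₀-agree {g = glue U g h} {h}
    (closed-agree {h} {glue U g h} (λ c i i∈ → sym (agree c i i∈)) cl) cl agree
    where
    agree : ∀ c i → i ∈ W ─ U → act (glue U g h) c i ≡ act h c i
    agree c i i∈ = glue-∉ U g h c (proj₂ (x∈p─q⁻ W U i∈))

  module _ (S : Subset n) (Φ : Subset n → Matchings D n → ℤ) where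

    ∑-closed : ∑[ g ∈ gems D S ] ∑[ W ∈ subsets n ] 𝟙 (W ⊆? S) ℤ.* (𝟙 (closed? g W) ℤ.* Φ W g) ≡
               ∑[ W ∈ subsets n ] 𝟙 (W ⊆? S) ℤ.*
                 (∑[ g ∈ gems D W ] ∑[ h ∈ gems D (S ─ W) ] Φ W (glue W g h))
    ∑-closed = trans (∑-swap (gems D S) (subsets n) _) (∑-ext (subsets n) λ W → trans
      (∑-*ˡ (𝟙 (W ⊆? S)) (gems D S) _)
      (𝟙-*-cong (W ⊆? S) (λ W⊆S → ∑-gems-split W⊆S (Φ W))))

    -- When `Φ W` sees the GEM only inside `W`, the GEM on `S ─ W` is free and contributes its
    -- number as a factor.
    ∑-closed-local : (∀ W {g h} → GEM W g → Φ W (glue W g h) ≡ Φ W g) →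
      ∑[ g ∈ gems D S ] ∑[ W ∈ subsets n ] 𝟙 (W ⊆? S) ℤ.* (𝟙 (closed? g W) ℤ.* Φ W g) ≡
      ∑[ W ∈ subsets n ] 𝟙 (W ⊆? S) ℤ.* (∑ (gems D W) (Φ W) ℤ.* + gemCount D (∣ S ─ W ∣))
    ∑-closed-local local = trans ∑-closed (∑-ext (subsets n) λ W → cong (𝟙 (W ⊆? S) ℤ.*_) (trans
      (∑-cong (gems D W) (λ g g∈ → trans
        (∑-ext (gems D (S ─ W)) (λ h → trans (local W {g} {h} (gems-∈⁻ g∈)) (sym (ℤ.*-identityʳ (Φ W g)))))
        (trans (∑-*ˡ (Φ W g) (gems D (S ─ W)) (λ _ → 1ℤ))
          (cong (Φ W g ℤ.*_) (trans (sym (∑-length (gems D (S ─ W)))) (cong +_ (length-gems D (S ─ W))))))))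
      (∑-*ʳ (+ gemCount D (∣ S ─ W ∣)) (gems D W) (Φ W))))

-- A chain of closed sets U ⊆ W cuts `W` into two parts, and U ⊆ W ⊆ V cuts `V` into three, with an
-- arbitrary GEM on each part. These are the numbers of such decorated splittings of a `k`-set.
gemPairs gemTriples : ℕ → ℕ → ℤ
gemPairs   D k = ∑splits k (λ i j → + gemCount D i ℤ.* + gemCount D j)
gemTriples D k = ∑splits k (λ i j → gemPairs D i ℤ.* + gemCount D j)

-- With `h` the indicator of `m`, this is the coefficient `𝔡 D k (suc m)`.
signedPairs : ℕ → (ℕ → ℤ) → ℕ → ℤ
signedPairs D h k = ∑splits k (λ i j → ∑π₀ D (⊤ {i}) h ℤ.* ∑π₀ D (⊤ {j}) sgn)

∑-gems-1 : ∀ D {n} (U : Subset n) → ∑[ g ∈ gems D U ] 1ℤ ≡ + gemCount D (∣ U ∣)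
∑-gems-1 D U = trans (sym (∑-length (gems D U))) (cong +_ (length-gems D U))

∑-⊆⊤ : ∀ n (f : ℕ → ℕ → ℤ) → ∑[ W ∈ subsets n ] 𝟙 (W ⊆? ⊤) ℤ.* f (∣ W ∣) (∣ ⊤ ─ W ∣) ≡ ∑splits n f
∑-⊆⊤ n f = trans (∑-⊆ (⊤ {n}) f) (cong (λ k → ∑splits k f) (∣⊤∣≡n n))

-- Brings a sum over all subsets into the shape of `∑-closed-local` with `S = ⊤`.
insert-⊆⊤ : ∀ {n} (W : Subset n) (a b c : ℤ) → a ℤ.* (b ℤ.* c) ≡ 𝟙 (W ⊆? ⊤) ℤ.* (b ℤ.* (a ℤ.* c))
insert-⊆⊤ W a b c = trans (ring a b c) (cong (ℤ._* (b ℤ.* (a ℤ.* c))) (sym (𝟙-yes (W ⊆? ⊤) ⊆⊤)))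
  where
  ring : ∀ a b c → a ℤ.* (b ℤ.* c) ≡ 1ℤ ℤ.* (b ℤ.* (a ℤ.* c))
  ring = ℤSolver.solve-∀

module _ (D : ℕ) {n : ℕ} (s : ℕ) where

  ∑-closedParts : ∀ (W : Subset n) → ∑[ g ∈ gems D W ] closedParts s g W ≡ gemPairs D (∣ W ∣)
  ∑-closedParts W = trans (∑-closed-local W (λ _ _ → 1ℤ) (λ _ _ → refl))
    (trans (∑-ext (subsets n) (λ U → cong (λ z → 𝟙 (U ⊆? W) ℤ.* (z ℤ.* + gemCount D (∣ W ─ U ∣)))
             (∑-gems-1 D U)))
           (∑-⊆ W (λ i j → + gemCount D i ℤ.* + gemCount D j)))

  closedParts-glue : ∀ {W V : Subset n} → W ⊆ V → (g h : Matchings D n) →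
                     closedParts s (glue V g h) W ≡ closedParts s g W
  closedParts-glue {W} W⊆V g h = ∑-ext (subsets n) (λ U → 𝟙-*-cong (U ⊆? W) (λ U⊆W →
    cong (ℤ._* 1ℤ) (𝟙-closed-glue (λ i∈ → W⊆V (U⊆W i∈)) g h)))

  ∑-closedPairs : ∀ (V : Subset n) →
    ∑[ g ∈ gems D V ] ∑[ W ∈ subsets n ] 𝟙 (W ⊆? V) ℤ.* closedPairs s g W ≡ gemTriples D (∣ V ∣)
  ∑-closedPairs V = trans
    (∑-closed-local V (λ W g → closedParts s g W) (λ W {g} {h} _ → closedParts-glue (λ i∈ → i∈) g h))
    (trans (∑-ext (subsets n) (λ W → cong (λ z → 𝟙 (W ⊆? V) ℤ.* (z ℤ.* + gemCount D (∣ V ─ W ∣)))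
             (∑-closedParts W)))
           (∑-⊆ V (λ i j → gemPairs D i ℤ.* + gemCount D j)))

  -- The cutting is iterated from the outside in: `V` from its complement, then `W` from the rest of
  -- `V`, then `U` from the rest of `W`.
  ∑-flags : ∑[ g ∈ gems D (⊤ {n}) ] flags s g ≡
    ∑splits n (λ i j → 𝟙 ((s ℕ.<? i) ×-dec (s ℕ.<? j)) ℤ.* gemTriples D i ℤ.* + gemCount D j)
  ∑-flags = trans
    (∑-ext (gems D (⊤ {n})) (λ g → ∑-ext (subsets n) (λ V →
      insert-⊆⊤ V (𝟙 (balanced? {D} s V)) (𝟙 (closed? g V)) (pairs-in V g))))
    (trans (∑-closed-local (⊤ {n}) (λ V g → 𝟙 (balanced? {D} s V) ℤ.* pairs-in V g)
             (λ V {g} {h} _ → cong (𝟙 (balanced? {D} s V) ℤ.*_) (pairs-in-glue V g h)))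
    (trans (∑-ext (subsets n) (λ V → cong (λ z → 𝟙 (V ⊆? ⊤ {n}) ℤ.* (z ℤ.* + gemCount D (∣ ⊤ {n} ─ V ∣)))
             (trans (∑-*ˡ (𝟙 (balanced? {D} s V)) (gems D V) (pairs-in V))
                    (cong (𝟙 (balanced? {D} s V) ℤ.*_) (∑-closedPairs V)))))
           (∑-⊆⊤ n (λ i j → 𝟙 ((s ℕ.<? i) ×-dec (s ℕ.<? j)) ℤ.* gemTriples D i ℤ.* + gemCount D j))))
    where
    pairs-in : Subset n → Matchings D n → ℤ
    pairs-in V g = ∑[ W ∈ subsets n ] 𝟙 (W ⊆? V) ℤ.* closedPairs s g W

    pairs-in-glue : ∀ V g h → pairs-in V (glue V g h) ≡ pairs-in V g
    pairs-in-glue V g h = ∑-ext (subsets n) (λ W → 𝟙-*-cong (W ⊆? V) (λ W⊆V →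
      cong₂ ℤ._*_ (𝟙-closed-glue W⊆V g h) (closedParts-glue W⊆V g h)))

  module _ (h : ℕ → ℤ) where

    private
      signed : Subset n → Subset n → Matchings D n → ℤ
      signed W U g = h (π₀ U g) ℤ.* sgn (π₀ (W ─ U) g)

      signedParts : Subset n → Matchings D n → ℤ
      signedParts W g = ∑[ U ∈ subsets n ] 𝟙 (U ⊆? W) ℤ.* (𝟙 (closed? g U) ℤ.* signed W U g)

    ∑-signedParts : ∀ W → ∑ (gems D W) (signedParts W) ≡ signedPairs D h (∣ W ∣)
    ∑-signedParts W = trans (∑-closed W (signed W))
      (trans (∑-ext (subsets n) (λ U → cong (𝟙 (U ⊆? W) ℤ.*_) (trans (factor U)
               (cong₂ ℤ._*_ (∑π₀-relabel D U h) (∑π₀-relabel D (W ─ U) sgn)))))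
             (∑-⊆ W (λ i j → ∑π₀ D (⊤ {i}) h ℤ.* ∑π₀ D (⊤ {j}) sgn)))
      where
      factor : ∀ U → ∑[ g₁ ∈ gems D U ] ∑[ g₂ ∈ gems D (W ─ U) ] signed W U (glue U g₁ g₂) ≡
                     ∑π₀ D U h ℤ.* ∑π₀ D (W ─ U) sgn
      factor U = trans
        (∑-cong (gems D U) (λ g₁ g₁∈ → trans
          (∑-cong (gems D (W ─ U)) (λ g₂ g₂∈ → cong₂ (λ a b → h a ℤ.* sgn b)
            (π₀-glue {U = U} {U} (λ i∈ → i∈) g₁ g₂ (gem-closed (gems-∈⁻ g₁∈)))
            (π₀-glue-─ {W = W} {U} g₁ g₂ (gem-closed (gems-∈⁻ g₂∈)))))
          (∑-*ˡ (h (π₀ U g₁)) (gems D (W ─ U)) (λ g₂ → sgn (π₀ (W ─ U) g₂)))))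
        (∑-*ʳ (∑π₀ D (W ─ U) sgn) (gems D U) (λ g₁ → h (π₀ U g₁)))

    signedParts-glue : ∀ W {g₁ g₂} → GEM W g₁ → signedParts W (glue W g₁ g₂) ≡ signedParts W g₁
    signedParts-glue W {g₁} {g₂} gem = ∑-ext (subsets n) (λ U → 𝟙-*-cong (U ⊆? W) (λ U⊆W → trans
      (cong (ℤ._* signed W U (glue W g₁ g₂)) (𝟙-closed-glue U⊆W g₁ g₂))
      (𝟙-*-cong (closed? g₁ U) (λ clU → cong₂ (λ a b → h a ℤ.* sgn b)
        (π₀-glue U⊆W g₁ g₂ clU)
        (π₀-glue (p─q⊆p W U) g₁ g₂ (closed-─ gem (gem-closed gem) clU))))))

    ∑-weight : ∑[ g ∈ gems D (⊤ {n}) ] weight s h g ≡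
      ∑splits n (λ i j → 𝟙 (i ℕ.≤? s) ℤ.* signedPairs D h i ℤ.* + gemCount D j)
    ∑-weight = trans
      (∑-ext (gems D (⊤ {n})) (λ g → ∑-ext (subsets n) (λ W →
        insert-⊆⊤ W (𝟙 (∣ W ∣ ℕ.≤? s)) (𝟙 (closed? g W)) (signedParts W g))))
      (trans (∑-closed-local (⊤ {n}) (λ W g → 𝟙 (∣ W ∣ ℕ.≤? s) ℤ.* signedParts W g)
               (λ W {g₁} {g₂} gem → cong (𝟙 (∣ W ∣ ℕ.≤? s) ℤ.*_) (signedParts-glue W {g₁} {g₂} gem)))
      (trans (∑-ext (subsets n) (λ W → cong (λ z → 𝟙 (W ⊆? ⊤ {n}) ℤ.* (z ℤ.* + gemCount D (∣ ⊤ {n} ─ W ∣)))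
               (trans (∑-*ˡ (𝟙 (∣ W ∣ ℕ.≤? s)) (gems D W) (signedParts W))
                      (cong (𝟙 (∣ W ∣ ℕ.≤? s) ℤ.*_) (∑-signedParts W)))))
             (∑-⊆⊤ n (λ i j → 𝟙 (i ℕ.≤? s) ℤ.* signedPairs D h i ℤ.* + gemCount D j))))

-- Monotonicity and decay of the split counts

-- Indexed by the two part sizes, which keeps truncated subtraction out of the recurrences.
binom : ℕ → ℕ → ℕ
binom i j = (i + j) C i

binom-! : ∀ i j → binom i j * (i ! * j !) ≡ (i + j) !
binom-! i j = trans (cong₂ (λ b k → b * (i ! * k !)) (nCk≡n!/k![n-k]! (ℕ.m≤m+n i j)) (sym (ℕ.m+n∸m≡n i j)))
  (ℕ.m/n*n≡m {{nz}} (k![n∸k]!∣n! (ℕ.m≤m+n i j)))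
  where
  nz : NonZero (i ! * (i + j ∸ i) !)
  nz = ℕ.m*n≢0 (i !) _ {{i ℕ.!≢0}} {{(i + j ∸ i) ℕ.!≢0}}

binom-sym : ∀ i j → binom i j ≡ binom j i
binom-sym i j = trans (nCk≡nC[n∸k] (ℕ.m≤m+n i j)) (cong₂ _C_ (ℕ.+-comm i j) (ℕ.m+n∸m≡n i j))

-- Multiplied by `i ! * j !`, both sides become `(2 + i + j) !`.
binom-2-2 : ∀ i j → binom (suc (suc i)) j * (suc (suc i) * suc i) ≡ binom i (suc (suc j)) * (suc (suc j) * suc j)
binom-2-2 i j = ℕ.*-cancelʳ-≡ _ _ (i ! * j !) {{ℕ.m*n≢0 (i !) (j !) {{i ℕ.!≢0}} {{j ℕ.!≢0}}}} (begin
  binom (2 + i) j * (suc (suc i) * suc i) * (i ! * j !)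
    ≡⟨ ring₁ (binom (2 + i) j) (suc i) (suc (suc i)) (i !) (j !) ⟩
  binom (2 + i) j * ((2 + i) ! * j !)
    ≡⟨ binom-! (2 + i) j ⟩
  (2 + i + j) !
    ≡⟨ cong _! (trans (cong suc (sym (ℕ.+-suc i j))) (sym (ℕ.+-suc i (suc j)))) ⟩
  (i + (2 + j)) !
    ≡⟨ binom-! i (2 + j) ⟨
  binom i (2 + j) * (i ! * (2 + j) !)
    ≡⟨ ring₂ (binom i (2 + j)) (suc j) (suc (suc j)) (i !) (j !) ⟩
  binom i (2 + j) * (suc (suc j) * suc j) * (i ! * j !) ∎)
  where
  open ≡-Reasoning

  ring₁ : ∀ b s t x y → b * (t * s) * (x * y) ≡ b * (t * (s * x) * y)
  ring₁ = ℕSolver.solve-∀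

  ring₂ : ∀ b s t x y → b * (x * (t * (s * y))) ≡ b * (t * s) * (x * y)
  ring₂ = ℕSolver.solve-∀

2*suc : ∀ u → 2 * suc u ≡ suc (suc (2 * u))
2*suc u = ℕ.*-suc 2 u

binom-even : ∀ u w → binom (2 * suc u) (2 * w) * (suc u * suc (2 * u)) ≡
                     binom (2 * u) (2 * suc w) * (suc w * suc (2 * w))
binom-even u w = ℕ.*-cancelˡ-≡ _ _ 2 (begin
  2 * (binom (2 * suc u) (2 * w) * (suc u * suc (2 * u)))
    ≡⟨ ring (binom (2 * suc u) (2 * w)) (suc u) (suc (2 * u)) ⟩
  binom (2 * suc u) (2 * w) * (2 * suc u * suc (2 * u))
    ≡⟨ cong (λ k → binom k (2 * w) * (k * suc (2 * u))) (2*suc u) ⟩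
  binom (suc (suc (2 * u))) (2 * w) * (suc (suc (2 * u)) * suc (2 * u))
    ≡⟨ binom-2-2 (2 * u) (2 * w) ⟩
  binom (2 * u) (suc (suc (2 * w))) * (suc (suc (2 * w)) * suc (2 * w))
    ≡⟨ cong (λ k → binom (2 * u) k * (k * suc (2 * w))) (2*suc w) ⟨
  binom (2 * u) (2 * suc w) * (2 * suc w * suc (2 * w))
    ≡⟨ ring (binom (2 * u) (2 * suc w)) (suc w) (suc (2 * w)) ⟨
  2 * (binom (2 * u) (2 * suc w) * (suc w * suc (2 * w))) ∎)
  where
  open ≡-Reasoning

  ring : ∀ b s t → 2 * (b * (s * t)) ≡ b * (2 * s * t)
  ring = ℕSolver.solve-∀

matchingCount-odd : ∀ u → matchingCount (suc (2 * u)) ≡ 0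
matchingCount-odd zero    = refl
matchingCount-odd (suc u) = trans (cong (matchingCount ∘ suc) (2*suc u))
  (trans (cong (suc (suc (2 * u)) *_) (matchingCount-odd u)) (ℕ.*-zeroʳ (suc (suc (2 * u)))))

matchingCount-even : ∀ u → matchingCount (2 * u) ≡ ⟦2 u -1⟧!!
matchingCount-even zero    = refl
matchingCount-even (suc u) = trans (cong matchingCount (2*suc u))
  (cong₂ _*_ (cong (_∸ 1) (sym (2*suc u))) (matchingCount-even u))

even-or-odd : ∀ i → (∃ λ u → i ≡ 2 * u) ⊎ (∃ λ u → i ≡ suc (2 * u))
even-or-odd zero = inj₁ (0 , refl)
even-or-odd (suc i) with even-or-odd i
... | inj₁ (u , refl) = inj₂ (u , refl)
... | inj₂ (u , refl) = inj₁ (suc u , sym (2*suc u))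

module _ (D : ℕ) where

  gemCount-odd : ∀ u → gemCount D (suc (2 * u)) ≡ 0
  gemCount-odd u = cong (_^ suc D) (matchingCount-odd u)

  gemCount-even : ∀ u → gemCount D (2 * u) ≡ ⟦2 u -1⟧!! ^ suc D
  gemCount-even u = cong (_^ suc D) (matchingCount-even u)

  gemCount-nonZero : ∀ u → NonZero (gemCount D (2 * u))
  gemCount-nonZero u = subst NonZero (sym (gemCount-even u))
    (ℕ.m^n≢0 ⟦2 u -1⟧!! (suc D) {{doubleFactorial-nonZero u}})

  gemCount-suc : ∀ u → gemCount D (2 * suc u) ≡ suc (2 * u) ^ suc D * gemCount D (2 * u)
  gemCount-suc u = trans (cong (gemCount D) (2*suc u))
    (*-^ (suc D) (suc (2 * u)) (matchingCount (2 * u)))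
    where
    *-^ : ∀ k a b → (a * b) ^ k ≡ a ^ k * b ^ k
    *-^ zero    a b = refl
    *-^ (suc k) a b = trans (cong (a * b *_) (*-^ k a b)) (ℕ.[m*n]*[o*p]≡[m*o]*[n*p] a b (a ^ k) (b ^ k))

  -- The number of ways to split a set of size 2u + 2v into parts of sizes 2u and
  -- 2v with a GEM on each.
  splitCount : ℕ → ℕ → ℕ
  splitCount u v = binom (2 * u) (2 * v) * (gemCount D (2 * u) * gemCount D (2 * v))

  splitCount-sym : ∀ u v → splitCount u v ≡ splitCount v u
  splitCount-sym u v = cong₂ _*_ (binom-sym (2 * u) (2 * v)) (ℕ.*-comm (gemCount D (2 * u)) _)

  -- Passing from (u, w + 1) to (u + 1, w) multiplies the binomial coefficient by (w+1)(2w+1) /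
  -- ((u+1)(2u+1)) and the number of GEMs by ((2u+1) / (2w+1))^(D+1). One power cancels, and the
  -- quotient is cleared of denominators.
  splitCount-step : ∀ u w → splitCount (suc u) w * (suc u * suc (2 * w) ^ D) ≡
                            splitCount u (suc w) * (suc w * suc (2 * u) ^ D)
  splitCount-step u w = begin
    splitCount (suc u) w * (suc u * y ^ D)
      ≡⟨ cong (λ a → binom (2 * suc u) (2 * w) * (a * gemCount D (2 * w)) * (suc u * y ^ D)) (gemCount-suc u) ⟩
    binom (2 * suc u) (2 * w) * (x * x ^ D * a * b) * (suc u * y ^ D)
      ≡⟨ ring₁ (binom (2 * suc u) (2 * w)) x (x ^ D) (y ^ D) a b (suc u) ⟩
    binom (2 * suc u) (2 * w) * (suc u * x) * (x ^ D * y ^ D * (a * b))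
      ≡⟨ cong (_* (x ^ D * y ^ D * (a * b))) (binom-even u w) ⟩
    binom (2 * u) (2 * suc w) * (suc w * y) * (x ^ D * y ^ D * (a * b))
      ≡⟨ ring₂ (binom (2 * u) (2 * suc w)) y (x ^ D) (y ^ D) a b (suc w) ⟩
    binom (2 * u) (2 * suc w) * (a * (y * y ^ D * b)) * (suc w * x ^ D)
      ≡⟨ cong (λ b → binom (2 * u) (2 * suc w) * (a * b) * (suc w * x ^ D)) (gemCount-suc w) ⟨
    splitCount u (suc w) * (suc w * x ^ D) ∎
    where
    open ≡-Reasoning

    a b x y : ℕ
    a = gemCount D (2 * u)
    b = gemCount D (2 * w)
    x = suc (2 * u)
    y = suc (2 * w)

    ring₁ : ∀ c x p q a b s → c * (x * p * a * b) * (s * q) ≡ c * (s * x) * (p * q * (a * b))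
    ring₁ = ℕSolver.solve-∀

    ring₂ : ∀ c y p q a b s → c * (s * y) * (p * q * (a * b)) ≡ c * (a * (y * q * b)) * (s * p)
    ring₂ = ℕSolver.solve-∀

  module _ (2≤D : 2 ≤ D) where

    private
      suc-pred² : D ≡ 2 + (D ∸ 2)
      suc-pred² = sym (ℕ.m+[n∸m]≡n 2≤D)

    -- By `splitCount-step` this amounts to (w+1)(2u+1)^D ≤ (u+1)(2w+1)^D: one power is compared
    -- together with the linear factors, the others by monotonicity.
    splitCount-anti : ∀ {u w} → u ≤ w → splitCount (suc u) w ≤ splitCount u (suc w)
    splitCount-anti {u} {w} u≤w = ℕ.*-cancelʳ-≤ _ _ (suc u * suc (2 * w) ^ D) {{nz}} (begin
      splitCount (suc u) w * (suc u * suc (2 * w) ^ D)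
        ≡⟨ splitCount-step u w ⟩
      splitCount u (suc w) * (suc w * suc (2 * u) ^ D)
        ≤⟨ ℕ.*-monoʳ-≤ (splitCount u (suc w)) (subst (λ D → suc w * suc (2 * u) ^ D ≤ suc u * suc (2 * w) ^ D)
             (sym suc-pred²) (factor (suc (D ∸ 2)))) ⟩
      splitCount u (suc w) * (suc u * suc (2 * w) ^ D) ∎)
      where
      open ℕ.≤-Reasoning

      nz : NonZero (suc u * suc (2 * w) ^ D)
      nz = ℕ.m*n≢0 (suc u) _ {{_}} {{ℕ.m^n≢0 (suc (2 * w)) D}}

      -- The two sides differ by exactly `w - u`.
      linear : suc w * suc (2 * u) ≤ suc u * suc (2 * w)
      linear = subst₂ _≤_ (lhs u w) (rhs u w) (ℕ.+-monoʳ-≤ (2 * (u * w) + u + w + 1) u≤w)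
        where
        lhs : ∀ u w → 2 * (u * w) + u + w + 1 + u ≡ suc w * suc (2 * u)
        lhs = ℕSolver.solve-∀

        rhs : ∀ u w → 2 * (u * w) + u + w + 1 + w ≡ suc u * suc (2 * w)
        rhs = ℕSolver.solve-∀

      factor : ∀ E → suc w * suc (2 * u) ^ suc E ≤ suc u * suc (2 * w) ^ suc E
      factor E = subst₂ _≤_ (ℕ.*-assoc (suc w) (suc (2 * u)) _) (ℕ.*-assoc (suc u) (suc (2 * w)) _)
        (ℕ.*-mono-≤ linear (ℕ.^-monoˡ-≤ E (s≤s (ℕ.*-monoʳ-≤ 2 u≤w))))

    splitCount-left : ∀ s d {v} → s + d ≤ suc v → splitCount (s + d) v ≤ splitCount s (d + v)
    splitCount-left s zero    {v} _  = ℕ.≤-reflexive (cong (λ k → splitCount k v) (ℕ.+-identityʳ s))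
    splitCount-left s (suc d) {v} le = begin
      splitCount (s + suc d) v   ≡⟨ cong (λ k → splitCount k v) (ℕ.+-suc s d) ⟩
      splitCount (suc (s + d)) v ≤⟨ splitCount-anti s+d≤v ⟩
      splitCount (s + d) (suc v) ≤⟨ splitCount-left s d (ℕ.m≤n⇒m≤1+n (ℕ.m≤n⇒m≤1+n s+d≤v)) ⟩
      splitCount s (d + suc v)   ≡⟨ cong (splitCount s) (ℕ.+-suc d v) ⟩
      splitCount s (suc d + v)   ∎
      where
      open ℕ.≤-Reasoning

      s+d≤v : s + d ≤ v
      s+d≤v = ℕ.≤-pred (subst (_≤ suc v) (ℕ.+-suc s d) le)

    -- By symmetry the smaller part may stand on the left. Labels are moved away from it two at a
    -- time until `2 * s` remain, and by `splitCount-anti` no move lowers the count.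
    splitCount-max : ∀ {s u v} → s ≤ u → s ≤ v → splitCount u v ≤ splitCount s (u + v ∸ s)
    splitCount-max {s} {u} {v} s≤u s≤v with ℕ.m≤n⇒∃[o]m+o≡n s≤u | ℕ.m≤n⇒∃[o]m+o≡n s≤v
    ... | p , refl | q , refl with ℕ.≤-total p q
    ...   | inj₁ p≤q = ℕ.≤-trans
            (splitCount-left s p (ℕ.m≤n⇒m≤1+n (ℕ.+-monoʳ-≤ s p≤q)))
            (ℕ.≤-reflexive (cong (splitCount s) (sym (trans
              (cong (_∸ s) (ℕ.+-assoc s p (s + q))) (ℕ.m+n∸m≡n s (p + (s + q)))))))
    ...   | inj₂ q≤p = ℕ.≤-trans (ℕ.≤-reflexive (splitCount-sym (s + p) (s + q))) (ℕ.≤-trans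
            (splitCount-left s q (ℕ.m≤n⇒m≤1+n (ℕ.+-monoʳ-≤ s q≤p)))
            (ℕ.≤-reflexive (cong (splitCount s) (sym (trans (cong (_∸ s)
              (trans (ℕ.+-comm (s + p) (s + q)) (ℕ.+-assoc s q (s + p)))) (ℕ.m+n∸m≡n s (q + (s + p))))))))

    -- The place where `2 ≤ D` gains a full factor `n = s + suc w`: by `splitCount-step` it is
    -- enough that n(w+1) ≤ (s+1)(2w+1)^D, which follows from n ≤ (s+1)(w+1) and (w+1)^2 ≤ (2w+1)^D.
    splitCount-decay : ∀ s w → (s + suc w) * splitCount (suc s) w ≤ suc (2 * s) ^ D * splitCount s (suc w)
    splitCount-decay s w = ℕ.*-cancelʳ-≤ _ _ (suc s * suc (2 * w) ^ D) {{nz}} (begin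
      n * splitCount (suc s) w * (suc s * suc (2 * w) ^ D)
        ≡⟨ ℕ.*-assoc n (splitCount (suc s) w) _ ⟩
      n * (splitCount (suc s) w * (suc s * suc (2 * w) ^ D))
        ≡⟨ cong (n *_) (splitCount-step s w) ⟩
      n * (splitCount s (suc w) * (suc w * suc (2 * s) ^ D))
        ≡⟨ ring n (splitCount s (suc w)) (suc w) (suc (2 * s) ^ D) ⟩
      suc (2 * s) ^ D * splitCount s (suc w) * (n * suc w)
        ≤⟨ ℕ.*-monoʳ-≤ (suc (2 * s) ^ D * splitCount s (suc w)) bound ⟩
      suc (2 * s) ^ D * splitCount s (suc w) * (suc s * suc (2 * w) ^ D) ∎)
      where
      open ℕ.≤-Reasoning

      n : ℕ
      n = s + suc w

      nz : NonZero (suc s * suc (2 * w) ^ D)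
      nz = ℕ.m*n≢0 (suc s) _ {{_}} {{ℕ.m^n≢0 (suc (2 * w)) D}}

      ring : ∀ n t v c → n * (t * (v * c)) ≡ c * t * (n * v)
      ring = ℕSolver.solve-∀

      w≤2w : suc w ≤ suc (2 * w)
      w≤2w = s≤s (ℕ.m≤m+n w (w + 0))

      bound : n * suc w ≤ suc s * suc (2 * w) ^ D
      bound = begin
        (s + suc w) * suc w
          ≤⟨ ℕ.*-monoˡ-≤ (suc w) (subst (s + suc w ≤_) (ℕ.+-comm (s * suc w) (suc w))
               (ℕ.+-monoˡ-≤ (suc w) (ℕ.m≤m*n s (suc w)))) ⟩
        suc s * suc w * suc w
          ≡⟨ ℕ.*-assoc (suc s) (suc w) (suc w) ⟩
        suc s * (suc w * suc w)
          ≤⟨ ℕ.*-monoʳ-≤ (suc s) (ℕ.*-mono-≤ w≤2w (subst (suc w ≤_) (sym (ℕ.*-identityʳ _)) w≤2w)) ⟩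
        suc s * suc (2 * w) ^ 2
          ≤⟨ ℕ.*-monoʳ-≤ (suc s) (ℕ.^-monoʳ-≤ (suc (2 * w)) 2≤D) ⟩
        suc s * suc (2 * w) ^ D ∎

-- The coefficients 𝔡

sgn-parity : ∀ k → 𝟙 (2 ∣? k) ℤ.- 𝟙 (¬? (2 ∣? k)) ≡ sgn k
sgn-parity k with even-or-odd k
... | inj₁ (u , refl) = trans (cong₂ ℤ._-_ (𝟙-yes (2 ∣? 2 * u) 2∣2u) (𝟙-no (¬? (2 ∣? 2 * u)) (λ ¬2∣ → ¬2∣ 2∣2u)))
                              (sym (sgn-even u))
  where
  2∣2u : 2 ℕ.∣ 2 * u
  2∣2u = ℕ.divides u (ℕ.*-comm 2 u)

  sgn-even : ∀ u → sgn (2 * u) ≡ 1ℤ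
  sgn-even zero    = refl
  sgn-even (suc u) = trans (cong sgn (2*suc u)) (trans (ℤ.neg-involutive _) (sgn-even u))
... | inj₂ (u , refl) = trans (cong₂ ℤ._-_ (𝟙-no (2 ∣? suc (2 * u)) 2∤) (𝟙-yes (¬? (2 ∣? suc (2 * u))) 2∤))
                              (sym (sgn-odd u))
  where
  2∤ : ¬ (2 ℕ.∣ suc (2 * u))
  2∤ (ℕ.divides q eq) = ℕ.even≢odd q u (trans (ℕ.*-comm 2 q) (sym eq))

  sgn-odd : ∀ u → sgn (suc (2 * u)) ≡ ℤ.- 1ℤ
  sgn-odd zero    = refl
  sgn-odd (suc u) = trans (cong (sgn ∘ suc) (2*suc u)) (trans (ℤ.neg-involutive _) (sgn-odd u))

∁≡⊤─ : ∀ {n} (U : Subset n) → ∁ U ≡ ⊤ ─ U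
∁≡⊤─ []            = refl
∁≡⊤─ (inside  ∷ U) = cong (outside ∷_) (∁≡⊤─ U)
∁≡⊤─ (outside ∷ U) = cong (inside ∷_) (∁≡⊤─ U)

module _ (D k : ℕ) where

  -- Each `U` has exactly one size, and it is at most `k`, so the grouping by `i` counts every
  -- decomposition once.
  ∑-pairs : ∀ (F : Pair D k → ℤ) → ∑ (concatMap (pairs D k) (upTo (suc k))) F ≡
    ∑[ U ∈ subsets k ] ∑[ g ∈ gems D U ] ∑[ h ∈ gems D (∁ U) ] F (U , g , h)
  ∑-pairs F = begin
    ∑ (concatMap (pairs D k) (upTo (suc k))) F
      ≡⟨ ∑-concatMap (pairs D k) (upTo (suc k)) F ⟩
    ∑[ i ∈ upTo (suc k) ] ∑ (pairs D k i) F
      ≡⟨ ∑-ext (upTo (suc k)) (λ i → trans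
           (∑-concatMap block (filter (λ U → ∣ U ∣ ℕ.≟ i) (subsets k)) F)
           (∑-filter (λ U → ∣ U ∣ ℕ.≟ i) (subsets k) (λ U → ∑ (block U) F))) ⟩
    ∑[ i ∈ upTo (suc k) ] ∑[ U ∈ subsets k ] 𝟙 (∣ U ∣ ℕ.≟ i) ℤ.* ∑ (block U) F
      ≡⟨ ∑-swap (upTo (suc k)) (subsets k) _ ⟩
    ∑[ U ∈ subsets k ] ∑[ i ∈ upTo (suc k) ] 𝟙 (∣ U ∣ ℕ.≟ i) ℤ.* ∑ (block U) F
      ≡⟨ ∑-ext (subsets k) (λ U → trans
           (∑-ext (upTo (suc k)) (λ i → cong (ℤ._* ∑ (block U) F) (𝟙-cong (∣ U ∣ ℕ.≟ i) (i ℕ.≟ ∣ U ∣) sym sym)))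
           (∑-𝟙-∈ ℕ._≟_ (λ _ → ∑ (block U) F) (Unique.upTo⁺ (suc k)) (List.∈-upTo⁺ (s≤s (∣p∣≤n U))))) ⟩
    ∑[ U ∈ subsets k ] ∑ (block U) F
      ≡⟨ ∑-ext (subsets k) (λ U → trans (∑-map (U ,_) (cartesianProduct (gems D U) (gems D (∁ U))) F)
           (∑-cartesianProductWith _,_ (gems D U) (gems D (∁ U)) (λ p → F (U , p)))) ⟩
    ∑[ U ∈ subsets k ] ∑[ g ∈ gems D U ] ∑[ h ∈ gems D (∁ U) ] F (U , g , h) ∎
    where
    open ≡-Reasoning

    block : Subset k → List (Pair D k)
    block U = List.map (U ,_) (cartesianProduct (gems D U) (gems D (∁ U)))

  𝔡≡signedPairs : ∀ m → 𝔡 D k (suc m) ≡ signedPairs D (λ p → 𝟙 (p ℕ.≟ m)) k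
  𝔡≡signedPairs m = begin
    𝔡 D k (suc m)
      ≡⟨ cong₂ ℤ._-_ (length-filter even? xs) (length-filter odd? xs) ⟩
    ∑ xs (λ x → 𝟙 (even? x)) ℤ.- ∑ xs (λ x → 𝟙 (odd? x))
      ≡⟨ ∑-- xs (λ x → 𝟙 (even? x)) (λ x → 𝟙 (odd? x)) ⟨
    ∑[ x ∈ xs ] (𝟙 (even? x) ℤ.- 𝟙 (odd? x))
      ≡⟨ ∑-ext xs (λ x → trans
           (cong₂ ℤ._-_ (𝟙-× (π₀′ x ℕ.≟ m) (2 ∣? π₀″ x)) (𝟙-× (π₀′ x ℕ.≟ m) (¬? (2 ∣? π₀″ x))))
           (trans (factor (h (π₀′ x)) (𝟙 (2 ∣? π₀″ x)) (𝟙 (¬? (2 ∣? π₀″ x))))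
                  (cong (h (π₀′ x) ℤ.*_) (sgn-parity (π₀″ x))))) ⟩
    ∑[ x ∈ xs ] h (π₀′ x) ℤ.* sgn (π₀″ x)
      ≡⟨ ∑-pairs (λ x → h (π₀′ x) ℤ.* sgn (π₀″ x)) ⟩
    ∑[ U ∈ subsets k ] ∑[ g ∈ gems D U ] ∑[ g′ ∈ gems D (∁ U) ] h (π₀ U g) ℤ.* sgn (π₀ (∁ U) g′)
      ≡⟨ ∑-ext (subsets k) (λ U → trans
           (∑-ext (gems D U) (λ g → ∑-*ˡ (h (π₀ U g)) (gems D (∁ U)) (λ g′ → sgn (π₀ (∁ U) g′))))
           (∑-*ʳ (∑π₀ D (∁ U) sgn) (gems D U) (λ g → h (π₀ U g)))) ⟩
    ∑[ U ∈ subsets k ] ∑π₀ D U h ℤ.* ∑π₀ D (∁ U) sgn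
      ≡⟨ ∑-ext (subsets k) (λ U → trans
           (cong₂ ℤ._*_ (∑π₀-relabel D U h)
             (trans (cong (λ V → ∑π₀ D V sgn) (∁≡⊤─ U)) (∑π₀-relabel D (⊤ ─ U) sgn)))
           (sym (trans (cong (ℤ._* f (∣ U ∣) (∣ ⊤ {k} ─ U ∣)) (𝟙-yes (U ⊆? ⊤) ⊆⊤)) (ℤ.*-identityˡ _)))) ⟩
    ∑[ U ∈ subsets k ] 𝟙 (U ⊆? ⊤) ℤ.* f (∣ U ∣) (∣ ⊤ ─ U ∣)
      ≡⟨ ∑-⊆⊤ k f ⟩
    signedPairs D h k ∎
    where
    open ≡-Reasoning

    h : ℕ → ℤ
    h p = 𝟙 (p ℕ.≟ m)

    f : ℕ → ℕ → ℤ
    f i j = ∑π₀ D (⊤ {i}) h ℤ.* ∑π₀ D (⊤ {j}) sgn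

    xs : List (Pair D k)
    xs = concatMap (pairs D k) (upTo (suc k))

    even? : ∀ x → Dec (π₀′ x ≡ m × 2 ℕ.∣ π₀″ x)
    even? x = (π₀′ x ℕ.≟ m) ×-dec (2 ∣? π₀″ x)

    odd? : ∀ x → Dec (π₀′ x ≡ m × ¬ (2 ℕ.∣ π₀″ x))
    odd? x = (π₀′ x ℕ.≟ m) ×-dec ¬? (2 ∣? π₀″ x)

    factor : ∀ a b c → a ℤ.* b ℤ.- a ℤ.* c ≡ a ℤ.* (b ℤ.- c)
    factor = ℤSolver.solve-∀

-- Bounds for sums over splits

∑splits-mono : ∀ k {f g : ℕ → ℕ → ℤ} → (∀ i j → i + j ≡ k → f i j ℤ.≤ g i j) → ∑splits k f ℤ.≤ ∑splits k g
∑splits-mono zero    e = e 0 0 refl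
∑splits-mono (suc k) e = ℤ.+-mono-≤
  (∑splits-mono k (λ i j p → e (suc i) j (cong suc p)))
  (∑splits-mono k (λ i j p → e i (suc j) (trans (ℕ.+-suc i j) (cong suc p))))

∑splits-*ˡ : ∀ c k f → ∑splits k (λ i j → c ℤ.* f i j) ≡ c ℤ.* ∑splits k f
∑splits-*ˡ c zero    f = refl
∑splits-*ˡ c (suc k) f = trans
  (cong₂ ℤ._+_ (∑splits-*ˡ c k (λ i j → f (suc i) j)) (∑splits-*ˡ c k (λ i j → f i (suc j))))
  (sym (ℤ.*-distribˡ-+ c _ _))

∑splits-zero : ∀ k → ∑splits k (λ _ _ → 0ℤ) ≡ 0ℤ
∑splits-zero zero    = refl
∑splits-zero (suc k) = cong₂ ℤ._+_ (∑splits-zero k) (∑splits-zero k)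

sumTo-𝟙-> : ∀ k {a} c → k < a → sumTo k (λ t → 𝟙 (t ℕ.≟ a) ℤ.* c) ≡ 0ℤ
sumTo-𝟙-> k {a} c k<a = trans
  (sumTo-cong k (λ t t≤k → cong (ℤ._* c) (𝟙-no (t ℕ.≟ a) (λ { refl → ℕ.<⇒≱ k<a t≤k }))))
  (trans (sumTo-const k 0ℤ) (ℤ.*-zeroʳ (+ suc k)))

sumTo-𝟙≤ : ∀ k a {c} → 0ℤ ℤ.≤ c → sumTo k (λ t → 𝟙 (t ℕ.≟ a) ℤ.* c) ℤ.≤ c
sumTo-𝟙≤ zero    a {c} c≥0 with 0 ℕ.≟ a
... | yes p = ℤ.≤-reflexive (trans (cong (ℤ._* c) (𝟙-yes (0 ℕ.≟ a) p)) (ℤ.*-identityˡ c))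
... | no ¬p = subst (ℤ._≤ c) (sym (cong (ℤ._* c) (𝟙-no (0 ℕ.≟ a) ¬p))) c≥0
sumTo-𝟙≤ (suc k) a {c} c≥0 with suc k ℕ.≟ a
... | yes p = ℤ.≤-reflexive (trans
        (cong₂ ℤ._+_ (sumTo-𝟙-> k c (ℕ.≤-reflexive p)) (cong (ℤ._* c) (𝟙-yes (suc k ℕ.≟ a) p)))
        (trans (ℤ.+-identityˡ _) (ℤ.*-identityˡ c)))
... | no ¬p = subst (ℤ._≤ c) (sym (trans
        (cong (ℤ._+_ (sumTo k (λ t → 𝟙 (t ℕ.≟ a) ℤ.* c))) (cong (ℤ._* c) (𝟙-no (suc k ℕ.≟ a) ¬p)))
        (ℤ.+-identityʳ _))) (sumTo-𝟙≤ k a c≥0)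

module _ (D : ℕ) where

  gemPairs-odd : ∀ q → gemPairs D (suc (2 * q)) ≡ 0ℤ
  gemPairs-odd q = trans (∑splits-cong (suc (2 * q)) vanish) (∑splits-zero (suc (2 * q)))
    where
    vanish : ∀ i j → i + j ≡ suc (2 * q) → + gemCount D i ℤ.* + gemCount D j ≡ 0ℤ
    vanish i j i+j≡ with even-or-odd i | even-or-odd j
    ... | inj₂ (u , refl) | _ = cong (λ k → + k ℤ.* + gemCount D j) (gemCount-odd D u)
    ... | inj₁ _ | inj₂ (v , refl) = trans (cong (λ k → + gemCount D i ℤ.* + k) (gemCount-odd D v)) (ℤ.*-zeroʳ (+ gemCount D i))
    ... | inj₁ (u , refl) | inj₁ (v , refl) =
      contradiction (trans (ℕ.*-distribˡ-+ 2 u v) i+j≡) (ℕ.even≢odd (u + v) q)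

  -- The summand 2 pays for the two extreme splits, of half-sizes `s` and `n ∸ s`; the summand
  -- `2 * suc (2 * s) ^ D` pays for all splits between them together, through `next`.
  tailConstant : ℕ → ℕ
  tailConstant s = 2 + 2 * suc (2 * s) ^ D

  module _ (2≤D : 2 ≤ D) where

    -- splitCount (s + 1) (n - s - 1), and 0 for n ≤ s where this is undefined.
    next : ∀ s n → ∃ λ E → (∀ u v → u + v ≡ n → s < u → s < v → splitCount D u v ≤ E) ×
                           suc n * E ≤ 2 * suc (2 * s) ^ D * splitCount D s (n ∸ s)
    next s n with suc s ℕ.≤? n
    ... | no s≮n = 0 , (λ { u v refl s<u _ → contradiction (ℕ.≤-trans s<u (ℕ.m≤m+n u v)) s≮n })
                 , subst (_≤ 2 * suc (2 * s) ^ D * splitCount D s (n ∸ s)) (sym (ℕ.*-zeroʳ (suc n))) z≤n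
    ... | yes s<n with ℕ.m≤n⇒∃[o]m+o≡n s<n
    ...   | w , refl = splitCount D (suc s) w
        , (λ u v u+v≡n s<u s<v → subst (λ x → splitCount D u v ≤ splitCount D (suc s) x)
            (trans (cong (_∸ suc s) u+v≡n) (ℕ.m+n∸m≡n (suc s) w)) (splitCount-max D 2≤D s<u s<v))
        , (begin
          -- The factor `suc n` is the number of terms of the later sum. As `n = s + suc w` is
          -- positive, `suc n ≤ 2 * n`, which is the source of the 2.
          suc n * splitCount D (suc s) w
            ≤⟨ ℕ.*-monoˡ-≤ (splitCount D (suc s) w) (ℕ.≤-trans (s≤s (ℕ.m≤m+n n (s + w))) (ℕ.≤-reflexive (double s w))) ⟩
          2 * (s + suc w) * splitCount D (suc s) w
            ≡⟨ ℕ.*-assoc 2 (s + suc w) (splitCount D (suc s) w) ⟩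
          2 * ((s + suc w) * splitCount D (suc s) w)
            ≤⟨ ℕ.*-monoʳ-≤ 2 (splitCount-decay D 2≤D s w) ⟩
          2 * (suc (2 * s) ^ D * splitCount D s (suc w))
            ≡⟨ ℕ.*-assoc 2 (suc (2 * s) ^ D) (splitCount D s (suc w)) ⟨
          2 * suc (2 * s) ^ D * splitCount D s (suc w)
            ≡⟨ cong (λ x → 2 * suc (2 * s) ^ D * splitCount D s x) (trans (cong (_∸ s) (sym (ℕ.+-suc s w))) (ℕ.m+n∸m≡n s (suc w))) ⟨
          2 * suc (2 * s) ^ D * splitCount D s (n ∸ s) ∎)
      where
      open ℕ.≤-Reasoning

      double : ∀ s w → suc (suc (s + w) + (s + w)) ≡ 2 * (s + suc w)
      double = ℕSolver.solve-∀

-- The integer form of the expansion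

-- The two parts of a set of even size have the same parity, so the hypothesis removes every odd
-- term.
∑splits-even : ∀ n f → (∀ u v → f (suc (2 * u)) (suc (2 * v)) ≡ 0ℤ) →
  ∑splits (2 * n) f ≡ sumTo n (λ u → + ((2 * n) C (2 * u)) ℤ.* f (2 * u) (2 * (n ∸ u)))
∑splits-even n f odd = trans (∑splits≡sumTo (2 * n) f) (trans
  (sumTo-even n (λ t → + ((2 * n) C t) ℤ.* f t (2 * n ∸ t)) vanish)
  (sumTo-cong n (λ u _ → cong (λ j → + ((2 * n) C (2 * u)) ℤ.* f (2 * u) j) (sym (ℕ.*-distribˡ-∸ 2 n u)))))
  where
  vanish : ∀ u → + ((2 * n) C suc (2 * u)) ℤ.* f (suc (2 * u)) (2 * n ∸ suc (2 * u)) ≡ 0ℤ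
  vanish u with suc u ℕ.≤? n
  ... | no u≮n = cong (λ b → + b ℤ.* f (suc (2 * u)) (2 * n ∸ suc (2 * u)))
          (k>n⇒nCk≡0 (s≤s (ℕ.*-monoʳ-≤ 2 (ℕ.≮⇒≥ u≮n))))
  ... | yes u<n with ℕ.m≤n⇒∃[o]m+o≡n u<n
  ...   | o , refl = trans (cong (ℤ._*_ (+ ((2 * n) C suc (2 * u)))) (trans
            (cong (f (suc (2 * u))) (trans (cong (_∸ suc (2 * u)) (rearrange u o)) (ℕ.m+n∸m≡n (suc (2 * u)) (suc (2 * o)))))
            (odd u o))) (ℤ.*-zeroʳ (+ ((2 * n) C suc (2 * u))))
    where
    rearrange : ∀ u o → 2 * (suc u + o) ≡ suc (2 * u) + suc (2 * o)
    rearrange = ℕSolver.solve-∀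

binom-∸ : ∀ {u n} → u ≤ n → binom (2 * u) (2 * (n ∸ u)) ≡ (2 * n) C (2 * u)
binom-∸ {u} {n} u≤n = cong (_C (2 * u))
  (trans (sym (ℕ.*-distribˡ-+ 2 u (n ∸ u))) (cong (2 *_) (ℕ.m+[n∸m]≡n u≤n)))

module _ (D : ℕ) where

  private
    G : ℕ → ℤ
    G i = + gemCount D i

    T : ℕ → ℕ → ℕ
    T = splitCount D

  -- (2n - 1)!!^(D + 1) times the k-th gauge function.
  gaugeNum : ℕ → ℕ → ℕ
  gaugeNum k n = ((2 * n) C (2 * k)) * gemCount D (2 * (n ∸ k))

  -- For fixed `k` the split count and the gauge differ by a factor independent of `n`, so estimates
  -- for one carry over to the other.
  splitCount≡gaugeNum : ∀ {k n} → k ≤ n → T k (n ∸ k) ≡ gaugeNum k n * gemCount D (2 * k)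
  splitCount≡gaugeNum {k} {n} k≤n = trans
    (cong (_* (gemCount D (2 * k) * gemCount D (2 * (n ∸ k)))) (binom-∸ k≤n))
    (ring ((2 * n) C (2 * k)) (gemCount D (2 * k)) (gemCount D (2 * (n ∸ k))))
    where
    ring : ∀ a b c → a * (b * c) ≡ a * c * b
    ring = ℕSolver.solve-∀

  splitCount-zero : ∀ n → T 0 n ≡ gemCount D (2 * n)
  splitCount-zero n = trans
    (cong₂ (λ b g → b * (g * gemCount D (2 * n))) binom-zero (ℕ.^-zeroˡ (suc D)))
    (trans (ℕ.*-identityˡ _) (ℕ.*-identityˡ _))
    where
    binom-zero : binom 0 (2 * n) ≡ 1
    binom-zero = trans (binom-sym 0 (2 * n))
      (trans (cong (_C (2 * n)) (ℕ.+-identityʳ (2 * n))) (nCn≡1 (2 * n)))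

  module _ (2≤D : 2 ≤ D) where

    module _ {P : ℕ → ℕ → Set} (P? : ∀ i j → Dec (P i j)) (s n : ℕ)
             (low : ∀ u v → P (2 * u) (2 * v) → s ≤ u × s ≤ v) where

      private
        E : ℕ
        E = proj₁ (next D 2≤D s n)

        t : ℤ
        t = + T s (n ∸ s)

        term≤ : ∀ u → u ≤ n → 𝟙 (P? (2 * u) (2 * (n ∸ u))) ℤ.* + T u (n ∸ u) ℤ.≤
                (𝟙 (u ℕ.≟ s) ℤ.* t ℤ.+ 𝟙 (u ℕ.≟ n ∸ s) ℤ.* t) ℤ.+ + E
        term≤ u u≤n with P? (2 * u) (2 * (n ∸ u))
        ... | no _ = ℤ.+-mono-≤ {0ℤ} {_} {0ℤ} (ℤ.+-mono-≤ {0ℤ} {_} {0ℤ} (𝟙-*≥0 (u ℕ.≟ s) (ℤ.+≤+ z≤n))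
                (𝟙-*≥0 (u ℕ.≟ n ∸ s) (ℤ.+≤+ z≤n))) (ℤ.+≤+ z≤n)
        ... | yes p = subst (ℤ._≤ (𝟙 (u ℕ.≟ s) ℤ.* t ℤ.+ 𝟙 (u ℕ.≟ n ∸ s) ℤ.* t) ℤ.+ + E) (sym (ℤ.*-identityˡ _))
                        (cases (u ℕ.≟ s) (u ℕ.≟ n ∸ s))
          where
          s≤u : s ≤ u
          s≤u = proj₁ (low u (n ∸ u) p)

          s≤n∸u : s ≤ n ∸ u
          s≤n∸u = proj₂ (low u (n ∸ u) p)

          cases : (d : Dec (u ≡ s)) (e : Dec (u ≡ n ∸ s)) →
                  + T u (n ∸ u) ℤ.≤ (𝟙 d ℤ.* t ℤ.+ 𝟙 e ℤ.* t) ℤ.+ + E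
          cases (yes refl) e = begin
            + T s (n ∸ s)                     ≡⟨ ℤ.*-identityˡ t ⟨
            1ℤ ℤ.* t                          ≤⟨ ℤ.i≤i+j _ _ {{ℤ.nonNegative (𝟙-*≥0 e (ℤ.+≤+ z≤n))}} ⟩
            1ℤ ℤ.* t ℤ.+ 𝟙 e ℤ.* t            ≤⟨ ℤ.i≤i+j _ (+ E) ⟩
            (1ℤ ℤ.* t ℤ.+ 𝟙 e ℤ.* t) ℤ.+ + E  ∎
            where open ℤ.≤-Reasoning
          cases (no _) (yes refl) = begin
            + T (n ∸ s) (n ∸ (n ∸ s))
              ≡⟨ cong +_ (trans (cong (T (n ∸ s)) (ℕ.m∸[m∸n]≡n (ℕ.≤-trans s≤u u≤n))) (splitCount-sym D (n ∸ s) s)) ⟩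
            t                       ≡⟨ ℤ.*-identityˡ t ⟨
            1ℤ ℤ.* t                ≡⟨ ℤ.+-identityˡ (1ℤ ℤ.* t) ⟨
            0ℤ ℤ.+ 1ℤ ℤ.* t         ≤⟨ ℤ.i≤i+j _ (+ E) ⟩
            (0ℤ ℤ.+ 1ℤ ℤ.* t) ℤ.+ + E ∎
            where open ℤ.≤-Reasoning
          cases (no u≢s) (no u≢n∸s) = ℤ.+≤+ (proj₁ (proj₂ (next D 2≤D s n)) u (n ∸ u) (ℕ.m+[n∸m]≡n u≤n)
            (ℕ.≤∧≢⇒< s≤u (u≢s ∘ sym))
            (ℕ.≤∧≢⇒< s≤n∸u (λ s≡ → u≢n∸s (trans (sym (ℕ.m∸[m∸n]≡n u≤n)) (cong (n ∸_) (sym s≡))))))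

      -- Only half-sizes `u` with s ≤ u ≤ n - s survive. The two ends give `T s (n ∸ s)` each, and
      -- every other term is at most `E`, which is granted to all `suc n` indices. The predicate `P`
      -- is left abstract because the bound is needed both for all splits, with `s = 0`, and for
      -- those with two large parts.
      ∑splits-balanced : ∑splits (2 * n) (λ i j → 𝟙 (P? i j) ℤ.* (G i ℤ.* G j)) ℤ.≤
                         + (tailConstant D s * T s (n ∸ s))
      ∑splits-balanced = begin
        ∑splits (2 * n) (λ i j → 𝟙 (P? i j) ℤ.* (G i ℤ.* G j))
          ≡⟨ ∑splits-even n _ (λ u v → trans
               (cong (λ k → 𝟙 (P? (suc (2 * u)) (suc (2 * v))) ℤ.* (+ k ℤ.* G (suc (2 * v)))) (gemCount-odd D u))
               (ℤ.*-zeroʳ (𝟙 (P? (suc (2 * u)) (suc (2 * v)))))) ⟩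
        sumTo n (λ u → + ((2 * n) C (2 * u)) ℤ.* (𝟙 (P? (2 * u) (2 * (n ∸ u))) ℤ.* (G (2 * u) ℤ.* G (2 * (n ∸ u)))))
          ≡⟨ sumTo-cong n value ⟩
        sumTo n (λ u → 𝟙 (P? (2 * u) (2 * (n ∸ u))) ℤ.* + T u (n ∸ u))
          ≤⟨ sumTo-mono n term≤ ⟩
        sumTo n (λ u → (𝟙 (u ℕ.≟ s) ℤ.* t ℤ.+ 𝟙 (u ℕ.≟ n ∸ s) ℤ.* t) ℤ.+ + E)
          ≡⟨ trans (sumTo-+ n (λ u → 𝟙 (u ℕ.≟ s) ℤ.* t ℤ.+ 𝟙 (u ℕ.≟ n ∸ s) ℤ.* t) (λ _ → + E))
                   (cong (ℤ._+ sumTo n (λ _ → + E)) (sumTo-+ n (λ u → 𝟙 (u ℕ.≟ s) ℤ.* t) (λ u → 𝟙 (u ℕ.≟ n ∸ s) ℤ.* t))) ⟩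
        (sumTo n (λ u → 𝟙 (u ℕ.≟ s) ℤ.* t) ℤ.+ sumTo n (λ u → 𝟙 (u ℕ.≟ n ∸ s) ℤ.* t)) ℤ.+ sumTo n (λ _ → + E)
          ≤⟨ ℤ.+-mono-≤ (ℤ.+-mono-≤ (sumTo-𝟙≤ n s (ℤ.+≤+ z≤n)) (sumTo-𝟙≤ n (n ∸ s) (ℤ.+≤+ z≤n)))
               (ℤ.≤-trans (ℤ.≤-reflexive (trans (sumTo-const n (+ E)) (sym (ℤ.pos-* (suc n) E))))
                          (ℤ.+≤+ (proj₂ (proj₂ (next D 2≤D s n))))) ⟩
        + (T s (n ∸ s) + T s (n ∸ s) + 2 * suc (2 * s) ^ D * T s (n ∸ s))
          ≡⟨ cong +_ (ring (T s (n ∸ s)) (2 * suc (2 * s) ^ D)) ⟩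
        + (tailConstant D s * T s (n ∸ s)) ∎
        where
        open ℤ.≤-Reasoning

        ring : ∀ a c → a + a + c * a ≡ (2 + c) * a
        ring = ℕSolver.solve-∀

        move : ∀ b i x → b ℤ.* (i ℤ.* x) ≡ i ℤ.* (b ℤ.* x)
        move = ℤSolver.solve-∀

        value : ∀ u → u ≤ n →
          + ((2 * n) C (2 * u)) ℤ.* (𝟙 (P? (2 * u) (2 * (n ∸ u))) ℤ.* (G (2 * u) ℤ.* G (2 * (n ∸ u)))) ≡
          𝟙 (P? (2 * u) (2 * (n ∸ u))) ℤ.* + T u (n ∸ u)
        value u u≤n = trans (move (+ ((2 * n) C (2 * u))) (𝟙 (P? (2 * u) (2 * (n ∸ u)))) (G (2 * u) ℤ.* G (2 * (n ∸ u))))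
          (cong (𝟙 (P? (2 * u) (2 * (n ∸ u))) ℤ.*_) (trans
            (cong₂ ℤ._*_ (cong +_ (sym (binom-∸ u≤n))) (sym (ℤ.pos-* (gemCount D (2 * u)) _)))
            (sym (ℤ.pos-* (binom (2 * u) (2 * (n ∸ u))) _))))

    -- The constant is `tailConstant D 0 = 2 + 2 * 1 ^ D`; with `s = 0` the extreme term is the
    -- number of GEMs on the whole set. Applied twice, it gives the 16 for triples.
    gemPairs≤ : ∀ k → gemPairs D k ℤ.≤ + 4 ℤ.* G k
    gemPairs≤ k with even-or-odd k
    ... | inj₂ (q , refl) = ℤ.≤-reflexive (trans (gemPairs-odd D q)
            (sym (cong (λ x → + 4 ℤ.* + x) (gemCount-odd D q))))
    ... | inj₁ (q , refl) = begin
      gemPairs D (2 * q)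
        ≡⟨ ∑splits-cong (2 * q) (λ i j _ → sym (ℤ.*-identityˡ (G i ℤ.* G j))) ⟩
      ∑splits (2 * q) (λ i j → 1ℤ ℤ.* (G i ℤ.* G j))
        ≤⟨ ∑splits-balanced (λ _ _ → yes tt) 0 q (λ _ _ _ → z≤n , z≤n) ⟩
      + (tailConstant D 0 * T 0 q)
        ≡⟨ cong +_ (cong₂ (λ c x → (2 + 2 * c) * x) (ℕ.^-zeroˡ D) (splitCount-zero q)) ⟩
      + (4 * gemCount D (2 * q))
        ≡⟨ ℤ.pos-* 4 (gemCount D (2 * q)) ⟩
      + 4 ℤ.* G (2 * q) ∎
      where open ℤ.≤-Reasoning

    gemTriples≤ : ∀ k → gemTriples D k ℤ.≤ + 16 ℤ.* G k
    gemTriples≤ k = begin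
      ∑splits k (λ i j → gemPairs D i ℤ.* G j)
        ≤⟨ ∑splits-mono k (λ i j _ → ℤ.*-monoʳ-≤-nonNeg (G j) (gemPairs≤ i)) ⟩
      ∑splits k (λ i j → + 4 ℤ.* G i ℤ.* G j)
        ≡⟨ trans (∑splits-cong k (λ i j _ → ℤ.*-assoc (+ 4) (G i) (G j))) (∑splits-*ˡ (+ 4) k (λ i j → G i ℤ.* G j)) ⟩
      + 4 ℤ.* gemPairs D k
        ≤⟨ ℤ.*-monoˡ-≤-nonNeg (+ 4) (gemPairs≤ k) ⟩
      + 4 ℤ.* (+ 4 ℤ.* G k)
        ≡⟨ ℤ.*-assoc (+ 4) (+ 4) (G k) ⟨
      + 16 ℤ.* G k ∎
      where open ℤ.≤-Reasoning

    -- Only even parts contribute, and one larger than `2 * r` has half-size at least `suc r`. This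
    -- shift makes the extreme term belong to the gauge of index `suc r`.
    ∑-flags≤ : ∀ r n → ∑[ g ∈ gems D (⊤ {2 * n}) ] flags (2 * r) g ℤ.≤
               + (16 * (tailConstant D (suc r) * T (suc r) (n ∸ suc r)))
    ∑-flags≤ r n = begin
      ∑[ g ∈ gems D (⊤ {2 * n}) ] flags (2 * r) g
        ≡⟨ ∑-flags D {2 * n} (2 * r) ⟩
      ∑splits (2 * n) (λ i j → 𝟙 (large? i j) ℤ.* gemTriples D i ℤ.* G j)
        ≤⟨ ∑splits-mono (2 * n) (λ i j _ → ℤ.*-monoʳ-≤-nonNeg (G j)
             (𝟙-*-mono (large? i j) (λ _ → gemTriples≤ i))) ⟩
      ∑splits (2 * n) (λ i j → 𝟙 (large? i j) ℤ.* (+ 16 ℤ.* G i) ℤ.* G j)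
        ≡⟨ trans (∑splits-cong (2 * n) (λ i j _ → ring (𝟙 (large? i j)) (+ 16) (G i) (G j)))
                 (∑splits-*ˡ (+ 16) (2 * n) (λ i j → 𝟙 (large? i j) ℤ.* (G i ℤ.* G j))) ⟩
      + 16 ℤ.* ∑splits (2 * n) (λ i j → 𝟙 (large? i j) ℤ.* (G i ℤ.* G j))
        ≤⟨ ℤ.*-monoˡ-≤-nonNeg (+ 16) (∑splits-balanced large? (suc r) n (λ u v (p , q) →
             ℕ.*-cancelˡ-< 2 r u p , ℕ.*-cancelˡ-< 2 r v q)) ⟩
      + 16 ℤ.* + (tailConstant D (suc r) * T (suc r) (n ∸ suc r))
        ≡⟨ ℤ.pos-* 16 (tailConstant D (suc r) * T (suc r) (n ∸ suc r)) ⟨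
      + (16 * (tailConstant D (suc r) * T (suc r) (n ∸ suc r))) ∎
      where
      open ℤ.≤-Reasoning

      large? : ∀ i j → Dec (2 * r < i × 2 * r < j)
      large? i j = (2 * r ℕ.<? i) ×-dec (2 * r ℕ.<? j)

      ring : ∀ a c x y → a ℤ.* (c ℤ.* x) ℤ.* y ≡ c ℤ.* (a ℤ.* (x ℤ.* y))
      ring = ℤSolver.solve-∀

  -- The threshold `2 * r` on `∣ W ∣` is precisely the truncation after `k = r`. Odd sizes of `W`
  -- drop out because the complement then has odd size and carries no GEM.
  ∑-weight≡ : ∀ m {r n} → r ≤ n →
    ∑[ g ∈ gems D (⊤ {2 * n}) ] weight (2 * r) (λ k → 𝟙 (k ℕ.≟ m)) g ≡
    sumTo r (λ k → 𝔡 D (2 * k) (suc m) ℤ.* + gaugeNum k n)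
  ∑-weight≡ m {r} {n} r≤n = begin
    ∑[ g ∈ gems D (⊤ {2 * n}) ] weight (2 * r) h g
      ≡⟨ ∑-weight D {2 * n} (2 * r) h ⟩
    ∑splits (2 * n) (λ i j → 𝟙 (i ℕ.≤? 2 * r) ℤ.* signedPairs D h i ℤ.* G j)
      ≡⟨ ∑splits-even n (λ i j → 𝟙 (i ℕ.≤? 2 * r) ℤ.* signedPairs D h i ℤ.* G j) (λ u v → trans
           (cong (λ k → 𝟙 (suc (2 * u) ℕ.≤? 2 * r) ℤ.* signedPairs D h (suc (2 * u)) ℤ.* + k) (gemCount-odd D v))
           (ℤ.*-zeroʳ (𝟙 (suc (2 * u) ℕ.≤? 2 * r) ℤ.* signedPairs D h (suc (2 * u))))) ⟩
    sumTo n term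
      ≡⟨ sumTo-truncate r≤n term (λ u r<u → trans
           (cong (λ z → + ((2 * n) C (2 * u)) ℤ.* (z ℤ.* signedPairs D h (2 * u) ℤ.* G (2 * (n ∸ u))))
             (𝟙-no (2 * u ℕ.≤? 2 * r) (λ le → ℕ.<⇒≱ r<u (ℕ.*-cancelˡ-≤ 2 le))))
           (ℤ.*-zeroʳ (+ ((2 * n) C (2 * u))))) ⟩
    sumTo r term
      ≡⟨ sumTo-cong r (λ u u≤r → trans
           (cong₂ (λ z d → + ((2 * n) C (2 * u)) ℤ.* (z ℤ.* d ℤ.* G (2 * (n ∸ u))))
             (𝟙-yes (2 * u ℕ.≤? 2 * r) (ℕ.*-monoʳ-≤ 2 u≤r)) (sym (𝔡≡signedPairs D (2 * u) m)))
           (trans (ring (+ ((2 * n) C (2 * u))) (𝔡 D (2 * u) (suc m)) (G (2 * (n ∸ u))))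
             (cong (𝔡 D (2 * u) (suc m) ℤ.*_) (sym (ℤ.pos-* ((2 * n) C (2 * u)) _))))) ⟩
    sumTo r (λ k → 𝔡 D (2 * k) (suc m) ℤ.* + gaugeNum k n) ∎
    where
    open ≡-Reasoning

    h : ℕ → ℤ
    h k = 𝟙 (k ℕ.≟ m)

    term : ℕ → ℤ
    term u = + ((2 * n) C (2 * u)) ℤ.* (𝟙 (2 * u ℕ.≤? 2 * r) ℤ.* signedPairs D h (2 * u) ℤ.* G (2 * (n ∸ u)))

    ring : ∀ c d g → c ℤ.* (1ℤ ℤ.* d ℤ.* g) ≡ d ℤ.* (c ℤ.* g)
    ring = ℤSolver.solve-∀

integerError : ∀ D → 2 ≤ D → ∀ m r → ∃ λ K → ∀ n → suc (r + r + r) ≤ n →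
  ℤ.∣ + length (filter (λ g → π₀ ⊤ g ℕ.≟ suc m) (gems D {2 * n} ⊤)) ℤ.-
      sumTo r (λ k → 𝔡 D (2 * k) (suc m) ℤ.* + gaugeNum D k n) ∣ ≤ K * gaugeNum D (suc r) n
integerError D 2≤D m r = K , λ n 3r<n → ℤ.drop‿+≤+ (bound n 3r<n)
  where
  c K : ℕ
  c = 16 * tailConstant D (suc r)
  -- The 2 comes from the bound by twice `flags`, the 16 in `c` from `gemTriples≤`, and `gemCount`
  -- converts the split count into the gauge.
  K = 2 * (c * gemCount D (2 * suc r))

  bound : ∀ n → suc (r + r + r) ≤ n →
    + ℤ.∣ + length (filter (λ g → π₀ ⊤ g ℕ.≟ suc m) (gems D {2 * n} ⊤)) ℤ.-
          sumTo r (λ k → 𝔡 D (2 * k) (suc m) ℤ.* + gaugeNum D k n) ∣ ℤ.≤ + (K * gaugeNum D (suc r) n)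
  bound n 3r<n = begin
    + ℤ.∣ + length (filter (λ g → π₀ ⊤ g ℕ.≟ suc m) all) ℤ.-
          sumTo r (λ k → 𝔡 D (2 * k) (suc m) ℤ.* + gaugeNum D k n) ∣
      ≡⟨ cong (λ z → + ℤ.∣ z ∣) (trans
           (cong₂ ℤ._-_ (length-filter (λ g → π₀ ⊤ g ℕ.≟ suc m) all) (sym (∑-weight≡ D m {r} {n} (ℕ.≤-trans (ℕ.n≤1+n r) r<n))))
           (sym (∑-- all (λ g → 𝟙 (π₀ ⊤ g ℕ.≟ suc m)) (weight (2 * r) (λ k → 𝟙 (k ℕ.≟ m)))))) ⟩
    + ℤ.∣ ∑ all (λ g → 𝟙 (π₀ ⊤ g ℕ.≟ suc m) ℤ.- weight (2 * r) (λ k → 𝟙 (k ℕ.≟ m)) g) ∣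
      ≤⟨ ∑-abs all (λ g g∈ → ∣error∣≤flags (2 * r) 6r<2n m {g} (gems-∈⁻ {U = ⊤} g∈)) ⟩
    ∑ all (λ g → flags (2 * r) g ℤ.+ flags (2 * r) g)
      ≡⟨ ∑-+ all (flags (2 * r)) (flags (2 * r)) ⟩
    ∑ all (flags (2 * r)) ℤ.+ ∑ all (flags (2 * r))
      ≤⟨ ℤ.+-mono-≤ (∑-flags≤ D 2≤D r n) (∑-flags≤ D 2≤D r n) ⟩
    + (16 * (tailConstant D (suc r) * t) + 16 * (tailConstant D (suc r) * t))
      ≡⟨ cong +_ (trans (double (tailConstant D (suc r)) t) (trans
           (cong (λ t → 2 * (c * t)) (splitCount≡gaugeNum D {suc r} {n} r<n))
           (regroup c (gemCount D (2 * suc r)) (gaugeNum D (suc r) n)))) ⟩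
    + (K * gaugeNum D (suc r) n) ∎
    where
    open ℤ.≤-Reasoning

    all : List (Matchings D (2 * n))
    all = gems D ⊤

    t : ℕ
    t = splitCount D (suc r) (n ∸ suc r)

    r<n : suc r ≤ n
    r<n = ℕ.≤-trans (s≤s (ℕ.m≤n+m r (r + r))) 3r<n

    -- The condition of `∣error∣≤flags` for threshold `2 * r` on `2 * n` vertices.
    6r<2n : 2 * r + 2 * r + 2 * r < 2 * n
    6r<2n = subst (_< 2 * n) (six r) (ℕ.*-monoʳ-< 2 3r<n)
      where
      six : ∀ r → 2 * (r + r + r) ≡ 2 * r + 2 * r + 2 * r
      six = ℕSolver.solve-∀

    double : ∀ a t → 16 * (a * t) + 16 * (a * t) ≡ 2 * (16 * a * t)
    double = ℕSolver.solve-∀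

    regroup : ∀ c g x → 2 * (c * (x * g)) ≡ 2 * (c * g) * x
    regroup = ℕSolver.solve-∀

-- Inherited from `splitCount-decay`: the factor `gemCount D (2 * suc k)` introduced on the left is
-- at least 1, and the one on the right joins the constant.
gaugeNum-decay : ∀ D → 2 ≤ D → ∀ k n → suc k ≤ n →
  n * gaugeNum D (suc k) n ≤ suc (2 * k) ^ D * gemCount D (2 * k) * gaugeNum D k n
gaugeNum-decay D 2≤D k n k<n with ℕ.m≤n⇒∃[o]m+o≡n k<n
... | w , refl = begin
  n * gaugeNum D (suc k) n
    ≤⟨ ℕ.*-monoʳ-≤ n (ℕ.m≤m*n (gaugeNum D (suc k) n) (gemCount D (2 * suc k)) {{gemCount-nonZero D (suc k)}}) ⟩
  n * (gaugeNum D (suc k) n * gemCount D (2 * suc k))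
    ≡⟨ cong (n *_) (trans (sym (splitCount≡gaugeNum D {suc k} {n} k<n))
         (cong (splitCount D (suc k)) (ℕ.m+n∸m≡n (suc k) w))) ⟩
  n * splitCount D (suc k) w
    ≡⟨ cong (_* splitCount D (suc k) w) (sym (ℕ.+-suc k w)) ⟩
  (k + suc w) * splitCount D (suc k) w
    ≤⟨ splitCount-decay D 2≤D k w ⟩
  suc (2 * k) ^ D * splitCount D k (suc w)
    ≡⟨ cong (suc (2 * k) ^ D *_) (trans
         (cong (splitCount D k) (sym (trans (cong (_∸ k) (sym (ℕ.+-suc k w))) (ℕ.m+n∸m≡n k (suc w)))))
         (splitCount≡gaugeNum D {k} {n} (ℕ.≤-trans (ℕ.n≤1+n k) k<n))) ⟩
  suc (2 * k) ^ D * (gaugeNum D k n * gemCount D (2 * k))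
    ≡⟨ ring (suc (2 * k) ^ D) (gaugeNum D k n) (gemCount D (2 * k)) ⟩
  suc (2 * k) ^ D * gemCount D (2 * k) * gaugeNum D k n ∎
  where
  open ℕ.≤-Reasoning

  ring : ∀ a b c → a * (b * c) ≡ a * c * b
  ring = ℕSolver.solve-∀

-- Division by the number of GEMs

-- Normalised fractions do not compute symbolically. Through this bridge the identities for `/`
-- become ring identities over ℤ between unnormalised fractions.
toℚᵘ-/ : ∀ i d → ℚ.toℚᵘ (i / suc d) ℚᵘ.≃ mkℚᵘ i d
toℚᵘ-/ i d = ℚ.toℚᵘ-fromℚᵘ (mkℚᵘ i d)

/1-+ : ∀ i j → (i ℤ.+ j) / 1 ≡ (i / 1) ℚ.+ (j / 1)
/1-+ i j = ℚ.toℚᵘ-injective (begin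
  ℚ.toℚᵘ ((i ℤ.+ j) / 1)               ≈⟨ toℚᵘ-/ (i ℤ.+ j) 0 ⟩
  mkℚᵘ (i ℤ.+ j) 0                     ≈⟨ *≡* (ring i j) ⟩
  mkℚᵘ i 0 ℚᵘ.+ mkℚᵘ j 0               ≈⟨ ℚᵘ.+-cong (toℚᵘ-/ i 0) (toℚᵘ-/ j 0) ⟨
  ℚ.toℚᵘ (i / 1) ℚᵘ.+ ℚ.toℚᵘ (j / 1)   ≈⟨ ℚ.toℚᵘ-homo-+ (i / 1) (j / 1) ⟨
  ℚ.toℚᵘ ((i / 1) ℚ.+ (j / 1))         ∎)
  where
  open ℚᵘ.≃-Reasoning

  ring : ∀ i j → (i ℤ.+ j) ℤ.* 1ℤ ≡ (i ℤ.* 1ℤ ℤ.+ j ℤ.* 1ℤ) ℤ.* 1ℤ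
  ring = ℤSolver.solve-∀

/1-neg : ∀ i → (ℤ.- i) / 1 ≡ ℚ.- (i / 1)
/1-neg i = ℚ.toℚᵘ-injective (begin
  ℚ.toℚᵘ ((ℤ.- i) / 1)     ≈⟨ toℚᵘ-/ (ℤ.- i) 0 ⟩
  ℚᵘ.- (mkℚᵘ i 0)          ≈⟨ ℚᵘ.-‿cong (toℚᵘ-/ i 0) ⟨
  ℚᵘ.- (ℚ.toℚᵘ (i / 1))    ≈⟨ ℚ.toℚᵘ-homo‿- (i / 1) ⟨
  ℚ.toℚᵘ (ℚ.- (i / 1))     ∎)
  where open ℚᵘ.≃-Reasoning

/1-* : ∀ i j → (i ℤ.* j) / 1 ≡ (i / 1) ℚ.* (j / 1)
/1-* i j = ℚ.toℚᵘ-injective (begin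
  ℚ.toℚᵘ ((i ℤ.* j) / 1)               ≈⟨ toℚᵘ-/ (i ℤ.* j) 0 ⟩
  mkℚᵘ i 0 ℚᵘ.* mkℚᵘ j 0               ≈⟨ ℚᵘ.*-cong (toℚᵘ-/ i 0) (toℚᵘ-/ j 0) ⟨
  ℚ.toℚᵘ (i / 1) ℚᵘ.* ℚ.toℚᵘ (j / 1)   ≈⟨ ℚ.toℚᵘ-homo-* (i / 1) (j / 1) ⟨
  ℚ.toℚᵘ ((i / 1) ℚ.* (j / 1))         ∎)
  where open ℚᵘ.≃-Reasoning

/1-mono : ∀ {i j} → i ℤ.≤ j → (i / 1) ℚ.≤ (j / 1)
/1-mono {i} {j} i≤j = ℚ.toℚᵘ-cancel-≤ (begin
  ℚ.toℚᵘ (i / 1)  ≃⟨ toℚᵘ-/ i 0 ⟩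
  mkℚᵘ i 0        ≤⟨ *≤* (ℤ.*-monoʳ-≤-nonNeg 1ℤ i≤j) ⟩
  mkℚᵘ j 0        ≃⟨ toℚᵘ-/ j 0 ⟨
  ℚ.toℚᵘ (j / 1)  ∎)
  where open ℚᵘ.≤-Reasoning

/1-abs : ∀ i → ℚ.∣ i / 1 ∣ ≡ (+ ℤ.∣ i ∣) / 1
/1-abs i = ℚ.toℚᵘ-injective (begin
  ℚ.toℚᵘ ℚ.∣ i / 1 ∣          ≈⟨ ℚ.toℚᵘ-homo-∣-∣ (i / 1) ⟩
  ℚᵘ.∣ ℚ.toℚᵘ (i / 1) ∣       ≈⟨ ℚᵘ.∣-∣-cong (toℚᵘ-/ i 0) ⟩
  ℚᵘ.∣ mkℚᵘ i 0 ∣             ≈⟨ toℚᵘ-/ (+ ℤ.∣ i ∣) 0 ⟨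
  ℚ.toℚᵘ ((+ ℤ.∣ i ∣) / 1)    ∎)
  where open ℚᵘ.≃-Reasoning

/1-*-/ : ∀ i d .{{_ : NonZero d}} → (+ d / 1) ℚ.* (i / d) ≡ i / 1
/1-*-/ i (suc d) = ℚ.toℚᵘ-injective (begin
  ℚ.toℚᵘ ((+ suc d / 1) ℚ.* (i / suc d))             ≈⟨ ℚ.toℚᵘ-homo-* (+ suc d / 1) (i / suc d) ⟩
  ℚ.toℚᵘ (+ suc d / 1) ℚᵘ.* ℚ.toℚᵘ (i / suc d)       ≈⟨ ℚᵘ.*-cong (toℚᵘ-/ (+ suc d) 0) (toℚᵘ-/ i d) ⟩
  mkℚᵘ (+ suc d) 0 ℚᵘ.* mkℚᵘ i d                     ≈⟨ *≡* (trans (ring (+ suc d) i)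
                                                          (cong (λ k → i ℤ.* + suc k) (sym (ℕ.+-identityʳ d)))) ⟩
  mkℚᵘ i 0                                           ≈⟨ toℚᵘ-/ i 0 ⟨
  ℚ.toℚᵘ (i / 1)                                     ∎)
  where
  open ℚᵘ.≃-Reasoning

  ring : ∀ d i → d ℤ.* i ℤ.* 1ℤ ≡ i ℤ.* d
  ring = ℤSolver.solve-∀

/1-pos : ∀ k .{{_ : NonZero k}} → ℚ.Positive (+ k / 1)
/1-pos k = ℚ.normalize-pos k 1

/1-^ : ∀ d k → + (d ^ k) / 1 ≡ (+ d / 1) ^ℚ k
/1-^ d zero    = refl
/1-^ d (suc k) = trans (cong (_/ 1) (ℤ.pos-* d (d ^ k)))
  (trans (/1-* (+ d) (+ (d ^ k))) (cong ((+ d / 1) ℚ.*_) (/1-^ d k)))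

ℚ-*-comm-middle : ∀ a b c d → (a ℚ.* b) ℚ.* (c ℚ.* d) ≡ (a ℚ.* c) ℚ.* (b ℚ.* d)
ℚ-*-comm-middle a b c d = trans (ℚ.*-assoc a b (c ℚ.* d)) (trans
  (cong (a ℚ.*_) (trans (sym (ℚ.*-assoc b c d)) (trans (cong (ℚ._* d) (ℚ.*-comm b c)) (ℚ.*-assoc c b d))))
  (sym (ℚ.*-assoc a c (b ℚ.* d))))

ℚ-*-left-comm : ∀ a b c → a ℚ.* (b ℚ.* c) ≡ b ℚ.* (a ℚ.* c)
ℚ-*-left-comm a b c = trans (sym (ℚ.*-assoc a b c)) (trans (cong (ℚ._* c) (ℚ.*-comm a b)) (ℚ.*-assoc b a c))

^ℚ-distrib-* : ∀ x y k → (x ℚ.* y) ^ℚ k ≡ x ^ℚ k ℚ.* y ^ℚ k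
^ℚ-distrib-* x y zero    = refl
^ℚ-distrib-* x y (suc k) = trans (cong ((x ℚ.* y) ℚ.*_) (^ℚ-distrib-* x y k))
  (ℚ-*-comm-middle x y (x ^ℚ k) (y ^ℚ k))

module _ (D : ℕ) where

  gemTotal : ℕ → ℕ
  gemTotal n = ⟦2 n -1⟧!! ^ suc D

  instance
    gemTotal-nonZero : ∀ {n} → NonZero (gemTotal n)
    gemTotal-nonZero {n} = ℕ.m^n≢0 ⟦2 n -1⟧!! (suc D) {{doubleFactorial-nonZero n}}

  private
    Γ : ℕ → ℚ
    Γ n = + gemTotal n / 1

    Γ-pos : ∀ n → ℚ.Positive (Γ n)
    Γ-pos n = /1-pos (gemTotal n) {{gemTotal-nonZero {n}}}

  -- Multiplication by the number of GEMs clears all denominators: gauges, probabilities and partial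
  -- sums become integers. As `Γ n` is positive, it can be cancelled from inequalities afterwards.
  Γ*gauge : ∀ k n → Γ n ℚ.* gauge D k n ≡ + gaugeNum D k n / 1
  Γ*gauge k n = begin
    Γ n ℚ.* (c ℚ.* x ^ℚ suc D)
      ≡⟨ ℚ-*-left-comm (Γ n) c (x ^ℚ suc D) ⟩
    c ℚ.* (Γ n ℚ.* x ^ℚ suc D)
      ≡⟨ cong (λ z → c ℚ.* (z ℚ.* x ^ℚ suc D)) (/1-^ ⟦2 n -1⟧!! (suc D)) ⟩
    c ℚ.* ((+ ⟦2 n -1⟧!! / 1) ^ℚ suc D ℚ.* x ^ℚ suc D)
      ≡⟨ cong (c ℚ.*_) (^ℚ-distrib-* (+ ⟦2 n -1⟧!! / 1) x (suc D)) ⟨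
    c ℚ.* ((+ ⟦2 n -1⟧!! / 1) ℚ.* x) ^ℚ suc D
      ≡⟨ cong (λ z → c ℚ.* z ^ℚ suc D)
           (/1-*-/ (+ ⟦2 n ∸ k -1⟧!!) ⟦2 n -1⟧!! {{doubleFactorial-nonZero n}}) ⟩
    c ℚ.* (+ ⟦2 n ∸ k -1⟧!! / 1) ^ℚ suc D
      ≡⟨ cong (c ℚ.*_) (/1-^ ⟦2 n ∸ k -1⟧!! (suc D)) ⟨
    c ℚ.* (+ (⟦2 n ∸ k -1⟧!! ^ suc D) / 1)
      ≡⟨ /1-* (+ ((2 * n) C (2 * k))) (+ (⟦2 n ∸ k -1⟧!! ^ suc D)) ⟨
    (+ ((2 * n) C (2 * k)) ℤ.* + (⟦2 n ∸ k -1⟧!! ^ suc D)) / 1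
      ≡⟨ cong (_/ 1) (ℤ.pos-* ((2 * n) C (2 * k)) (⟦2 n ∸ k -1⟧!! ^ suc D)) ⟨
    + (((2 * n) C (2 * k)) * ⟦2 n ∸ k -1⟧!! ^ suc D) / 1
      ≡⟨ cong (λ g → + (((2 * n) C (2 * k)) * g) / 1) (gemCount-even D (n ∸ k)) ⟨
    + gaugeNum D k n / 1 ∎
    where
    open ≡-Reasoning

    c x : ℚ
    c = + ((2 * n) C (2 * k)) / 1
    x = _/_ (+ ⟦2 n ∸ k -1⟧!!) ⟦2 n -1⟧!! {{doubleFactorial-nonZero n}}

  Γ*∣_∣ : ∀ {n} x → Γ n ℚ.* ℚ.∣ x ∣ ≡ ℚ.∣ Γ n ℚ.* x ∣
  Γ*∣_∣ {n} x = trans (cong (ℚ._* ℚ.∣ x ∣) (sym (/1-abs (+ gemTotal n)))) (sym (ℚ.∣p*q∣≡∣p∣*∣q∣ (Γ n) x))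

  Γ*∣gauge∣ : ∀ k n → Γ n ℚ.* ℚ.∣ gauge D k n ∣ ≡ + gaugeNum D k n / 1
  Γ*∣gauge∣ k n = trans (Γ*∣_∣ {n} (gauge D k n))
    (trans (cong ℚ.∣_∣ (Γ*gauge k n)) (/1-abs (+ gaugeNum D k n)))

  componentCount : ℕ → ℕ → ℕ
  componentCount m n = length (filter (λ g → π₀ ⊤ g ℕ.≟ m) (gems D {2 * n} ⊤))

  Γ*ℙ : ∀ m n → Γ n ℚ.* ℙ D m n ≡ + componentCount m n / 1
  Γ*ℙ m n = trans (cong (λ k → (+ k / 1) ℚ.* ℙ D m n) (sym total))
    (/1-*-/ (+ componentCount m n) (length (gems D {2 * n} ⊤)) {{gems-nonZero D n}})
    where
    total : length (gems D {2 * n} ⊤) ≡ gemTotal n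
    total = trans (length-gems D (⊤ {2 * n})) (trans (cong (gemCount D) (∣⊤∣≡n (2 * n))) (gemCount-even D n))

  Γ*sum≤ : ∀ (c : ℕ → ℤ) r n → Γ n ℚ.* sum≤ r (λ k → (c k / 1) ℚ.* gauge D k n) ≡
           sumTo r (λ k → c k ℤ.* + gaugeNum D k n) / 1
  Γ*sum≤ c r n = go r
    where
    term : ∀ k → Γ n ℚ.* ((c k / 1) ℚ.* gauge D k n) ≡ (c k ℤ.* + gaugeNum D k n) / 1
    term k = trans (ℚ-*-left-comm (Γ n) (c k / 1) (gauge D k n))
      (trans (cong ((c k / 1) ℚ.*_) (Γ*gauge k n)) (sym (/1-* (c k) (+ gaugeNum D k n))))

    go : ∀ r → Γ n ℚ.* sum≤ r (λ k → (c k / 1) ℚ.* gauge D k n) ≡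
               sumTo r (λ k → c k ℤ.* + gaugeNum D k n) / 1
    go zero    = term zero
    go (suc r) = trans (ℚ.*-distribˡ-+ (Γ n) _ _) (trans (cong₂ ℚ._+_ (go r) (term (suc r)))
      (sym (/1-+ (sumTo r (λ k → c k ℤ.* + gaugeNum D k n)) (c (suc r) ℤ.* + gaugeNum D (suc r) n))))

  module _ (2≤D : 2 ≤ D) where

    gauge-=o : ∀ k → gauge D (suc k) =o gauge D k
    -- A positive `δ` is at least 1 over its denominator, so `n ≥ c * ℚ.↧ₙ δ` gives c ≤ n δ; `suc k`
    -- puts `n` in the range of `gaugeNum-decay`.
    gauge-=o k δ 0<δ = suc k + c * ℚ.↧ₙ δ , λ n n₀≤n → bound n
        (ℕ.≤-trans (ℕ.m≤m+n (suc k) (c * ℚ.↧ₙ δ)) n₀≤n) (ℕ.≤-trans (ℕ.m≤n+m (c * ℚ.↧ₙ δ) (suc k)) n₀≤n)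
      where
      c : ℕ
      c = suc (2 * k) ^ D * gemCount D (2 * k)

      1≤↥ : ∀ p → 0ℚ ℚ.< p → 1ℤ ℤ.≤ ℚ.↥ p
      1≤↥ p 0<p = numerator p {{ℚ.positive 0<p}}
        where
        numerator : ∀ p {{_ : ℚ.Positive p}} → 1ℤ ℤ.≤ ℚ.↥ p
        numerator (ℚ.mkℚ ℤ.+[1+ _ ] _ _) = ℤ.+≤+ (s≤s z≤n)

      c≤nδ : ∀ n → c * ℚ.↧ₙ δ ≤ n → (+ c / 1) ℚ.≤ (+ n / 1) ℚ.* δ
      c≤nδ n cq≤n = begin
        + c / 1
          ≡⟨ cong (_/ 1) (ℤ.*-identityʳ (+ c)) ⟨
        (+ c ℤ.* 1ℤ) / 1
          ≤⟨ /1-mono (ℤ.*-monoˡ-≤-nonNeg (+ c) (1≤↥ δ 0<δ)) ⟩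
        (+ c ℤ.* ℚ.↥ δ) / 1
          ≡⟨ /1-* (+ c) (ℚ.↥ δ) ⟩
        (+ c / 1) ℚ.* (ℚ.↥ δ / 1)
          ≡⟨ cong ((+ c / 1) ℚ.*_) (trans (sym (/1-*-/ (ℚ.↥ δ) (ℚ.↧ₙ δ)))
               (cong ((+ ℚ.↧ₙ δ / 1) ℚ.*_) (ℚ.↥p/↧p≡p δ))) ⟩
        (+ c / 1) ℚ.* ((+ ℚ.↧ₙ δ / 1) ℚ.* δ)
          ≡⟨ ℚ.*-assoc (+ c / 1) (+ ℚ.↧ₙ δ / 1) δ ⟨
        ((+ c / 1) ℚ.* (+ ℚ.↧ₙ δ / 1)) ℚ.* δ
          ≡⟨ cong (ℚ._* δ) (trans (sym (/1-* (+ c) (+ ℚ.↧ₙ δ))) (cong (_/ 1) (sym (ℤ.pos-* c (ℚ.↧ₙ δ))))) ⟩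
        (+ (c * ℚ.↧ₙ δ) / 1) ℚ.* δ
          ≤⟨ ℚ.*-monoʳ-≤-nonNeg δ {{ℚ.nonNegative (ℚ.<⇒≤ 0<δ)}} (/1-mono (ℤ.+≤+ cq≤n)) ⟩
        (+ n / 1) ℚ.* δ ∎
        where open ℚ.≤-Reasoning

      bound : ∀ n → suc k ≤ n → c * ℚ.↧ₙ δ ≤ n → ℚ.∣ gauge D (suc k) n ∣ ℚ.≤ δ ℚ.* ℚ.∣ gauge D k n ∣
      bound n k<n cq≤n = ℚ.*-cancelˡ-≤-pos (Γ n) {{Γ-pos n}} (ℚ.*-cancelˡ-≤-pos (+ n / 1) {{/1-pos n {{ℕ.>-nonZero (ℕ.≤-trans (s≤s z≤n) k<n)}}}} (begin
        (+ n / 1) ℚ.* (Γ n ℚ.* ℚ.∣ gauge D (suc k) n ∣)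
          ≡⟨ cong ((+ n / 1) ℚ.*_) (Γ*∣gauge∣ (suc k) n) ⟩
        (+ n / 1) ℚ.* (+ gaugeNum D (suc k) n / 1)
          ≡⟨ trans (sym (/1-* (+ n) (+ gaugeNum D (suc k) n))) (cong (_/ 1) (sym (ℤ.pos-* n (gaugeNum D (suc k) n)))) ⟩
        + (n * gaugeNum D (suc k) n) / 1
          ≤⟨ /1-mono (ℤ.+≤+ (gaugeNum-decay D 2≤D k n k<n)) ⟩
        + (c * gaugeNum D k n) / 1
          ≡⟨ trans (cong (_/ 1) (ℤ.pos-* c (gaugeNum D k n))) (/1-* (+ c) (+ gaugeNum D k n)) ⟩
        (+ c / 1) ℚ.* (+ gaugeNum D k n / 1)
          ≤⟨ ℚ.*-monoʳ-≤-nonNeg (+ gaugeNum D k n / 1) {{nonNeg}} (c≤nδ n cq≤n) ⟩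
        ((+ n / 1) ℚ.* δ) ℚ.* (+ gaugeNum D k n / 1)
          ≡⟨ ℚ.*-assoc (+ n / 1) δ (+ gaugeNum D k n / 1) ⟩
        (+ n / 1) ℚ.* (δ ℚ.* (+ gaugeNum D k n / 1))
          ≡⟨ cong (λ z → (+ n / 1) ℚ.* (δ ℚ.* z)) (Γ*∣gauge∣ k n) ⟨
        (+ n / 1) ℚ.* (δ ℚ.* (Γ n ℚ.* ℚ.∣ gauge D k n ∣))
          ≡⟨ cong ((+ n / 1) ℚ.*_) (ℚ-*-left-comm δ (Γ n) ℚ.∣ gauge D k n ∣) ⟩
        (+ n / 1) ℚ.* (Γ n ℚ.* (δ ℚ.* ℚ.∣ gauge D k n ∣)) ∎))
        where
        open ℚ.≤-Reasoning

        nonNeg : ℚ.NonNegative (+ gaugeNum D k n / 1)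
        nonNeg = ℚ.normalize-nonNeg (gaugeNum D k n) 1

    ℙ-error-=O : ∀ m r →
      (λ n → ℙ D (suc m) n ℚ.- sum≤ r (λ k → (𝔡 D (2 * k) (suc m) / 1) ℚ.* gauge D k n)) =O gauge D (suc r)
    ℙ-error-=O m r = + K / 1 , suc (r + r + r) , λ n n₀≤n → ℚ.*-cancelˡ-≤-pos (Γ n) {{Γ-pos n}} (begin
      Γ n ℚ.* ℚ.∣ ℙ D (suc m) n ℚ.- S n ∣
        ≡⟨ Γ*∣_∣ {n} (ℙ D (suc m) n ℚ.- S n) ⟩
      ℚ.∣ Γ n ℚ.* (ℙ D (suc m) n ℚ.- S n) ∣
        ≡⟨ cong ℚ.∣_∣ (Γ*error n) ⟩
      ℚ.∣ error n / 1 ∣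
        ≡⟨ /1-abs (error n) ⟩
      + ℤ.∣ error n ∣ / 1
        ≤⟨ /1-mono (ℤ.+≤+ (proj₂ (integerError D 2≤D m r) n n₀≤n)) ⟩
      + (K * gaugeNum D (suc r) n) / 1
        ≡⟨ trans (cong (_/ 1) (ℤ.pos-* K (gaugeNum D (suc r) n))) (/1-* (+ K) (+ gaugeNum D (suc r) n)) ⟩
      (+ K / 1) ℚ.* (+ gaugeNum D (suc r) n / 1)
        ≡⟨ cong ((+ K / 1) ℚ.*_) (Γ*∣gauge∣ (suc r) n) ⟨
      (+ K / 1) ℚ.* (Γ n ℚ.* ℚ.∣ gauge D (suc r) n ∣)
        ≡⟨ ℚ-*-left-comm (+ K / 1) (Γ n) ℚ.∣ gauge D (suc r) n ∣ ⟩
      Γ n ℚ.* ((+ K / 1) ℚ.* ℚ.∣ gauge D (suc r) n ∣) ∎)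
      where
      open ℚ.≤-Reasoning

      K : ℕ
      K = proj₁ (integerError D 2≤D m r)

      S : ℕ → ℚ
      S n = sum≤ r (λ k → (𝔡 D (2 * k) (suc m) / 1) ℚ.* gauge D k n)

      s error : ℕ → ℤ
      s n = sumTo r (λ k → 𝔡 D (2 * k) (suc m) ℤ.* + gaugeNum D k n)
      error n = + componentCount (suc m) n ℤ.- s n

      Γ*error : ∀ n → Γ n ℚ.* (ℙ D (suc m) n ℚ.- S n) ≡ error n / 1
      Γ*error n = trans (ℚ.*-distribˡ-+ (Γ n) (ℙ D (suc m) n) (ℚ.- S n))
        (trans (cong₂ ℚ._+_ (Γ*ℙ (suc m) n) (trans (sym (ℚ.neg-distribʳ-* (Γ n) (S n)))
                 (trans (cong ℚ.-_ (Γ*sum≤ (λ k → 𝔡 D (2 * k) (suc m)) r n)) (sym (/1-neg (s n))))))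
               (sym (/1-+ (+ componentCount (suc m) n) (ℤ.- s n))))

proposition4p16 : ∀ (D : ℕ) → 2 ≤ D → ∀ (m : ℕ) .{{_ : NonZero m}} →
    ℙ D m ≈∑ (λ k → 𝔡 D (2 * k) m / 1) · gauge D
-- With `m` in successor form, the truncated `m ∸ 1` in `𝔡` reduces.
proposition4p16 D 2≤D (suc m) = gauge-=o D 2≤D , ℙ-error-=O D 2≤D m
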